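{- Let $m\geq 3$ and let $\chi_1,\chi_2$ be multiplicative characters modulo $2^m$ with $\chi_2$ primitive. Let $A,B,k$ be integers with $k\geq 1$, $A$ even and $B$ odd, and write $$A=2^nA_1,\ n>0,\qquad k=2^tk_1,\qquad 2\nmid A_1k_1B,$$ and set $$S=\sum_{x=1}^{2^m}\chi_1(x)\chi_2(Ax^k+B).$$ Let $c_1,c_2$ be the integers with $\chi_i(5)=e_{2^{m-2}}(c_i)$ and $1\leq c_i\leq 2^{m-2}$ ($i=1,2$), where $e_q(x)=e^{2\pi i x/q}$. For $i\geq 2$ let $R_i$ be the odd integer defined by $5^{2^{i-2}}=1+R_i2^i$. Define $$N:=\begin{cases}\lceil \tfrac12(m-n)\rceil, & \text{if } m-n>2t+4,\\ t+2, & \text{if } t+2\leq m-n\leq 2t+4,\end{cases}$$ and $$C(x):=c_1(Ax^k+B)+c_2Akx^kR_NR_{N+n}^{ -1},$$ where $R_{N+n}^{ -1}$ denotes the inverse of $R_{N+n}$ modulo $2^m$. By the characteristic equation we mean the congruence $$C(x_0)\equiv 0 \pmod{2^{\lfloor \frac12(m+n)\rfloor+t}}$$ in an integer $x_0$ with $2\nmid x_0(Ax_0^k+B)$. Suppose that $m-n\geq t+2$. Then $S=0$ unless all of the following hold: $c_1=2^{n+t}c_3$ with $c_3$ an odd integer; $\chi_1(-1)=1$ if $k$ is even; and, when $m-n>2t+4$, the characteristic equation has an odd solution $x_0$. Assume these conditions hold. Then: (i) If $m-n>2t+4$, let $x_0$ be an odd solution of the characteristic equation, write $C(x_0)=\lambda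 2^{\lfloor\frac12(m+n)\rfloor+t}$ with $\lambda\in\mathbb Z$, and put $h:=2\lambda+(k_1-1)+(2^n-1)c_3$. Then $$S=2^{\frac12(m+n)+t+\min\{1,t\}}\chi_1(x_0)\chi_2(Ax_0^k+B)\cdot\begin{cases}1, & \text{if } m-n \text{ is even},\\ \omega^h\left(\frac{2}{h}\right), & \text{if } m-n \text{ is odd},\end{cases}$$ where $\omega=e^{\pi i/4}$ and $\left(\frac{2}{h}\right)$ is the Jacobi symbol. (ii) If $t+3<m-n\leq 2t+4$, then $$S=\begin{cases}2^{m-1}\chi_2(A+B), & \text{if } k \text{ is even and } C(1)\equiv 0 \bmod 2^{m-2},\\ 2^{m-2}\chi_2(A+B), & \text{if } k \text{ is odd and } C(1)\equiv 0 \bmod 2^{m-2},\\ 2^{m-2}\chi_1(-1)\chi_2(-A+B), & \text{if } k \text{ is odd and } C(-1)\equiv 0 \bmod 2^{m-2},\\ 0, & \text{otherwise}.\end{cases}$$ (iii) If $m-n=t+3$, then $$S=\begin{cases}2^{m-1}\chi_2(A+B), & \text{if } k \text{ is even and } \chi_1(5)=\pm1,\ \chi_1(-1)=1,\\ 2^{m-2}\bigl(\chi_2(A+B)+\chi_1(-1)\chi_2(-A+B)\bigr), & \text{if } k \text{ is odd and } \chi_1(5)=\pm 1,\\ 0, & \text{otherwise}.\end{cases}$$ (iv) If $m-n=t+2$, then $$S=\begin{cases}2^{m-1}\chi_2(A+B), & \text{if } k \text{ is even and } \chi_1=\chi_0, \text{ or } k \text{ is odd and } \chi_1=\chi_4,\\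 0, & \text{otherwise},\end{cases}$$ where $\chi_0$ is the principal character modulo $2^m$ and $\chi_4$ is the character modulo $2^m$ induced by the non-trivial character modulo $4$ (i.e. $\chi_4(x)=\pm1$ according as $x\equiv\pm1 \bmod 4$).
   Context: Characters modulo $2^m$ are extended by $\chi(x)=0$ for even $x$. Since $(\mathbb Z/2^m\mathbb Z)^*$ is generated by $-1$ and $5$, with $5$ of order $2^{m-2}$, each character mod $2^m$ is determined by its values at $-1$ and $5$; primitivity of $\chi_2$ means $c_2$ is odd. Throughout, $y^{ -1}$ denotes the inverse of an odd integer $y$ modulo $2^m$. -}

module Defs where

open import Algebra.Apartness.Bundles using (HeytingField)
open import Algebra.Bundles using (CommutativeRing)
import Algebra.Properties.Monoid.Sum as MonoidSum
import Algebra.Properties.Semiring.Exp as Exp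
import Algebra.Properties.Semiring.Mult as Mult
open import Data.Bool.Base using (if_then_else_)
open import Data.Fin.Base using (Fin; toℕ)
open import Data.Fin.Properties using (any?)
open import Data.Integer.Base as ℤ using (ℤ; +_; -[1+_]; ∣_∣)
open import Data.Integer.Coprimality using (Coprime; coprime?)
open import Data.Integer.Divisibility using (_∣_)
open import Data.List.Base using (foldr)
open import Data.Nat.Base as ℕ using (ℕ; zero; suc; NonZero; ⌈_/2⌉)
import Data.Nat.Divisibility as ℕ
import Data.Nat.Properties as ℕ
open import Data.Nat.Primality.Factorisation using (factorise; PrimeFactorisation)
open import Data.Rational.Base as ℚ using (ℚ; ½)
open import Level as Level using (_⊔_)
open import Relation.Nullary.Decidable using (does)
open import Relation.Nullary.Negation using (¬_)

infix 4 _≡_[mod_]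
_≡_[mod_] : ℤ → ℤ → ℕ → Set
a ≡ b [mod q ] = + q ∣ a ℤ.- b

-- The division is exact for i ≥ 2, and then 5 ^ 2 ^ (i - 2) = 1 + R i * 2 ^ i.
R : ℕ → ℤ
R i = + (ℕ._/_ (5 ℕ.^ (2 ℕ.^ (i ℕ.∸ 2)) ℕ.∸ 1) (2 ℕ.^ i) {{ℕ.m^n≢0 2 i}})

N : (m n t : ℕ) → ℕ
N m n t = if does (2 ℕ.* t ℕ.+ 4 ℕ.<? m ℕ.∸ n)
          then ⌈ m ℕ.∸ n /2⌉
          else t ℕ.+ 2

-- For p an odd prime.
legendre : ℤ → ℕ → ℤ
legendre a p =
  if does (p ℕ.∣? ∣ a ∣) then ℤ.0ℤ
  else if does (any? {n = p} λ x → p ℕ.∣? ∣ (+ toℕ x) ℤ.^ 2 ℤ.- a ∣) then ℤ.1ℤ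
  else ℤ.-1ℤ

-- For b odd.  A negative b is allowed, with (a / b) = (a / ∣b∣); for a = 2 this
-- is the usual extension, in which (2 / b) depends only on b modulo 8.
jacobi : ℤ → ℤ → ℤ
jacobi a b = go ∣ b ∣
  where
  go : ℕ → ℤ
  go zero        = ℤ.0ℤ
  go b@(suc _) = foldr (λ p s → legendre a p ℤ.* s) ℤ.1ℤ
                   (PrimeFactorisation.factors (factorise b))

-- The features of ℂ that enter into character sums: it is a field of
-- characteristic zero, with the additive character r ↦ e^{2πir} of ℚ.
record ComplexField c ℓ₁ ℓ₂ : Set (Level.suc (c ⊔ ℓ₁ ⊔ ℓ₂)) where
  field
    heytingField : HeytingField c ℓ₁ ℓ₂

  open HeytingField heytingField public

  commutativeRing : CommutativeRing c ℓ₁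
  commutativeRing = record { isCommutativeRing = isCommutativeRing }

  open CommutativeRing commutativeRing public using (semiring; +-monoid)
  open Exp semiring public using (_^_)
  open Mult semiring public using (_×_)

  field
    char0  : ∀ n → (suc n × 1#) # 0#
    exp2πi : ℚ → Carrier
    exp2πi-homo : ∀ p q → exp2πi (p ℚ.+ q) ≈ exp2πi p * exp2πi q
    exp2πi-½    : exp2πi ½ ≈ - 1#

module CharacterSums {c ℓ₁ ℓ₂} (ℂ : ComplexField c ℓ₁ ℓ₂) where

  open ComplexField ℂ public
    using (Carrier; _≈_; 0#; 1#)
    renaming (_+_ to _+ᶜ_; _*_ to _*ᶜ_; -_ to -ᶜ_; _^_ to _^ᶜ_)
  open ComplexField ℂ using (_×_; exp2πi; +-monoid)
  open MonoidSum +-monoid using (sum)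

  2# : Carrier
  2# = 1# +ᶜ 1#

  fromℤ : ℤ → Carrier
  fromℤ (+ n)    = n × 1#
  fromℤ -[1+ n ] = -ᶜ (suc n × 1#)

  -- e_q(x) = e^{2πix/q}
  e : (q : ℕ) .{{_ : NonZero q}} → ℤ → Carrier
  e q x = exp2πi (x ℚ./ q)

  -- The integral powers of ω = e^{πi/4} = e₈(1).
  ω^_ : ℤ → Carrier
  ω^ h = e 8 h

  -- √2 = 2 cos (π/4) = e^{πi/4} + e^{-πi/4}
  √2 : Carrier
  √2 = e 8 ℤ.1ℤ +ᶜ e 8 ℤ.-1ℤ

  record DirichletCharacter (q : ℕ) : Set (c ⊔ ℓ₁) where
    field
      value    : ℤ → Carrier
      periodic : ∀ x y → x ≡ y [mod q ] → value x ≈ value y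
      *-homo   : ∀ x y → value (x ℤ.* y) ≈ value x *ᶜ value y
      1-homo   : value ℤ.1ℤ ≈ 1#
      vanishes : ∀ x → ¬ Coprime x (+ q) → value x ≈ 0#

  infix 9 _⟨_⟩
  _⟨_⟩ : ∀ {q} → DirichletCharacter q → ℤ → Carrier
  χ ⟨ x ⟩ = DirichletCharacter.value χ x

  -- χ modulo q is not induced by a character of smaller modulus.
  Primitive : ∀ {q} → DirichletCharacter q → Set ℓ₁
  Primitive {q} χ =
    ∀ d → d ℕ.∣ q → d ℕ.< q →
    ¬ (∀ x → Coprime x (+ q) → x ≡ ℤ.1ℤ [mod d ] → χ ⟨ x ⟩ ≈ 1#)

  infix 4 _≐_
  _≐_ : (f g : ℤ → Carrier) → Set ℓ₁
  f ≐ g = ∀ x → f x ≈ g x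

  principal : (q : ℕ) → ℤ → Carrier
  principal q x = if does (coprime? x (+ q)) then 1# else 0#

  χ₄ : ℤ → Carrier
  χ₄ x = if does (x ℤ.%ℕ 4 ℕ.≟ 1) then 1#
         else if does (x ℤ.%ℕ 4 ℕ.≟ 3) then -ᶜ 1#
         else 0#

  ∑[1⋯_] : ℕ → (ℤ → Carrier) → Carrier
  ∑[1⋯ q ] f = sum {q} λ i → f (+ suc (toℕ i))

module Submission where

-- Write g(x) = χ₁(x) χ₂(A x ^ k + B).  With s = N - t - 2, expanding 5 ^ (2 ^ (N - 2) k₁ v) to first order shows
-- g(x 5 ^ (2 ^ s v)) = g(x) e(v C(x) / (A x ^ k + B) / 2 ^ P), where P = m - N + t.  Averaging S over v
-- leaves only the x with C(x) ≡ 0 modulo 2 ^ P, and on these g depends on x modulo 2 ^ (s + 2) only, so that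
-- S = 2 ^ P ∑ g(x) over the solutions modulo 2 ^ (s + 2).  The characteristic equation prescribes x ^ k
-- modulo a power of 2, hence x up to sign (when k is even) and, for m - n odd, up to a factor 5 ^ 2 ^ (s - 1).
-- In the latter case two values of g in the ratio i ^ h remain, and 1 + i ^ h = √2 ω ^ h (2 / h).

-- The choice of `N` balances two demands. Since `A` carries the factor `2 ^ n`, the first-order
-- expansion is exact as soon as `n + 2 N >= m`, which suggests half of `m - n`, rounded up; but the
-- shift `5 ^ 2 ^ s` needs `s = N - t - 2 >= 0`, and so `N` stops at `t + 2` when
-- `m - n <= 2 t + 4`. In the large range an odd `m - n` makes `n + 2 N` exceed `m` by one, and this
-- lost binary digit is what splits a class of solutions in two. Two difficulties lie outside the
-- averaging. The symbol `(2 / h)` is a product of Legendre symbols defined through squares modulo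
-- primes, so the identity for `1 + i ^ h` rests on the second supplement to quadratic reciprocity:
-- a descent shows that 2 is no square modulo numbers congruent to 3 or -3 modulo 8, and an orbit
-- count shows the converse for primes. Moreover equality in the field is not decidable; vanishing
-- is drawn from the tightness of the apartness relation, and roots of unity are told apart only
-- through `exp2πi ½ ≈ - 1#` and characteristic zero.

open import Algebra.Bundles using (CommutativeMonoid)
open import Data.Integer.Base as ℤ using (ℤ; +_)
open import Data.Nat.Base as ℕ using (ℕ)
open import Defs using (R; ComplexField; module CharacterSums; jacobi)
open import Relation.Binary.PropositionalEquality.Core using (_≡_)

-- Congruences of integers, powers of 2 as moduli, parity.

module Congruence where
  open import Data.Integer.Base hiding (suc; _≤_; _<_)
  open import Data.Integer.Properties
  open import Data.Integer.Tactic.RingSolver using (solve-∀)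
  open import Data.Nat.Base as ℕ using (ℕ; zero; suc)
  import Data.Nat.Properties as ℕ
  import Data.Nat.DivMod as ℕ
  import Data.Nat.Divisibility as ℕ
  import Data.Integer.DivMod as DivMod
  import Data.Integer.Divisibility as Unsigned
  import Data.Integer.Divisibility.Signed as Signed
  open import Data.Product.Base using (∃; _,_)
  open import Data.Sum.Base using (_⊎_; inj₁; inj₂)
  open import Relation.Binary.Bundles using (Setoid)
  open import Relation.Binary.PropositionalEquality
  open import Relation.Nullary.Negation using (¬_; contradiction)
  open import Relation.Nullary.Decidable using (Dec; yes; no)
  open import Defs using (_≡_[mod_])

  infix 4 _≋_⟨_⟩
  -- The quotient is kept as data: matching on `by z refl` replaces one side by `b + z * q`, after
  -- which a law of congruences is a ring identity. As a record it does not unfold, so that both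
  -- sides and the modulus can be inferred.
  record _≋_⟨_⟩ (a b q : ℤ) : Set where
    constructor by
    field
      multiplier : ℤ
      equality   : a ≡ b + multiplier * q

  private variable
    a b c d q x y : ℤ

  ≋-reflexive : a ≡ b → a ≋ b ⟨ q ⟩
  ≋-reflexive {a} {q = q} refl = by 0ℤ (lemma a q)
    where
    lemma : ∀ a q → a ≡ a + 0ℤ * q
    lemma = solve-∀

  ≋-refl : a ≋ a ⟨ q ⟩
  ≋-refl = ≋-reflexive refl

  ≋-sym : a ≋ b ⟨ q ⟩ → b ≋ a ⟨ q ⟩
  ≋-sym {b = b} {q} (by z refl) = by (- z) (lemma b z q)
    where
    lemma : ∀ b z q → b ≡ b + z * q + - z * q
    lemma = solve-∀

  ≋-trans : a ≋ b ⟨ q ⟩ → b ≋ c ⟨ q ⟩ → a ≋ c ⟨ q ⟩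
  ≋-trans {q = q} {c} (by z refl) (by w refl) = by (w + z) (lemma c w z q)
    where
    lemma : ∀ c w z q → c + w * q + z * q ≡ c + (w + z) * q
    lemma = solve-∀

  +-cong≋ : a ≋ b ⟨ q ⟩ → c ≋ d ⟨ q ⟩ → a + c ≋ b + d ⟨ q ⟩
  +-cong≋ {b = b} {q} {d = d} (by z refl) (by w refl) = by (z + w) (lemma b d z w q)
    where
    lemma : ∀ b d z w q → b + z * q + (d + w * q) ≡ b + d + (z + w) * q
    lemma = solve-∀

  *-cong≋ : a ≋ b ⟨ q ⟩ → c ≋ d ⟨ q ⟩ → a * c ≋ b * d ⟨ q ⟩
  *-cong≋ {b = b} {q} {d = d} (by z refl) (by w refl) =
    by (z * d + b * w + z * w * q) (lemma b d z w q)
    where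
    lemma : ∀ b d z w q →
      (b + z * q) * (d + w * q) ≡ b * d + (z * d + b * w + z * w * q) * q
    lemma = solve-∀

  *-congˡ≋ : ∀ c → a ≋ b ⟨ q ⟩ → c * a ≋ c * b ⟨ q ⟩
  *-congˡ≋ c p = *-cong≋ (≋-refl {c}) p

  *-congʳ≋ : ∀ c → a ≋ b ⟨ q ⟩ → a * c ≋ b * c ⟨ q ⟩
  *-congʳ≋ c p = *-cong≋ p (≋-refl {c})

  +-congˡ≋ : ∀ c → a ≋ b ⟨ q ⟩ → c + a ≋ c + b ⟨ q ⟩
  +-congˡ≋ c p = +-cong≋ (≋-refl {c}) p

  +-congʳ≋ : ∀ c → a ≋ b ⟨ q ⟩ → a + c ≋ b + c ⟨ q ⟩
  +-congʳ≋ c p = +-cong≋ p (≋-refl {c})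

  -‿cong≋ : a ≋ b ⟨ q ⟩ → - a ≋ - b ⟨ q ⟩
  -‿cong≋ {b = b} {q} (by z refl) = by (- z) (lemma b z q)
    where
    lemma : ∀ b z q → - (b + z * q) ≡ - b + - z * q
    lemma = solve-∀

  ^-cong≋ : ∀ k → a ≋ b ⟨ q ⟩ → a ^ k ≋ b ^ k ⟨ q ⟩
  ^-cong≋ zero    p = ≋-refl
  ^-cong≋ (suc k) p = *-cong≋ p (^-cong≋ k p)

  multiple≋0 : ∀ z → z * q ≋ 0ℤ ⟨ q ⟩
  multiple≋0 {q} z = by z (sym (+-identityˡ (z * q)))

  ≋0⇒multiple : a ≋ 0ℤ ⟨ q ⟩ → ∃ λ z → a ≡ q * z
  ≋0⇒multiple {q = q} (by z eq) = z , trans eq (trans (+-identityˡ (z * q)) (*-comm z q))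

  modulus-∣ : ∀ r → a ≋ b ⟨ q * r ⟩ → a ≋ b ⟨ q ⟩
  modulus-∣ {b = b} {q} r (by z refl) = by (z * r) (cong (λ w → b + w) (lemma z q r))
    where
    lemma : ∀ z q r → z * (q * r) ≡ z * r * q
    lemma = solve-∀

  scale≋ : ∀ c → a ≋ b ⟨ q ⟩ → c * a ≋ c * b ⟨ c * q ⟩
  scale≋ {b = b} {q} c (by z refl) = by z (lemma b c z q)
    where
    lemma : ∀ b c z q → c * (b + z * q) ≡ c * b + z * (c * q)
    lemma = solve-∀

  unscale≋ : ∀ c .{{_ : NonZero c}} → c * a ≋ c * b ⟨ c * q ⟩ → a ≋ b ⟨ q ⟩
  unscale≋ {a} {b} {q} c (by z eq) =
    by z (*-cancelˡ-≡ c a (b + z * q) (trans eq (lemma b c z q)))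
    where
    lemma : ∀ b c z q → c * b + z * (c * q) ≡ c * (b + z * q)
    lemma = solve-∀

  ≋-setoid : ℤ → Setoid _ _
  ≋-setoid q = record
    { Carrier = ℤ
    ; _≈_ = λ a b → a ≋ b ⟨ q ⟩
    ; isEquivalence = record { refl = ≋-refl ; sym = ≋-sym ; trans = ≋-trans }
    }

  module ≋-Reasoning (q : ℤ) where
    open import Relation.Binary.Reasoning.Setoid (≋-setoid q) public

  to-[mod] : ∀ {n} → a ≋ b ⟨ + n ⟩ → a ≡ b [mod n ]
  to-[mod] {b = b} {n} (by z refl) = Signed.∣⇒∣ᵤ (Signed.divides z (lemma b (z * + n)))
    where
    lemma : ∀ b w → b + w - b ≡ w
    lemma = solve-∀

  from-[mod] : ∀ {a b n} → a ≡ b [mod n ] → a ≋ b ⟨ + n ⟩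
  from-[mod] {a} {b} {n} p with Signed.∣ᵤ⇒∣ {+ n} {a - b} p
  ... | Signed.divides z eq = by z (trans (lemma a b) (cong (λ w → b + w) eq))
    where
    lemma : ∀ a b → a ≡ b + (a - b)
    lemma = solve-∀

  _≋?_⟨_⟩ : ∀ a b q → Dec (a ≋ b ⟨ q ⟩)
  a ≋? b ⟨ q ⟩ with q Signed.∣? (a - b)
  ... | yes (Signed.divides z eq) = yes (by z (trans (lemma a b) (cong (λ w → b + w) eq)))
    where
    lemma : ∀ a b → a ≡ b + (a - b)
    lemma = solve-∀
  ... | no ∤ = no λ { (by z refl) → ∤ (Signed.divides z (lemma b (z * q))) }
    where
    lemma : ∀ b w → b + w - b ≡ w
    lemma = solve-∀

  residue : ∀ a n .{{_ : ℕ.NonZero n}} → a ≋ + (a %ℕ n) ⟨ + n ⟩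
  residue a n = by (a /ℕ n) (DivMod.a≡a%ℕn+[a/ℕn]*n a n)

  opaque
    -- Opaque, so that moduli remain symbols and are never multiplied out in type checking. Inside
    -- the block the power still computes, which is what `mod2^1` and `mod2^2` rely on.
    2^_ : ℕ → ℤ
    2^ j = + (2 ℕ.^ j)

    2^≡ : ∀ j → 2^ j ≡ + (2 ℕ.^ j)
    2^≡ j = refl

    2^-+ : ∀ i j → 2^ (i ℕ.+ j) ≡ 2^ i * 2^ j
    2^-+ i j = trans (cong +_ (ℕ.^-distribˡ-+-* 2 i j)) (pos-* (2 ℕ.^ i) (2 ℕ.^ j))

    2^-suc : ∀ i → 2^ (suc i) ≡ + 2 * 2^ i
    2^-suc i = pos-* 2 (2 ℕ.^ i)

    2^-suc-suc : ∀ i → 2^ (2 ℕ.+ i) ≡ + 4 * 2^ i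
    2^-suc-suc i = 2^-+ 2 i

    2^-nonZero : ∀ j → NonZero (2^ j)
    2^-nonZero j = ℕ.m^n≢0 2 j

    mod2 : ∀ {j} → a ≋ b ⟨ 2^ (suc j) ⟩ → a ≋ b ⟨ + 2 ⟩
    mod2 {a} {b} {j} p = modulus-∣ (2^ j) (subst (λ q → a ≋ b ⟨ q ⟩) (2^-suc j) p)

    mod4 : ∀ {j} → a ≋ b ⟨ 2^ (2 ℕ.+ j) ⟩ → a ≋ b ⟨ + 4 ⟩
    mod4 {a} {b} {j} p = modulus-∣ (2^ j) (subst (λ q → a ≋ b ⟨ q ⟩) (2^-suc-suc j) p)

    mod2^1 : a ≋ b ⟨ + 2 ⟩ → a ≋ b ⟨ 2^ 1 ⟩
    mod2^1 p = p

    mod2^2 : a ≋ b ⟨ + 4 ⟩ → a ≋ b ⟨ 2^ 2 ⟩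
    mod2^2 p = p

    mod2^0 : ∀ a b → a ≋ b ⟨ 2^ 0 ⟩
    mod2^0 a b = by (a - b) (lemma a b)
      where
      lemma : ∀ a b → a ≡ b + (a - b) * 1ℤ
      lemma = solve-∀

  to-2^ : ∀ {j} → a ≋ b ⟨ + (2 ℕ.^ j) ⟩ → a ≋ b ⟨ 2^ j ⟩
  to-2^ {a} {b} {j} = subst (λ q → a ≋ b ⟨ q ⟩) (sym (2^≡ j))

  from-2^ : ∀ {j} → a ≋ b ⟨ 2^ j ⟩ → a ≋ b ⟨ + (2 ℕ.^ j) ⟩
  from-2^ {a} {b} {j} = subst (λ q → a ≋ b ⟨ q ⟩) (2^≡ j)

  pos-2^* : ∀ i v → + (2 ℕ.^ i ℕ.* v) ≡ 2^ i * + v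
  pos-2^* i v = trans (pos-* (2 ℕ.^ i) v) (cong (_* + v) (sym (2^≡ i)))

  lower : ∀ {i j} → i ℕ.≤ j → a ≋ b ⟨ 2^ j ⟩ → a ≋ b ⟨ 2^ i ⟩
  lower {a = a} {b} {i} {j} i≤j p =
    modulus-∣ (2^ (j ℕ.∸ i)) (subst (λ q → a ≋ b ⟨ q ⟩) eq p)
    where
    eq : 2^ j ≡ 2^ i * 2^ (j ℕ.∸ i)
    eq = trans (cong 2^_ (sym (ℕ.m+[n∸m]≡n i≤j))) (2^-+ i (j ℕ.∸ i))

  recast : ∀ {i j} → i ≡ j → a ≋ b ⟨ 2^ i ⟩ → a ≋ b ⟨ 2^ j ⟩
  recast refl p = p

  scale-2^ : ∀ i {j} → a ≋ b ⟨ 2^ j ⟩ → 2^ i * a ≋ 2^ i * b ⟨ 2^ (i ℕ.+ j) ⟩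
  scale-2^ {a} {b} i {j} p =
    subst (λ q → 2^ i * a ≋ 2^ i * b ⟨ q ⟩) (sym (2^-+ i j)) (scale≋ (2^ i) p)

  unscale-2^ : ∀ i {j} → 2^ i * a ≋ 2^ i * b ⟨ 2^ (i ℕ.+ j) ⟩ → a ≋ b ⟨ 2^ j ⟩
  unscale-2^ {a} {b} i {j} p =
    unscale≋ (2^ i) {{2^-nonZero i}} (subst (λ q → 2^ i * a ≋ 2^ i * b ⟨ q ⟩) (2^-+ i j) p)

  Even Odd : ℤ → Set
  Even x = x ≋ 0ℤ ⟨ + 2 ⟩
  Odd  x = x ≋ 1ℤ ⟨ + 2 ⟩

  parity : ∀ x → Even x ⊎ Odd x
  parity x with x %ℕ 2 in eq | residue x 2 | DivMod.n%ℕd<d x 2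
  ... | 0 | p | _ = inj₁ p
  ... | 1 | p | _ = inj₂ p
  ... | suc (suc _) | _ | ℕ.s≤s (ℕ.s≤s ())

  Even⇒∣ : Even x → + 2 Unsigned.∣ x
  Even⇒∣ {x} ev = subst (+ 2 Unsigned.∣_) (+-identityʳ x) (to-[mod] ev)

  ∣⇒Even : + 2 Unsigned.∣ x → Even x
  ∣⇒Even {x} d = from-[mod] (subst (+ 2 Unsigned.∣_) (sym (+-identityʳ x)) d)

  ¬1≋0 : ¬ (1ℤ ≋ 0ℤ ⟨ + 2 ⟩)
  ¬1≋0 p with ℕ.∣1⇒≡1 (to-[mod] p)
  ... | ()

  Even⇒¬Odd : Even x → ¬ Odd x
  Even⇒¬Odd e o = ¬1≋0 (≋-trans (≋-sym o) e)

  ¬Even⇒Odd : ¬ Even x → Odd x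
  ¬Even⇒Odd {x} ¬e with parity x
  ... | inj₁ e = contradiction e ¬e
  ... | inj₂ o = o

  Odd-* : Odd x → Odd y → Odd (x * y)
  Odd-* = *-cong≋

  Odd-*ˡ : ∀ x y → Odd (x * y) → Odd x
  Odd-*ˡ x y o with parity x
  ... | inj₁ e = contradiction o (Even⇒¬Odd (*-congʳ≋ y e))
  ... | inj₂ p = p

  Odd-*ʳ : ∀ x y → Odd (x * y) → Odd y
  Odd-*ʳ x y o = Odd-*ˡ y x (subst Odd (*-comm x y) o)

  Odd-^ : ∀ k → Odd x → Odd (x ^ k)
  Odd-^ k o = ≋-trans (^-cong≋ k o) (≋-reflexive (^-zeroˡ k))

  Odd-neg : Odd x → Odd (- x)
  Odd-neg o = ≋-trans (-‿cong≋ o) (by -1ℤ refl)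

  -- Newton's step: if `y * d = 1 + z w`, then `d (1 - z w)` yields `1 - z^2 w^2`, correct modulo
  -- `w^2`. Only one digit of this gain is kept, so that the induction is structural in `j`.
  odd-inverse : ∀ j → Odd y → ∃ λ d → y * d ≋ 1ℤ ⟨ 2^ j ⟩
  odd-inverse {y} zero o = 0ℤ , mod2^0 (y * 0ℤ) 1ℤ
  odd-inverse {y} (suc zero) o = 1ℤ , ≋-trans (≋-reflexive (*-identityʳ y)) (mod2^1 o)
  odd-inverse {y} (suc (suc j)) o with odd-inverse {y} (suc j) o
  ... | d , by z eq = d * (1ℤ - z * w) ,
    lower (ℕ.m≤n+m (suc (suc j)) j) (recast (sym (ℕ.+-suc j (suc j)))
      (≋-trans (≋-reflexive eq′)
        (subst (λ r → 1ℤ + - (z * z) * (w * w) ≋ 1ℤ ⟨ r ⟩) (sym (2^-+ (suc j) (suc j)))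
          (by (- (z * z)) refl))))
    where
    w = 2^ (suc j)
    shuffle : ∀ z w → (1ℤ + z * w) * (1ℤ - z * w) ≡ 1ℤ + - (z * z) * (w * w)
    shuffle = solve-∀
    eq′ : y * (d * (1ℤ - z * w)) ≡ 1ℤ + - (z * z) * (w * w)
    eq′ = trans (sym (*-assoc y d _))
            (trans (cong (_* (1ℤ - z * w)) eq) (shuffle z w))

  odd-cancelˡ : ∀ {j} u → Odd u → u * a ≋ u * b ⟨ 2^ j ⟩ → a ≋ b ⟨ 2^ j ⟩
  odd-cancelˡ {a} {b} {j} u o p with odd-inverse j o
  ... | d , ud≋1 = begin
    a ≡⟨ *-identityˡ a ⟨
    1ℤ * a ≈⟨ *-congʳ≋ a ud≋1 ⟨
    u * d * a ≡⟨ lemma u d a ⟩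
    d * (u * a) ≈⟨ *-congˡ≋ d p ⟩
    d * (u * b) ≡⟨ lemma u d b ⟨
    u * d * b ≈⟨ *-congʳ≋ b ud≋1 ⟩
    1ℤ * b ≡⟨ *-identityˡ b ⟩
    b ∎
    where
    open ≋-Reasoning (2^ j)
    lemma : ∀ u d a → u * d * a ≡ d * (u * a)
    lemma = solve-∀

-- Powers of 5, the numbers `R i`, and k-th roots modulo powers of 2.

module Powers where
  open import Data.Integer.Base hiding (suc; _≤_; _<_)
  open import Data.Integer.Properties
  open import Data.Integer.Tactic.RingSolver using (solve-∀)
  open import Data.Nat.Base as ℕ using (ℕ; zero; suc)
  import Data.Nat.Properties as ℕ
  import Data.Nat.DivMod as ℕ
  import Data.Nat.Divisibility as ℕ
  import Data.Nat.Tactic.RingSolver as ℕSolver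
  open import Data.Product.Base using (∃; _,_; _×_)
  open import Data.Sum.Base using (_⊎_; inj₁; inj₂; [_,_]′)
  open import Relation.Binary.PropositionalEquality
  open import Relation.Nullary.Negation using (¬_; contradiction)
  open import Defs using (R)
  open Congruence

  private variable
    a b q x y : ℤ

  ^-*-distrib : ∀ a b k → (a * b) ^ k ≡ a ^ k * b ^ k
  ^-*-distrib a b zero    = refl
  ^-*-distrib a b (suc k) = trans (cong (a * b *_) (^-*-distrib a b k)) (lemma a b (a ^ k) (b ^ k))
    where
    lemma : ∀ a b c d → a * b * (c * d) ≡ a * c * (b * d)
    lemma = solve-∀

  binomial₁ : ∀ a j → (1ℤ + a) ^ j ≋ 1ℤ + + j * a ⟨ a * a ⟩
  binomial₁ a zero    = ≋-refl
  binomial₁ a (suc j) = ≋-trans (*-congˡ≋ (1ℤ + a) (binomial₁ a j)) (by (+ j) (lemma a (+ j)))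
    where
    lemma : ∀ a j → (1ℤ + a) * (1ℤ + j * a) ≡ 1ℤ + (1ℤ + j) * a + j * (a * a)
    lemma = solve-∀

  -- The binomial coefficient of `j` over 2, by its recursion rather than by a division.
  triangular : ℕ → ℤ
  triangular zero    = 0ℤ
  triangular (suc j) = triangular j + + j

  -- For `j = 2 b + 1` the coefficient is `b (2 b + 1)`. With `j = k₁` this is the source of the
  -- term `k₁ - 1 = 2 b` of `h`.
  triangular-odd : ∀ b → triangular (suc (2 ℕ.* b)) ≋ + b ⟨ + 2 ⟩
  triangular-odd zero    = ≋-refl
  triangular-odd (suc b) = ≋-trans (≋-reflexive eq)
    (≋-trans (+-congʳ≋ (+ (2 ℕ.* b ℕ.+ 1) + + (2 ℕ.* b ℕ.+ 2)) (triangular-odd b))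
      (by (+ 2 * + b + 1ℤ) (trans (cong (λ w → + b + (w + 1ℤ + (w + + 2))) (pos-* 2 b)) (lemma (+ b)))))
    where
    lemma : ∀ b → b + (+ 2 * b + 1ℤ + (+ 2 * b + + 2)) ≡ 1ℤ + b + (+ 2 * b + 1ℤ) * + 2
    lemma = solve-∀
    eq : triangular (suc (2 ℕ.* suc b)) ≡
         triangular (suc (2 ℕ.* b)) + (+ (2 ℕ.* b ℕ.+ 1) + + (2 ℕ.* b ℕ.+ 2))
    eq rewrite ℕ.+-suc b (b ℕ.+ 0) | ℕ.+-comm (2 ℕ.* b) 1 | ℕ.+-comm (2 ℕ.* b) 2 =
      +-assoc (triangular (2 ℕ.* b) + + (2 ℕ.* b)) (+ (1 ℕ.+ 2 ℕ.* b)) (+ (2 ℕ.+ 2 ℕ.* b))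

  binomial₂ : ∀ a j → (1ℤ + a) ^ j ≋ 1ℤ + + j * a + triangular j * (a * a) ⟨ a * a * a ⟩
  binomial₂ a zero    = ≋-refl
  binomial₂ a (suc j) = ≋-trans (*-congˡ≋ (1ℤ + a) (binomial₂ a j))
    (by (triangular j) (lemma a (+ j) (triangular j)))
    where
    lemma : ∀ a j s → (1ℤ + a) * (1ℤ + j * a + s * (a * a)) ≡
      1ℤ + (1ℤ + j) * a + (s + j) * (a * a) + s * (a * a * a)
    lemma = solve-∀

  private
    -- These are the `R (2 + j)`, by the recursion that squaring `1 + ρ j * 2 ^ (2 + j)` produces;
    -- the division in the definition of `R` is then seen to be exact.
    ρ : ℕ → ℕ
    ρ zero    = 1
    ρ (suc j) = ρ j ℕ.+ ρ j ℕ.* ρ j ℕ.* 2 ℕ.^ suc j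

    5^2^ : ∀ j → 5 ℕ.^ (2 ℕ.^ j) ≡ 1 ℕ.+ ρ j ℕ.* 2 ℕ.^ (2 ℕ.+ j)
    5^2^ zero    = refl
    5^2^ (suc j) = trans (cong (5 ℕ.^_) (ℕ.*-comm 2 (2 ℕ.^ j)))
      (trans (sym (ℕ.^-*-assoc 5 (2 ℕ.^ j) 2))
        (trans (cong (ℕ._^ 2) (5^2^ j)) (lemma (ρ j) (2 ℕ.^ j))))
      where
      lemma : ∀ r p → (1 ℕ.+ r ℕ.* (2 ℕ.* (2 ℕ.* p))) ℕ.* ((1 ℕ.+ r ℕ.* (2 ℕ.* (2 ℕ.* p))) ℕ.* 1) ≡
        1 ℕ.+ (r ℕ.+ r ℕ.* r ℕ.* (2 ℕ.* p)) ℕ.* (2 ℕ.* (2 ℕ.* (2 ℕ.* p)))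
      lemma = ℕSolver.solve-∀

    R≡ρ : ∀ j → R (2 ℕ.+ j) ≡ + ρ j
    R≡ρ j = cong +_ (trans (cong (λ z → ℕ._/_ (z ℕ.∸ 1) (2 ℕ.^ (2 ℕ.+ j)) {{ℕ.m^n≢0 2 (2 ℕ.+ j)}}) (5^2^ j))
                           (ℕ.m*n/n≡m (ρ j) (2 ℕ.^ (2 ℕ.+ j)) {{ℕ.m^n≢0 2 (2 ℕ.+ j)}}))

  5^[2^_*_] : ℕ → ℕ → ℤ
  5^[2^ j * v ] = (+ 5) ^ (2 ℕ.^ j ℕ.* v)

  pos-^ : ∀ a j → + (a ℕ.^ j) ≡ (+ a) ^ j
  pos-^ a zero    = refl
  pos-^ a (suc j) = trans (pos-* a (a ℕ.^ j)) (cong (+ a *_) (pos-^ a j))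

  5^2^≡1+R : ∀ j → (+ 5) ^ (2 ℕ.^ j) ≡ 1ℤ + R (2 ℕ.+ j) * 2^ (2 ℕ.+ j)
  5^2^≡1+R j = trans (sym (pos-^ 5 (2 ℕ.^ j))) (trans (cong +_ (5^2^ j))
    (cong (λ w → 1ℤ + w) (trans (pos-* (ρ j) (2 ℕ.^ (2 ℕ.+ j)))
      (cong₂ _*_ (sym (R≡ρ j)) (sym (2^≡ (2 ℕ.+ j)))))))

  R-suc : ∀ j → R (3 ℕ.+ j) ≡ R (2 ℕ.+ j) + R (2 ℕ.+ j) * R (2 ℕ.+ j) * 2^ (suc j)
  R-suc j = trans (R≡ρ (suc j)) (trans
    (cong (λ w → + ρ j + w) (trans (pos-* (ρ j ℕ.* ρ j) (2 ℕ.^ suc j)) (cong₂ _*_ (pos-* (ρ j) (ρ j)) (sym (2^≡ (suc j))))))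
    (cong (λ r → r + r * r * 2^ (suc j)) (sym (R≡ρ j))))

  R-odd : ∀ j → Odd (R (2 ℕ.+ j))
  R-odd zero    = ≋-refl
  R-odd (suc j) = ≋-trans (by (r * r * 2^ j) (trans (R-suc j)
      (trans (cong (λ p → r + r * r * p) (2^-suc j)) (lemma r (2^ j))))) (R-odd j)
    where
    r = R (2 ℕ.+ j)
    lemma : ∀ r p → r + r * r * (+ 2 * p) ≡ r + (r * r * p) * + 2
    lemma = solve-∀

  -- `R 3 = 3`, and from there on the correction in `R-suc` is divisible by 4. The index 2 is
  -- excluded because `R 2 = 1`.
  R≋-1[4] : ∀ j → R (3 ℕ.+ j) ≋ -1ℤ ⟨ + 4 ⟩
  R≋-1[4] zero    = by 1ℤ refl
  R≋-1[4] (suc j) = ≋-trans (by (r * r * 2^ j) (trans (R-suc (suc j))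
      (trans (cong (λ p → r + r * r * p) (trans (2^-suc (suc j)) (cong (+ 2 *_) (2^-suc j))))
        (lemma r (2^ j))))) (R≋-1[4] j)
    where
    r = R (3 ℕ.+ j)
    lemma : ∀ r p → r + r * r * (+ 2 * (+ 2 * p)) ≡ r + (r * r * p) * + 4
    lemma = solve-∀

  5-odd^ : ∀ v → Odd ((+ 5) ^ v)
  5-odd^ v = Odd-^ v (by (+ 2) refl)

  even-part : Even a → ∃ λ b → a ≡ + 2 * b
  even-part (by z refl) = z , trans (+-identityˡ (z * + 2)) (*-comm z (+ 2))

  -- Hensel lifting: at each step the next binary digit is corrected by 5 ^ 2 ^ (j + i) ≡ 1 + 2 ^ (2 + j + i).
  5-generates : ∀ j i {y} → y ≋ 1ℤ ⟨ 2^ (2 ℕ.+ j) ⟩ →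
    ∃ λ v → y ≋ 5^[2^ j * v ] ⟨ 2^ (2 ℕ.+ j ℕ.+ i) ⟩
  5-generates j zero p = 0 ,
    ≋-trans (recast (sym (ℕ.+-identityʳ (2 ℕ.+ j))) p)
            (≋-reflexive (cong ((+ 5) ^_) (sym (ℕ.*-zeroʳ (2 ℕ.^ j)))))
  5-generates j (suc i) {y} p with 5-generates j i p
  ... | v , by z eq with parity z
  ... | inj₁ ev with even-part ev
  ...   | z′ , refl = v , by z′ (trans eq (cong (λ w → 5^[2^ j * v ] + w) lift))
    where
    lift : + 2 * z′ * 2^ (2 ℕ.+ j ℕ.+ i) ≡ z′ * 2^ (2 ℕ.+ j ℕ.+ suc i)
    lift = trans (lemma z′ (2^ (2 ℕ.+ j ℕ.+ i)))
      (cong (z′ *_) (trans (sym (2^-suc (2 ℕ.+ j ℕ.+ i))) (cong 2^_ (sym (ℕ.+-suc (2 ℕ.+ j) i)))))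
      where
      lemma : ∀ z w → + 2 * z * w ≡ z * (+ 2 * w)
      lemma = solve-∀
  5-generates j (suc i) {y} p | v , by z eq | inj₂ od = v ℕ.+ 2 ℕ.^ i , goal
    where
    M = 2^ (2 ℕ.+ j ℕ.+ i)
    r = R (2 ℕ.+ (j ℕ.+ i))
    F = 5^[2^ j * v ]
    same-parity : z ≋ F * r ⟨ + 2 ⟩
    same-parity = ≋-trans od (≋-sym (Odd-* (5-odd^ (2 ℕ.^ j ℕ.* v)) (R-odd (j ℕ.+ i))))
    exponent : 2 ℕ.^ j ℕ.* (v ℕ.+ 2 ℕ.^ i) ≡ 2 ℕ.^ j ℕ.* v ℕ.+ 2 ℕ.^ (j ℕ.+ i)
    exponent = trans (ℕ.*-distribˡ-+ (2 ℕ.^ j) v (2 ℕ.^ i))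
      (cong (2 ℕ.^ j ℕ.* v ℕ.+_) (sym (ℕ.^-distribˡ-+-* 2 j i)))
    lemma : ∀ f r m → f + f * r * m ≡ f * (1ℤ + r * m)
    lemma = solve-∀
    power : F + F * r * M ≡ 5^[2^ j * (v ℕ.+ 2 ℕ.^ i) ]
    power = trans (lemma F r M) (trans (cong (F *_) (sym (5^2^≡1+R (j ℕ.+ i))))
      (trans (sym (^-distribˡ-+-* (+ 5) (2 ℕ.^ j ℕ.* v) (2 ℕ.^ (j ℕ.+ i))))
        (cong ((+ 5) ^_) (sym exponent))))
    goal : y ≋ 5^[2^ j * (v ℕ.+ 2 ℕ.^ i) ] ⟨ 2^ (2 ℕ.+ j ℕ.+ suc i) ⟩
    goal with same-parity
    ... | by w eq′ = ≋-trans
      (by w (trans eq (trans (cong (λ u → F + u * M) eq′)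
        (trans (shuffle F (F * r) w M) (cong (λ u → F + F * r * M + w * u)
          (trans (sym (2^-suc (2 ℕ.+ j ℕ.+ i))) (cong 2^_ (sym (ℕ.+-suc (2 ℕ.+ j) i)))))))))
      (≋-reflexive power)
      where
      shuffle : ∀ f g w m → f + (g + w * + 2) * m ≡ f + g * m + w * (+ 2 * m)
      shuffle = solve-∀

  ^-2^-suc : ∀ x t k → x ^ (2 ℕ.^ suc t ℕ.* k) ≡ (x * x) ^ (2 ℕ.^ t ℕ.* k)
  ^-2^-suc x t k = trans (cong (x ^_) (ℕ.*-assoc 2 (2 ℕ.^ t) k))
    (trans (sym (^-*-assoc x 2 (2 ℕ.^ t ℕ.* k))) (cong (λ w → (x * w) ^ (2 ℕ.^ t ℕ.* k)) (*-identityʳ x)))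

  square-lift : ∀ j → x ≋ y ⟨ 2^ (suc j) ⟩ → x * x ≋ y * y ⟨ 2^ (2 ℕ.+ j) ⟩
  square-lift {x} {y} j (by z eq) = by (y * z + z * z * 2^ j)
    (trans (cong₂ _*_ eq′ eq′) (trans (lemma y z (2^ j))
      (cong (λ p → y * y + (y * z + z * z * 2^ j) * p)
        (trans (cong (+ 2 *_) (sym (2^-suc j))) (sym (2^-suc (suc j)))))))
    where
    eq′ : x ≡ y + z * (+ 2 * 2^ j)
    eq′ = trans eq (cong (λ p → y + z * p) (2^-suc j))
    lemma : ∀ y z p → (y + z * (+ 2 * p)) * (y + z * (+ 2 * p)) ≡
      y * y + (y * z + z * z * p) * (+ 2 * (+ 2 * p))
    lemma = solve-∀

  -- Each of the `t` squarings gains a binary digit, `x + y` being even; the remaining power `k`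
  -- loses none.
  ^-lift : ∀ t k j → x ≋ y ⟨ 2^ (suc j) ⟩ →
    x ^ (2 ℕ.^ t ℕ.* k) ≋ y ^ (2 ℕ.^ t ℕ.* k) ⟨ 2^ (suc j ℕ.+ t) ⟩
  ^-lift zero k j p = ^-cong≋ (1 ℕ.* k) (recast (sym (ℕ.+-identityʳ (suc j))) p)
  ^-lift {x} {y} (suc t) k j p =
    subst₂ (λ a b → a ≋ b ⟨ 2^ (suc j ℕ.+ suc t) ⟩) (sym (^-2^-suc x t k)) (sym (^-2^-suc y t k))
      (recast (sym (ℕ.+-suc (suc j) t)) (^-lift t k (suc j) (square-lift j p)))

  -- The homogeneous sum `(x ^ k - y ^ k) / (x - y)`, by Horner's scheme.
  cofactor : ℕ → ℤ → ℤ → ℤ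
  cofactor zero    x y = 0ℤ
  cofactor (suc k) x y = x ^ k + y * cofactor k x y

  cofactor-* : ∀ k x y → x ^ k ≡ y ^ k + (x - y) * cofactor k x y
  cofactor-* zero    x y = lemma x y
    where
    lemma : ∀ x y → 1ℤ ≡ 1ℤ + (x - y) * 0ℤ
    lemma = solve-∀
  cofactor-* (suc k) x y = trans (cong (x *_) (cofactor-* k x y))
      (trans (lemma x y (y ^ k) (cofactor k x y))
        (cong (λ w → y * y ^ k + (x - y) * (w + y * cofactor k x y)) (sym (cofactor-* k x y))))
    where
    lemma : ∀ x y w c → x * (w + (x - y) * c) ≡ y * w + (x - y) * (w + (x - y) * c + y * c)
    lemma = solve-∀

  cofactor-parity : ∀ k → Odd x → Odd y → cofactor k x y ≋ + k ⟨ + 2 ⟩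
  cofactor-parity zero    ox oy = ≋-refl
  cofactor-parity (suc k) ox oy = +-cong≋ (Odd-^ k ox)
    (≋-trans (*-cong≋ oy (cofactor-parity k ox oy)) (≋-reflexive (*-identityˡ (+ k))))

  -- For odd `k` the cofactor is a sum of an odd number of odd terms, hence odd, and can be
  -- cancelled from `x ^ k - y ^ k`.
  ^-odd-injective : ∀ {j} k → Odd (+ k) → Odd x → Odd y → x ^ k ≋ y ^ k ⟨ 2^ j ⟩ → x ≋ y ⟨ 2^ j ⟩
  ^-odd-injective {x} {y} {j} k ok ox oy p =
    subst (λ w → w ≋ y ⟨ 2^ j ⟩) (lemma₂ x y)
      (≋-trans (+-congˡ≋ y (odd-cancelˡ (cofactor k x y) (≋-trans (cofactor-parity k ox oy) ok) diff))
        (≋-reflexive (+-identityʳ y)))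
    where
    lemma₁ : ∀ u v → u * v ≡ - v * (0ℤ - u) + 0ℤ
    lemma₁ = solve-∀
    lemma₂ : ∀ x y → y + (x - y) ≡ x
    lemma₂ = solve-∀
    lemma₃ : ∀ c d yk → c * d ≡ (yk + d * c) + - yk
    lemma₃ = solve-∀
    diff : cofactor k x y * (x - y) ≋ cofactor k x y * 0ℤ ⟨ 2^ j ⟩
    diff = begin
      cofactor k x y * (x - y) ≡⟨ lemma₃ (cofactor k x y) (x - y) (y ^ k) ⟩
      (y ^ k + (x - y) * cofactor k x y) + - y ^ k ≡⟨ cong (_+ - y ^ k) (cofactor-* k x y) ⟨
      x ^ k + - y ^ k ≈⟨ +-congʳ≋ (- y ^ k) p ⟩
      y ^ k + - y ^ k ≡⟨ +-inverseʳ (y ^ k) ⟩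
      0ℤ ≡⟨ *-zeroʳ (cofactor k x y) ⟨
      cofactor k x y * 0ℤ ∎
      where open ≋-Reasoning (2^ j)

  -- One of (x - y) / 2 and (x + y) / 2 is odd, their sum being x.
  square-root : ∀ j → Odd x → Odd y → x * x ≋ y * y ⟨ 2^ (3 ℕ.+ j) ⟩ →
    x ≋ y ⟨ 2^ (2 ℕ.+ j) ⟩ ⊎ x ≋ - y ⟨ 2^ (2 ℕ.+ j) ⟩
  square-root {x} {y} j ox oy p with ≋-trans ox (≋-sym oy)
  ... | by u refl = [ case-u , case-v ]′ (odd-u⊎v)
    where
    v = u + y
    uv : u * v ≋ 0ℤ ⟨ 2^ (suc j) ⟩
    uv = unscale-2^ 2 (≋-trans (≋-reflexive (trans (cong (_* (u * v)) (2^≡ 2)) (lemma u y)))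
      (≋-trans (+-congʳ≋ (- (y * y)) p) (≋-reflexive (trans (+-inverseʳ (y * y)) (sym (*-zeroʳ (2^ 2)))))))
      where
      lemma : ∀ u y → + 4 * (u * (u + y)) ≡ (y + u * + 2) * (y + u * + 2) + - (y * y)
      lemma = solve-∀
    odd-u⊎v : Odd u ⊎ Odd v
    odd-u⊎v with parity u
    ... | inj₂ o = inj₁ o
    ... | inj₁ e = inj₂ (+-cong≋ e oy)
    double : ∀ {w} → w ≋ 0ℤ ⟨ 2^ (suc j) ⟩ → w * + 2 ≋ 0ℤ ⟨ 2^ (2 ℕ.+ j) ⟩
    double {w} q = ≋-trans (≋-reflexive (trans (*-comm w (+ 2)) (cong (_* w) (sym (2^≡ 1)))))
      (≋-trans (scale-2^ 1 q) (≋-reflexive (*-zeroʳ (2^ 1))))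
    case-u : Odd u → _
    case-u o = inj₂ (≋-trans (≋-reflexive (lemma u y)) (≋-trans
        (+-congˡ≋ (- y) (double (odd-cancelˡ u o (≋-trans uv (≋-reflexive (sym (*-zeroʳ u)))))))
        (≋-reflexive (+-identityʳ (- y)))))
      where
      lemma : ∀ u y → y + u * + 2 ≡ - y + (u + y) * + 2
      lemma = solve-∀
    case-v : Odd v → _
    case-v o = inj₁ (≋-trans (+-congˡ≋ y (double (odd-cancelˡ v o
        (≋-trans (≋-reflexive (*-comm v u)) (≋-trans uv (≋-reflexive (sym (*-zeroʳ v))))))))
        (≋-reflexive (+-identityʳ y)))

  odd-square≋1[4] : Odd x → x * x ≋ 1ℤ ⟨ + 4 ⟩
  odd-square≋1[4] (by z refl) = by (z * (1ℤ + z)) (lemma z)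
    where
    lemma : ∀ z → (1ℤ + z * + 2) * (1ℤ + z * + 2) ≡ 1ℤ + z * (1ℤ + z) * + 4
    lemma = solve-∀

  ¬1≋-1[4] : ¬ (1ℤ ≋ -1ℤ ⟨ + 4 ⟩)
  ¬1≋-1[4] p with ℕ.∣⇒≤ (to-[mod] p)
  ... | ℕ.s≤s (ℕ.s≤s ())

  squares-not-opposite : Odd x → Odd y → ¬ (x * x ≋ - (y * y) ⟨ + 4 ⟩)
  squares-not-opposite {x} {y} ox oy p = ¬1≋-1[4] (≋-trans (≋-sym (odd-square≋1[4] ox))
    (≋-trans p (-‿cong≋ {y * y} {1ℤ} (odd-square≋1[4] oy))))

  -- The induction hypothesis is applied to `x * x` and `y * y`. Its negative branch is impossible,
  -- odd squares being 1 modulo 4, so the only sign that survives comes from the last square root.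
  2^-root : ∀ t j → Odd x → Odd y → x ^ (2 ℕ.^ t) ≋ y ^ (2 ℕ.^ t) ⟨ 2^ (2 ℕ.+ j ℕ.+ t) ⟩ →
    x ≋ y ⟨ 2^ (2 ℕ.+ j) ⟩ ⊎ (0 ℕ.< t × x ≋ - y ⟨ 2^ (2 ℕ.+ j) ⟩)
  2^-root {x} {y} zero j ox oy p = inj₁ (subst₂ (λ a b → a ≋ b ⟨ 2^ (2 ℕ.+ j) ⟩)
    (*-identityʳ x) (*-identityʳ y) (recast (ℕ.+-identityʳ (2 ℕ.+ j)) p))
  2^-root {x} {y} (suc t) j ox oy p
    with 2^-root t (suc j) (Odd-* ox ox) (Odd-* oy oy)
           (recast (ℕ.+-suc (2 ℕ.+ j) t) (subst₂ (λ a b → a ≋ b ⟨ 2^ (2 ℕ.+ j ℕ.+ suc t) ⟩) (square x) (square y) p))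
    where
    square : ∀ x → x ^ (2 ℕ.^ suc t) ≡ (x * x) ^ (2 ℕ.^ t)
    square x = trans (sym (^-*-assoc x 2 (2 ℕ.^ t))) (cong (λ w → (x * w) ^ (2 ℕ.^ t)) (*-identityʳ x))
  ... | inj₂ (_ , q) = contradiction (mod4 q) (squares-not-opposite ox oy)
  ... | inj₁ q with square-root j ox oy q
  ...   | inj₁ r = inj₁ r
  ...   | inj₂ r = inj₂ (ℕ.s≤s ℕ.z≤n , r)

  ^-injective : ∀ t k j → Odd (+ k) → Odd x → Odd y →
    x ^ (2 ℕ.^ t ℕ.* k) ≋ y ^ (2 ℕ.^ t ℕ.* k) ⟨ 2^ (2 ℕ.+ j ℕ.+ t) ⟩ →
    x ≋ y ⟨ 2^ (2 ℕ.+ j) ⟩ ⊎ (0 ℕ.< t × x ≋ - y ⟨ 2^ (2 ℕ.+ j) ⟩)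
  ^-injective {x} {y} t k j ok ox oy p =
    2^-root t j ox oy (^-odd-injective {x ^ (2 ℕ.^ t)} {y ^ (2 ℕ.^ t)} k ok
      (Odd-^ (2 ℕ.^ t) ox) (Odd-^ (2 ℕ.^ t) oy) p′)
    where
    p′ : (x ^ (2 ℕ.^ t)) ^ k ≋ (y ^ (2 ℕ.^ t)) ^ k ⟨ 2^ (2 ℕ.+ j ℕ.+ t) ⟩
    p′ = ≋-trans (≋-reflexive (^-*-assoc x (2 ℕ.^ t) k))
      (≋-trans p (≋-reflexive (sym (^-*-assoc y (2 ℕ.^ t) k))))

  odd-ℕ : ∀ k → Odd (+ k) → ∃ λ j → k ≡ suc (2 ℕ.* j)
  odd-ℕ zero          od = contradiction od (Even⇒¬Odd ≋-refl)
  odd-ℕ (suc zero)    od = 0 , refl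
  odd-ℕ (suc (suc k)) od = go (odd-ℕ k (≋-trans (by -1ℤ (lemma (+ k))) od))
    where
    lemma : ∀ k → k ≡ + 2 + k + -1ℤ * + 2
    lemma = solve-∀
    go : (∃ λ j → k ≡ suc (2 ℕ.* j)) → ∃ λ j → suc (suc k) ≡ suc (2 ℕ.* j)
    go (j , refl) = suc j , cong suc (sym (ℕ.*-suc 2 j))

  odd-mod4 : ∀ {x} → Odd x → x ≋ 1ℤ ⟨ + 4 ⟩ ⊎ x ≋ -1ℤ ⟨ + 4 ⟩
  odd-mod4 {x} (by z eq) = go (parity z)
    where
    go : Even z ⊎ Odd z → _
    go (inj₁ (by y refl)) = inj₁ (by y (trans eq (lemma′ y)))
      where
      lemma′ : ∀ y → 1ℤ + (0ℤ + y * + 2) * + 2 ≡ 1ℤ + y * + 4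
      lemma′ = solve-∀
    go (inj₂ (by y refl)) = inj₂ (by (1ℤ + y) (trans eq (lemma′ y)))
      where
      lemma′ : ∀ y → 1ℤ + (1ℤ + y * + 2) * + 2 ≡ -1ℤ + (1ℤ + y) * + 4
      lemma′ = solve-∀

-- Residue classes modulo `q` as elements of `Fin q`, represented by 1 to `q`.

module Residues where
  open import Data.Integer.Base using (ℤ; +_; ∣_∣; _⊖_; 0ℤ; 1ℤ; _+_; _-_)
  open import Data.Integer.Properties
  open import Data.Integer.Tactic.RingSolver using (solve-∀)
  import Data.Integer.DivMod as DivMod
  open import Data.Nat.Base as ℕ using (ℕ; zero; suc; NonZero)
  import Data.Nat.Properties as ℕ
  import Data.Nat.Divisibility as ℕ
  open import Data.Fin.Base using (Fin; toℕ; fromℕ<)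
  open import Data.Fin.Properties using (toℕ-fromℕ<; toℕ-injective; toℕ<n)
  open import Relation.Binary.PropositionalEquality
  open Congruence

  opaque
    val : ∀ {q} → Fin q → ℤ
    val i = + suc (toℕ i)

    val≡ : ∀ {q} (i : Fin q) → val i ≡ + suc (toℕ i)
    val≡ i = refl

    idx : ∀ {q} .{{_ : NonZero q}} → ℤ → Fin q
    idx {q} y = fromℕ< (DivMod.n%ℕd<d (y - 1ℤ) q)

    val-idx : ∀ {q} .{{_ : NonZero q}} y → val (idx {q} y) ≋ y ⟨ + q ⟩
    val-idx {q} y = ≋-trans
      (≋-reflexive (cong (λ n → + suc n) (toℕ-fromℕ< (DivMod.n%ℕd<d (y - 1ℤ) q))))
      (≋-trans (+-congˡ≋ 1ℤ (≋-sym (residue (y - 1ℤ) q))) (≋-reflexive (lemma y)))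
      where
      lemma : ∀ y → 1ℤ + (y - 1ℤ) ≡ y
      lemma = solve-∀

    -- The difference of two representatives is smaller than `q` in absolute value, so it is 0 once
    -- `q` divides it.
    val-injective : ∀ {q} {i j : Fin q} → val i ≋ val j ⟨ + q ⟩ → i ≡ j
    val-injective {q} {i} {j} p = toℕ-injective (+-injective (i-j≡0⇒i≡j (+ toℕ i) (+ toℕ j) diff))
      where
      d≡ : val i - val j ≡ toℕ i ⊖ toℕ j
      d≡ = [1+m]⊖[1+n]≡m⊖n (toℕ i) (toℕ j)
      small : ∣ val i - val j ∣ ℕ.< q
      small = ℕ.≤-<-trans (subst (λ z → ∣ z ∣ ℕ.≤ toℕ i ℕ.⊔ toℕ j) (sym d≡) (∣m⊝n∣≤m⊔n (toℕ i) (toℕ j)))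
                (ℕ.⊔-pres-<m (toℕ<n i) (toℕ<n j))
      zero-of : ∀ n → q ℕ.∣ n → n ℕ.< q → n ≡ 0
      zero-of zero    _ _ = refl
      zero-of (suc n) d l = ⊥-elim (ℕ.<⇒≱ l (ℕ.∣⇒≤ d))
        where open import Data.Empty using (⊥-elim)
      diff : + toℕ i - + toℕ j ≡ 0ℤ
      diff = trans (m-n≡m⊖n (toℕ i) (toℕ j)) (trans (sym d≡) (∣i∣≡0⇒i≡0 (zero-of _ (to-[mod] p) small)))

  idx-val : ∀ {q} .{{_ : NonZero q}} (i : Fin q) → idx (val i) ≡ i
  idx-val i = val-injective (val-idx (val i))

  idx-cong : ∀ {q} .{{_ : NonZero q}} {x y} → x ≋ y ⟨ + q ⟩ → idx {q} x ≡ idx y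
  idx-cong {x = x} {y} p = val-injective (≋-trans (val-idx x) (≋-trans p (≋-sym (val-idx y))))

  idx-injective : ∀ {q} .{{_ : NonZero q}} {x y} → idx {q} x ≡ idx y → x ≋ y ⟨ + q ⟩
  idx-injective {q} {x = x} {y} p =
    ≋-trans (≋-sym (val-idx x)) (≋-trans (≋-reflexive (cong val p)) (val-idx y))

-- Finite sums in a commutative monoid, for counting as well as for character sums.

module FinSums {c ℓ} (M : CommutativeMonoid c ℓ) where
  open CommutativeMonoid M renaming (_∙_ to _+_; ε to 0#; ∙-cong to +-cong; identityˡ to +-identityˡ; identityʳ to +-identityʳ)
  open import Algebra.Properties.CommutativeMonoid.Sum M
  open import Data.Fin.Base using (Fin; zero; suc)
  open import Data.Fin.Properties using (_≟_)
  open import Data.Fin.Permutation using (permutation)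
  open import Data.List.Base using (List; []; _∷_; foldr; map)
  open import Data.List.Relation.Unary.All using (All; []; _∷_)
  open import Data.List.Relation.Unary.AllPairs using ([]; _∷_)
  open import Data.List.Relation.Unary.Any using (here; there)
  open import Data.List.Relation.Unary.Unique.Propositional using (Unique)
  open import Data.List.Membership.Propositional using (_∉_)
  open import Data.Bool.Base using (if_then_else_)
  open import Relation.Binary.PropositionalEquality as ≡ using (_≡_; _≢_)
  open import Relation.Nullary.Decidable using (does; yes; no)
  open import Relation.Nullary.Negation using (contradiction)
  open import Function.Base using (_∘_)

  private
    sum-zero : ∀ {n} {f : Fin n → Carrier} → (∀ i → f i ≈ 0#) → sum f ≈ 0#
    sum-zero {n} f≈0 = trans (sum-cong-≋ f≈0) (sum-replicate-zero n)

  sum-single : ∀ {n} {f : Fin n → Carrier} a → (∀ i → i ≢ a → f i ≈ 0#) → sum f ≈ f a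
  sum-single zero    f≈0 = trans (+-cong refl (sum-zero (λ i → f≈0 (suc i) λ ()))) (+-identityʳ _)
  sum-single (suc a) f≈0 = trans
    (+-cong (f≈0 zero λ ()) (sum-single a (λ i i≢a → f≈0 (suc i) λ { ≡.refl → i≢a ≡.refl })))
    (+-identityˡ _)

  -- The points of `L` are split off one by one; `Unique` guarantees that erasing `f` at the head
  -- leaves its values on the tail unchanged.
  sum-support : ∀ {n} {f : Fin n → Carrier} {L} → Unique L → (∀ i → i ∉ L → f i ≈ 0#) →
    sum f ≈ foldr _+_ 0# (map f L)
  sum-support {L = []} _ f≈0 = sum-zero (λ i → f≈0 i λ ())
  sum-support {n} {f} {a ∷ L} (a∉L ∷ uniq) f≈0 = begin
    sum f ≈⟨ sum-cong-≋ split ⟩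
    sum (λ i → g i + h i) ≈⟨ ∑-distrib-+ g h ⟩
    sum g + sum h ≈⟨ +-cong (sum-single a (λ i → g-off i)) (sum-support uniq h-off) ⟩
    g a + foldr _+_ 0# (map h L) ≈⟨ +-cong g-at (h-on a∉L) ⟩
    f a + foldr _+_ 0# (map f L) ∎
    where
    open import Relation.Binary.Reasoning.Setoid setoid
    g h : Fin n → Carrier
    g i = if does (i ≟ a) then f i else 0#
    h i = if does (i ≟ a) then 0# else f i
    split : ∀ i → f i ≈ g i + h i
    split i with i ≟ a
    ... | yes _ = sym (+-identityʳ _)
    ... | no  _ = sym (+-identityˡ _)
    g-off : ∀ i → i ≢ a → g i ≈ 0#
    g-off i i≢a with i ≟ a
    ... | yes i≡a = contradiction i≡a i≢a
    ... | no  _   = refl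
    g-at : g a ≈ f a
    g-at with a ≟ a
    ... | yes _  = refl
    ... | no a≢a = contradiction ≡.refl a≢a
    h-off : ∀ i → i ∉ L → h i ≈ 0#
    h-off i i∉L with i ≟ a
    ... | yes _  = refl
    ... | no i≢a = f≈0 i λ { (here i≡a) → i≢a i≡a ; (there i∈L) → i∉L i∈L }
    h-on : ∀ {K} → All (a ≢_) K → foldr _+_ 0# (map h K) ≈ foldr _+_ 0# (map f K)
    h-on [] = refl
    h-on {b ∷ K} (a≢b ∷ ps) = +-cong h≈f (h-on ps)
      where
      h≈f : h b ≈ f b
      h≈f with b ≟ a
      ... | yes b≡a = contradiction (≡.sym b≡a) a≢b
      ... | no  _   = refl

  sum-involution : ∀ {n} (f : Fin n → Carrier) (σ : Fin n → Fin n) → (∀ i → σ (σ i) ≡ i) →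
    sum f ≈ sum (f ∘ σ)
  sum-involution f σ σσ = sum-permute f (permutation σ σ σσ σσ)

-- Counting orbits of commuting or compatible involutions by halving.

module Orbits where
  open import Data.Fin.Base using (Fin; toℕ; _<_; _≤_)
  open import Data.Fin.Properties using (_<?_; _≤?_; <-cmp; _≟_; ≤∧≢⇒<)
  import Data.Fin.Properties as Fin
  open import Data.Nat.Base as ℕ using (ℕ)
  import Data.Nat.Properties as ℕ
  open import Data.Bool.Base using (if_then_else_)
  open import Data.Product.Base using (_×_; _,_)
  open import Data.Sum.Base using (_⊎_; inj₁; inj₂)
  open import Relation.Binary.Definitions using (tri<; tri≈; tri>)
  open import Relation.Binary.PropositionalEquality
  open import Relation.Nullary.Decidable using (Dec; does; yes; no; _×-dec_)
  open import Relation.Nullary.Negation using (¬_; contradiction)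
  open import Relation.Unary using (Decidable)
  open FinSums ℕ.+-0-commutativeMonoid
  open import Algebra.Properties.CommutativeMonoid.Sum ℕ.+-0-commutativeMonoid
    using (sum; sum-cong-≗; ∑-distrib-+)

  indicator : ∀ {P : Set} → Dec P → ℕ
  indicator d = if does d then 1 else 0

  indicator-yes : ∀ {P : Set} (d : Dec P) → P → indicator d ≡ 1
  indicator-yes (yes _) _ = refl
  indicator-yes (no ¬p) p = contradiction p ¬p

  indicator-no : ∀ {P : Set} (d : Dec P) → ¬ P → indicator d ≡ 0
  indicator-no (yes p) ¬p = contradiction p ¬p
  indicator-no (no _)  _  = refl

  indicator-⇔ : ∀ {P Q : Set} (d : Dec P) (d′ : Dec Q) → (P → Q) → (Q → P) → indicator d ≡ indicator d′
  indicator-⇔ (yes p) d′ to from = sym (indicator-yes d′ (to p))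
  indicator-⇔ (no ¬p) d′ to from = sym (indicator-no d′ (λ q → ¬p (from q)))

  count : ∀ {n} {P : Fin n → Set} → Decidable P → ℕ
  count P? = sum (λ i → indicator (P? i))

  count-⇔ : ∀ {n} {P Q : Fin n → Set} (P? : Decidable P) (Q? : Decidable Q) →
    (∀ i → P i → Q i) → (∀ i → Q i → P i) → count P? ≡ count Q?
  count-⇔ P? Q? to from = sum-cong-≗ (λ i → indicator-⇔ (P? i) (Q? i) (to i) (from i))

  module _ {n} {D : Fin n → Set} (D? : Decidable D) (σ : Fin n → Fin n)
    (D-σ : ∀ {i} → D i → D (σ i)) (involutive : ∀ {i} → D i → σ (σ i) ≡ i)
    (free : ∀ {i} → D i → σ i ≢ i) where

    private
      -- `σ` is an involution on `D` only; extended by the identity it becomes a permutation of all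
      -- indices, by which a sum over `Fin n` can be rearranged.
      τ : Fin n → Fin n
      τ i = if does (D? i) then σ i else i

      τ-in : ∀ {i} → D i → τ i ≡ σ i
      τ-in {i} d with D? i
      ... | yes _ = refl
      ... | no ¬d = contradiction d ¬d

      τ-out : ∀ {i} → ¬ D i → τ i ≡ i
      τ-out {i} ¬d with D? i
      ... | yes d = contradiction d ¬d
      ... | no _  = refl

      ττ : ∀ i → τ (τ i) ≡ i
      ττ i with D? i
      ... | yes d = trans (τ-in (D-σ d)) (involutive d)
      ... | no ¬d = τ-out ¬d

      below? : Decidable (λ i → D i × i < σ i)
      below? i = D? i ×-dec (i <? σ i)

      above? : Decidable (λ i → D i × σ i < i)
      above? i = D? i ×-dec (σ i <? i)

      split : ∀ i → indicator (D? i) ≡ indicator (below? i) ℕ.+ indicator (above? i)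
      split i with D? i
      ... | no _ = refl
      ... | yes d with <-cmp i (σ i)
      ...   | tri< l _ ¬g = sym (cong₂ ℕ._+_ (indicator-yes (i <? σ i) l) (indicator-no (σ i <? i) ¬g))
      ...   | tri≈ _ e _  = contradiction (sym e) (free d)
      ...   | tri> ¬l _ g = sym (cong₂ ℕ._+_ (indicator-no (i <? σ i) ¬l) (indicator-yes (σ i <? i) g))

      swap : ∀ i → indicator (above? (τ i)) ≡ indicator (below? i)
      swap i = indicator-⇔ (above? (τ i)) (below? i) to from
        where
        to : D (τ i) × σ (τ i) < τ i → D i × i < σ i
        to (d , l) with D? i
        ... | yes d′ = d′ , subst (_< σ i) (involutive d′) l
        ... | no ¬d  = contradiction d ¬d
        from : D i × i < σ i → D (τ i) × σ (τ i) < τ i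
        from (d , l) rewrite τ-in d = D-σ d , subst (_< σ i) (sym (involutive d)) l

    -- Without fixed points each pair `i`, `σ i` has one member below its image and one above, and
    -- the involution exchanges the two kinds.
    count-halve : count D? ≡ 2 ℕ.* count (λ i → D? i ×-dec (i <? σ i))
    count-halve = begin
      count D? ≡⟨ sum-cong-≗ split ⟩
      sum (λ i → indicator (below? i) ℕ.+ indicator (above? i)) ≡⟨ ∑-distrib-+ (λ i → indicator (below? i)) _ ⟩
      count below? ℕ.+ count above?
        ≡⟨ cong (count below? ℕ.+_) (sum-involution (λ i → indicator (above? i)) τ ττ) ⟩
      count below? ℕ.+ sum (λ i → indicator (above? (τ i))) ≡⟨ cong (count below? ℕ.+_) (sum-cong-≗ swap) ⟩
      count below? ℕ.+ count below? ≡⟨ cong (count below? ℕ.+_) (ℕ.+-identityʳ (count below?)) ⟨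
      2 ℕ.* count below? ∎
      where open ≡-Reasoning

  module Representatives {n} {X : Fin n → Set} (X? : Decidable X) where

    -- A partition of `X` encoded by a canonical representative of each class, which avoids
    -- quotients: the classes are counted by the fixed points of `rep`.
    record Choice : Set where
      field
        rep  : Fin n → Fin n
        rep∈ : ∀ {x} → X x → X (rep x)
        idem : ∀ {x} → X x → rep (rep x) ≡ rep x

      Chosen : Fin n → Set
      Chosen x = X x × rep x ≡ x

      chosen? : Decidable Chosen
      chosen? x = X? x ×-dec (rep x ≟ x)

    open Choice

    -- `σ` need be an involution without fixed points only on the classes of `C`, not on the points
    -- of `X`.
    record FreeAction (C : Choice) (σ : Fin n → Fin n) : Set where
      field
        closed     : ∀ {x} → X x → X (σ x)
        compatible : ∀ {x y} → X x → X y → rep C x ≡ rep C y → rep C (σ x) ≡ rep C (σ y)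
        involutive : ∀ {x} → X x → rep C (σ (σ x)) ≡ rep C x
        free       : ∀ {x} → X x → rep C (σ x) ≢ rep C x

    -- The classes of `x` and `σ x` are merged. `one-of` records where a new representative comes
    -- from, so that the members of a merged class can be listed afterwards.
    record Refinement (C : Choice) (σ : Fin n → Fin n) : Set where
      field
        refined  : Choice
        halved   : count (chosen? C) ≡ 2 ℕ.* count (chosen? refined)
        one-of   : ∀ x → rep refined x ≡ rep C x ⊎ rep refined x ≡ rep C (σ x)
        respects : ∀ {x y} → X x → X y → rep C x ≡ rep C y → rep refined x ≡ rep refined y
        absorbs  : ∀ {x} → X x → rep refined (σ x) ≡ rep refined x

    private
      min : Fin n → Fin n → Fin n
      min a b = if does (a ≤? b) then a else b

      min-comm : ∀ a b → min a b ≡ min b a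
      min-comm a b = go (a ≤? b) (b ≤? a)
        where
        go : ∀ (d : Dec (a ≤ b)) (d′ : Dec (b ≤ a)) →
          (if does d then a else b) ≡ (if does d′ then b else a)
        go (yes p) (yes q) = Fin.≤-antisym p q
        go (yes _) (no _)  = refl
        go (no _)  (yes _) = refl
        go (no p)  (no q)  with ℕ.≤-total (toℕ a) (toℕ b)
        ... | inj₁ l = contradiction l p
        ... | inj₂ l = contradiction l q

      min-sel : ∀ a b → min a b ≡ a ⊎ min a b ≡ b
      min-sel a b = go (a ≤? b)
        where
        go : ∀ (d : Dec (a ≤ b)) → (if does d then a else b) ≡ a ⊎ (if does d then a else b) ≡ b
        go (yes _) = inj₁ refl
        go (no _)  = inj₂ refl

      min-≤ : ∀ {a b} → a ≤ b → min a b ≡ a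
      min-≤ {a} {b} l = go (a ≤? b)
        where
        go : ∀ (d : Dec (a ≤ b)) → (if does d then a else b) ≡ a
        go (yes _) = refl
        go (no ¬l) = contradiction l ¬l

      min-< : ∀ {a b} → min a b ≡ a → a ≢ b → a < b
      min-< {a} {b} eq a≢b = go (a ≤? b) eq
        where
        go : ∀ (d : Dec (a ≤ b)) → (if does d then a else b) ≡ a → a < b
        go (yes l) _  = ≤∧≢⇒< l a≢b
        go (no _)  eq = contradiction (sym eq) a≢b

    -- A merged class is represented by the smaller of its two old representatives. The new chosen
    -- points are then the old ones lying below the representative of their image, as in
    -- `count-halve`.
    refine : ∀ C σ → FreeAction C σ → Refinement C σ
    refine C σ A = record
      { refined  = refined′
      ; halved   = trans (count-halve (chosen? C) (λ x → c (σ x))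
                            (λ { (x∈ , _) → rep∈ C (closed x∈) , idem C (closed x∈) })
                            (λ { (x∈ , cx) → trans (trans (compatible (rep∈ C (closed x∈)) (closed x∈) (idem C (closed x∈)))
                                                          (involutive x∈)) cx })
                            (λ { (x∈ , cx) eq → free x∈ (trans eq (sym cx)) }))
                         (cong (2 ℕ.*_) (count-⇔ (λ i → chosen? C i ×-dec (i <? c (σ i))) (chosen? refined′) (λ i → to) (λ i → from)))
      ; one-of   = λ x → min-sel (c x) (c (σ x))
      ; respects = respects′
      ; absorbs  = λ {x} x∈ → trans (cong (min (c (σ x))) (involutive x∈)) (min-comm (c (σ x)) (c x))
      }
      where
      open FreeAction A
      c = rep C
      c′ : Fin n → Fin n
      c′ x = min (c x) (c (σ x))
      respects′ : ∀ {x y} → X x → X y → c x ≡ c y → c′ x ≡ c′ y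
      respects′ x∈ y∈ eq = cong₂ min eq (compatible x∈ y∈ eq)
      c′∈ : ∀ {x} → X x → X (c′ x)
      c′∈ {x} x∈ with min-sel (c x) (c (σ x))
      ... | inj₁ eq = subst X (sym eq) (rep∈ C x∈)
      ... | inj₂ eq = subst X (sym eq) (rep∈ C (closed x∈))
      c′-idem : ∀ {x} → X x → c′ (c′ x) ≡ c′ x
      c′-idem {x} x∈ with min-sel (c x) (c (σ x))
      ... | inj₁ eq = trans (cong c′ eq) (respects′ (rep∈ C x∈) x∈ (idem C x∈))
      ... | inj₂ eq = trans (cong c′ eq) (trans (respects′ (rep∈ C (closed x∈)) (closed x∈) (idem C (closed x∈)))
                        (trans (cong (min (c (σ x))) (involutive x∈)) (min-comm (c (σ x)) (c x))))
      refined′ : Choice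
      refined′ = record { rep = c′ ; rep∈ = c′∈ ; idem = c′-idem }
      to : ∀ {x} → Chosen C x × x < c (σ x) → X x × c′ x ≡ x
      to {x} ((x∈ , cx) , l) = x∈ ,
        trans (min-≤ (ℕ.<⇒≤ (subst (_< c (σ x)) (sym cx) l))) cx
      from : ∀ {x} → X x × c′ x ≡ x → Chosen C x × x < c (σ x)
      from {x} (x∈ , eq) with min-sel (c x) (c (σ x))
      ... | inj₁ e = (x∈ , cx) , subst (_< c (σ x)) cx (min-< e (λ e′ → free x∈ (sym e′)))
        where
        cx : c x ≡ x
        cx = trans (sym e) eq
      ... | inj₂ e = contradiction (trans (sym (idem C (closed x∈))) (cong c (trans (sym e) eq))) (free x∈)

-- Arithmetic modulo a prime and the maps -v, 1/v, (1 - v)/(1 + v).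

module PrimeField where
  open import Data.Integer.Base hiding (suc; _≤_; _<_)
  open import Data.Integer.Properties
  open import Data.Integer.Tactic.RingSolver using (solve-∀)
  open import Data.Nat.Base as ℕ using (ℕ; zero; suc)
  import Data.Nat.Properties as ℕ
  import Data.Nat.Divisibility as ℕ
  import Data.Nat.Coprimality as Coprimality
  open import Data.Nat.GCD using (module Bézout)
  open import Data.Nat.Primality using (Prime; prime⇒nonZero; prime⇒nonTrivial)
  import Data.Integer.DivMod as DivMod
  open import Data.Product.Base using (∃; _,_; _×_; proj₁; proj₂)
  open import Data.Sum.Base using (_⊎_; inj₁; inj₂)
  open import Relation.Binary.PropositionalEquality
  open import Relation.Nullary.Negation using (¬_; contradiction)
  open import Relation.Nullary.Decidable using (Dec; yes; no; _×-dec_; ¬?)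
  open Congruence

  module Arithmetic {p : ℕ} (prime : Prime p) where

    private instance
      p≢0 : ℕ.NonZero p
      p≢0 = prime⇒nonZero prime

    infix 4 _~_
    _~_ : ℤ → ℤ → Set
    a ~ b = a ≋ b ⟨ + p ⟩

    ¬1~0 : ¬ (1ℤ ~ 0ℤ)
    ¬1~0 e with ℕ.∣1⇒≡1 (to-[mod] e)
    ... | refl = ℕ.nonTrivial⇒≢1 {{prime⇒nonTrivial prime}} refl

    inverse : ∀ y → ¬ (y ~ 0ℤ) → ∃ λ d → y * d ~ 1ℤ
    inverse y y≁0 with y %ℕ p | residue y p | DivMod.n%ℕd<d y p
    ... | zero  | y~r | _ = contradiction y~r y≁0
    ... | suc r | y~r | r<p with Coprimality.coprime-Bézout (Coprimality.prime⇒coprime prime r<p)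
    ...   | Bézout.+- x z eq = - + z , ≋-trans (*-congʳ≋ (- + z) y~r) (by (- + x) (begin
        + suc r * - + z ≡⟨ lemma (+ suc r) (+ z) ⟩
        1ℤ + - (1ℤ + + z * + suc r) ≡⟨ cong (λ w → 1ℤ + - w) (trans (cong (λ w → 1ℤ + w) (sym (pos-* z (suc r)))) (trans (cong +_ eq) (pos-* x p))) ⟩
        1ℤ + - (+ x * + p) ≡⟨ cong (λ w → 1ℤ + w) (neg-distribˡ-* (+ x) (+ p)) ⟩
        1ℤ + - + x * + p ∎))
      where
      open ≡-Reasoning
      lemma : ∀ r z → r * - z ≡ 1ℤ + - (1ℤ + z * r)
      lemma = solve-∀
    ...   | Bézout.-+ x z eq = + z , ≋-trans (*-congʳ≋ (+ z) y~r) (by (+ x) (begin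
        + suc r * + z ≡⟨ *-comm (+ suc r) (+ z) ⟩
        + z * + suc r ≡⟨ pos-* z (suc r) ⟨
        + (z ℕ.* suc r) ≡⟨ cong +_ eq ⟨
        1ℤ + + (x ℕ.* p) ≡⟨ cong (λ w → 1ℤ + w) (pos-* x p) ⟩
        1ℤ + + x * + p ∎))
      where open ≡-Reasoning

    opaque
      inv : ℤ → ℤ
      inv y with y ≋? 0ℤ ⟨ + p ⟩
      ... | yes _  = 0ℤ
      ... | no y≁0 = proj₁ (inverse y y≁0)

      inv-* : ∀ {y} → ¬ (y ~ 0ℤ) → y * inv y ~ 1ℤ
      inv-* {y} y≁0 with y ≋? 0ℤ ⟨ + p ⟩
      ... | yes e  = contradiction e y≁0
      ... | no y≁0 = proj₂ (inverse y y≁0)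

    -- Turns deductions between congruences into ring identities: the conclusion is exhibited as an
    -- explicit combination of the hypotheses, with cofactor `u`.
    from-combination : ∀ {a b c d} → a ~ b → ∀ u → c ≡ d + u * (a - b) → c ~ d
    from-combination {a} {b} {d = d} e u eq = ≋-trans (≋-reflexive eq) (≋-trans
      (+-congˡ≋ d (*-congˡ≋ u (+-congʳ≋ (- b) e)))
      (≋-reflexive (lemma d u b)))
      where
      lemma : ∀ d u b → d + u * (b - b) ≡ d
      lemma = solve-∀

    from-combination₂ : ∀ {a b a′ b′ c d} → a ~ b → a′ ~ b′ → ∀ u u′ →
      c ≡ d + u * (a - b) + u′ * (a′ - b′) → c ~ d
    from-combination₂ e e′ u u′ eq = ≋-trans (from-combination e′ u′ eq) (from-combination e u refl)

    cancel : ∀ {a b} u → ¬ (u ~ 0ℤ) → u * a ~ u * b → a ~ b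
    cancel {a} {b} u u≁0 e = from-combination₂ (≋-sym (inv-* u≁0)) e (a - b) (inv u) (lemma a b u (inv u))
      where
      lemma : ∀ a b u i → a ≡ b + (a - b) * (1ℤ - u * i) + i * (u * a - u * b)
      lemma = solve-∀

    zero-product : ∀ u v → u * v ~ 0ℤ → u ~ 0ℤ ⊎ v ~ 0ℤ
    zero-product u v e with u ≋? 0ℤ ⟨ + p ⟩
    ... | yes u~0 = inj₁ u~0
    ... | no u≁0  = inj₂ (cancel u u≁0 (≋-trans e (≋-reflexive (sym (*-zeroʳ u)))))

    inv-unique : ∀ {y d} → y * d ~ 1ℤ → inv y ~ d
    inv-unique {y} {d} e = cancel y y≁0 (≋-trans (inv-* y≁0) (≋-sym e))
      where
      y≁0 : ¬ (y ~ 0ℤ)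
      y≁0 y~0 = ¬1~0 (≋-trans (≋-sym e) (*-congʳ≋ d y~0))

    opaque
      unfolding inv

      inv-cong : ∀ {x y} → x ~ y → inv x ~ inv y
      inv-cong {x} {y} e with y ≋? 0ℤ ⟨ + p ⟩
      ... | no y≁0 = inv-unique (≋-trans (*-congʳ≋ _ e) (proj₂ (inverse y y≁0)))
      ... | yes y~0 with x ≋? 0ℤ ⟨ + p ⟩
      ...   | yes _  = ≋-refl
      ...   | no x≁0 = contradiction (≋-trans e y~0) x≁0

    opaque
      -- For `v = tan θ` this is `tan (π/4 - θ)`. A fixed point satisfies `(v + 1)^2 = 2`, which is
      -- how square roots of 2 come in.
      möbius : ℤ → ℤ
      möbius v = (1ℤ - v) * inv (1ℤ + v)

      möbius-cong : ∀ {x y} → x ~ y → möbius x ~ möbius y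
      möbius-cong e = *-cong≋ (+-congˡ≋ 1ℤ (-‿cong≋ e)) (inv-cong (+-congˡ≋ 1ℤ e))

      möbius-solves : ∀ {v} → ¬ (1ℤ + v ~ 0ℤ) → möbius v * (1ℤ + v) ~ 1ℤ - v
      möbius-solves {v} 1+≁0 = from-combination (inv-* 1+≁0) (1ℤ - v) (lemma v (inv (1ℤ + v)))
        where
        lemma : ∀ v i → (1ℤ - v) * i * (1ℤ + v) ≡ 1ℤ - v + (1ℤ - v) * ((1ℤ + v) * i - 1ℤ)
        lemma = solve-∀

    module _ (2≁0 : ¬ (+ 2 ~ 0ℤ)) where

      -- On the projective line the group of the three maps has the short orbits `0, ∞, 1, -1` and
      -- `i, -i`, besides the one formed by the numbers `±1 ± √2`. Leaving out the first two also
      -- keeps every denominator nonzero.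
      record Regular (v : ℤ) : Set where
        constructor regular
        field
          ≁0  : ¬ (v ~ 0ℤ)
          ≁1  : ¬ (v ~ 1ℤ)
          ≁-1 : ¬ (v ~ -1ℤ)
          ≁i  : ¬ (v * v ~ -1ℤ)

        1+≁0 : ¬ (1ℤ + v ~ 0ℤ)
        1+≁0 e = ≁-1 (from-combination e 1ℤ (lemma v))
          where
          lemma : ∀ v → v ≡ -1ℤ + 1ℤ * (1ℤ + v - 0ℤ)
          lemma = solve-∀

        1-≁0 : ¬ (1ℤ - v ~ 0ℤ)
        1-≁0 e = ≁1 (from-combination e -1ℤ (lemma v))
          where
          lemma : ∀ v → v ≡ 1ℤ + -1ℤ * (1ℤ - v - 0ℤ)
          lemma = solve-∀

        möbius-* : möbius v * (1ℤ + v) ~ 1ℤ - v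
        möbius-* = möbius-solves 1+≁0

      open Regular

      regular-cong : ∀ {x y} → x ~ y → Regular x → Regular y
      regular-cong e (regular a b c d) = regular
        (λ h → a (≋-trans e h)) (λ h → b (≋-trans e h)) (λ h → c (≋-trans e h))
        (λ h → d (≋-trans (*-cong≋ e e) h))

      regular? : ∀ v → Dec (Regular v)
      regular? v with ¬? (v ≋? 0ℤ ⟨ + p ⟩) ×-dec ¬? (v ≋? 1ℤ ⟨ + p ⟩)
                      ×-dec ¬? (v ≋? -1ℤ ⟨ + p ⟩) ×-dec ¬? ((v * v) ≋? -1ℤ ⟨ + p ⟩)
      ... | yes (a , b , c , d) = yes (regular a b c d)
      ... | no ¬r = no λ { (regular a b c d) → ¬r (a , b , c , d) }

      regular-neg : ∀ {v} → Regular v → Regular (- v)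
      regular-neg {v} r = regular
        (λ e → ≁0 r (from-combination e -1ℤ (lemma₀ v)))
        (λ e → ≁-1 r (from-combination e -1ℤ (lemma₁ v)))
        (λ e → ≁1 r (from-combination e -1ℤ (lemma₂ v)))
        (λ e → ≁i r (from-combination e 1ℤ (lemma₃ v)))
        where
        lemma₀ : ∀ v → v ≡ 0ℤ + -1ℤ * (- v - 0ℤ)
        lemma₀ = solve-∀
        lemma₁ : ∀ v → v ≡ -1ℤ + -1ℤ * (- v - 1ℤ)
        lemma₁ = solve-∀
        lemma₂ : ∀ v → v ≡ 1ℤ + -1ℤ * (- v - -1ℤ)
        lemma₂ = solve-∀
        lemma₃ : ∀ v → v * v ≡ -1ℤ + 1ℤ * (- v * - v - -1ℤ)
        lemma₃ = solve-∀

      regular-inv : ∀ {v} → Regular v → Regular (inv v)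
      regular-inv {v} r = regular
        (λ e → ¬1~0 (from-combination₂ i e -1ℤ v (lemma₀ v (inv v))))
        (λ e → ≁1 r (from-combination₂ i e 1ℤ (- v) (lemma₁ v (inv v))))
        (λ e → ≁-1 r (from-combination₂ i e -1ℤ v (lemma₂ v (inv v))))
        (λ e → ≁i r (from-combination₂ i e (- (v * inv v + 1ℤ)) (v * v) (lemma₃ v (inv v))))
        where
        i = inv-* (≁0 r)
        lemma₀ : ∀ v w → 1ℤ ≡ 0ℤ + -1ℤ * (v * w - 1ℤ) + v * (w - 0ℤ)
        lemma₀ = solve-∀
        lemma₁ : ∀ v w → v ≡ 1ℤ + 1ℤ * (v * w - 1ℤ) + - v * (w - 1ℤ)
        lemma₁ = solve-∀
        lemma₂ : ∀ v w → v ≡ -1ℤ + -1ℤ * (v * w - 1ℤ) + v * (w - -1ℤ)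
        lemma₂ = solve-∀
        lemma₃ : ∀ v w → v * v ≡ -1ℤ + - (v * w + 1ℤ) * (v * w - 1ℤ) + v * v * (w * w - -1ℤ)
        lemma₃ = solve-∀

      regular-möbius : ∀ {v} → Regular v → Regular (möbius v)
      regular-möbius {v} r = regular
        (λ e → ≁1 r (from-combination₂ m e 1ℤ (- (1ℤ + v)) (lemma₀ v (möbius v))))
        (λ e → ≁0 r (cancel (+ 2) 2≁0 (from-combination₂ m e 1ℤ (- (1ℤ + v)) (lemma₁ v (möbius v)))))
        (λ e → 2≁0 (from-combination₂ m e -1ℤ (1ℤ + v) (lemma₂ v (möbius v))))
        (λ e → ≁i r (cancel (+ 2) 2≁0 (from-combination₂ m e
          (- (möbius v * (1ℤ + v) + (1ℤ - v))) ((1ℤ + v) * (1ℤ + v)) (lemma₃ v (möbius v)))))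
        where
        m = möbius-* r
        lemma₀ : ∀ v s → v ≡ 1ℤ + 1ℤ * (s * (1ℤ + v) - (1ℤ - v)) + - (1ℤ + v) * (s - 0ℤ)
        lemma₀ = solve-∀
        lemma₁ : ∀ v s → + 2 * v ≡ + 2 * 0ℤ + 1ℤ * (s * (1ℤ + v) - (1ℤ - v)) + - (1ℤ + v) * (s - 1ℤ)
        lemma₁ = solve-∀
        lemma₂ : ∀ v s → + 2 ≡ 0ℤ + -1ℤ * (s * (1ℤ + v) - (1ℤ - v)) + (1ℤ + v) * (s - -1ℤ)
        lemma₂ = solve-∀
        lemma₃ : ∀ v s → + 2 * (v * v) ≡ + 2 * -1ℤ
          + - (s * (1ℤ + v) + (1ℤ - v)) * (s * (1ℤ + v) - (1ℤ - v)) + (1ℤ + v) * (1ℤ + v) * (s * s - -1ℤ)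
        lemma₃ = solve-∀

      inv-neg : ∀ {v} → Regular v → inv (- v) ~ - inv v
      inv-neg {v} r = inv-unique (≋-trans (≋-reflexive (lemma v (inv v))) (inv-* (≁0 r)))
        where
        lemma : ∀ v w → - v * - w ≡ v * w
        lemma = solve-∀

      inv-inv : ∀ {v} → Regular v → inv (inv v) ~ v
      inv-inv {v} r = inv-unique (≋-trans (≋-reflexive (*-comm (inv v) v)) (inv-* (≁0 r)))

      -- Together with `möbius-inv` this says that conjugation by the möbius map exchanges negation
      -- and inversion, the defining relation of the dihedral group.
      möbius-neg : ∀ {v} → Regular v → möbius (- v) ~ inv (möbius v)
      möbius-neg {v} r = ≋-sym (inv-unique (cancel (1ℤ - v) (1-≁0 r) (cancel (1ℤ + v) (1+≁0 r)
        (from-combination₂ (möbius-* r) (möbius-* (regular-neg r))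
          (möbius (- v) * (1ℤ - v)) (1ℤ - v) (lemma v (möbius v) (möbius (- v)))))))
        where
        lemma : ∀ v s s′ → (1ℤ + v) * ((1ℤ - v) * (s * s′)) ≡ (1ℤ + v) * ((1ℤ - v) * 1ℤ)
          + s′ * (1ℤ - v) * (s * (1ℤ + v) - (1ℤ - v)) + (1ℤ - v) * (s′ * (1ℤ + - v) - (1ℤ - - v))
        lemma = solve-∀

      möbius-inv : ∀ {v} → Regular v → möbius (inv v) ~ - möbius v
      möbius-inv {v} r = cancel (1ℤ + v) (1+≁0 r) (≋-trans
        (from-combination₂ (inv-* (≁0 r)) (möbius-* (regular-inv r)) (- (1ℤ + q)) v (lemma₁ v (inv v) q))
        (from-combination (möbius-* r) 1ℤ (lemma₂ v (möbius v))))
        where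
        q = möbius (inv v)
        lemma₁ : ∀ v w q → (1ℤ + v) * q ≡ v - 1ℤ + - (1ℤ + q) * (v * w - 1ℤ) + v * (q * (1ℤ + w) - (1ℤ - w))
        lemma₁ = solve-∀
        lemma₂ : ∀ v s → v - 1ℤ ≡ (1ℤ + v) * - s + 1ℤ * (s * (1ℤ + v) - (1ℤ - v))
        lemma₂ = solve-∀

      möbius-möbius : ∀ {v} → Regular v → möbius (möbius v) ~ v
      möbius-möbius {v} r = cancel (+ 2) 2≁0 (from-combination₂ (möbius-* r) (möbius-* (regular-möbius r))
        (- (1ℤ + möbius (möbius v))) (1ℤ + v) (lemma v (möbius v) (möbius (möbius v))))
        where
        lemma : ∀ v s w → + 2 * w ≡ + 2 * v + - (1ℤ + w) * (s * (1ℤ + v) - (1ℤ - v))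
          + (1ℤ + v) * (w * (1ℤ + s) - (1ℤ - s))
        lemma = solve-∀

-- The value of (2 / h) from the residue of h modulo 8.

module SecondSupplement where
  open import Data.Integer.Base hiding (suc; _≤_; _<_)
  open import Data.Integer.Properties
  open import Data.Integer.Tactic.RingSolver using (solve-∀)
  open import Data.Nat.Base as ℕ using (ℕ; zero; suc)
  import Data.Nat.Properties as ℕ
  import Data.Nat.Divisibility as ℕ
  open import Data.Nat.Induction using (<-rec)
  open import Data.Nat.Primality using (Prime; prime⇒nonZero; prime⇒nonTrivial)
  open import Data.Nat.Primality.Factorisation using (factorise; PrimeFactorisation)
  open import Data.Nat.ListAction using (product)
  open import Data.List.Base using (List; []; _∷_; foldr; map)
  open import Data.List.Relation.Unary.All using (All; []; _∷_)
  open import Data.List.Relation.Unary.AllPairs using ([]; _∷_)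
  open import Data.List.Relation.Unary.Any using (here; there)
  open import Data.List.Membership.Propositional using (_∈_; _∉_)
  open import Data.List.Relation.Unary.Unique.Propositional using (Unique)
  open import Data.Fin.Base using (Fin; toℕ; fromℕ<)
  open import Data.Fin.Properties using (any?; toℕ-fromℕ<)
  import Data.Integer.DivMod as DivMod
  open import Data.Product.Base using (∃; _,_; _×_; proj₁)
  open import Data.Sum.Base using (_⊎_; inj₁; inj₂)
  open import Relation.Binary.PropositionalEquality
  open import Relation.Nullary.Negation using (¬_; contradiction)
  open import Relation.Nullary.Decidable using (Dec; yes; no; ¬?)
  open import Defs using (jacobi; legendre)
  open import Algebra.Properties.CommutativeMonoid.Sum ℕ.+-0-commutativeMonoid using (sum; sum-cong-≗; ∑-distrib-+)
  open Congruence
  open Residues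
  open Orbits
  open FinSums ℕ.+-0-commutativeMonoid

  -- The expected value of `(2 / n)`, indexed by the residue modulo 8; it is multiplicative and even
  -- in `n` by inspection of the table.
  data Sign8 (n : ℤ) : ℤ → Set where
    is+1 : n ≋ 1ℤ ⟨ + 8 ⟩  → Sign8 n 1ℤ
    is-1 : n ≋ -1ℤ ⟨ + 8 ⟩ → Sign8 n 1ℤ
    is+3 : n ≋ + 3 ⟨ + 8 ⟩ → Sign8 n -1ℤ
    is-3 : n ≋ - + 3 ⟨ + 8 ⟩ → Sign8 n -1ℤ

  Sign8-* : ∀ {a b ε δ} → Sign8 a ε → Sign8 b δ → Sign8 (a * b) (ε * δ)
  Sign8-* (is+1 p) (is+1 q) = is+1 (*-cong≋ p q)
  Sign8-* (is+1 p) (is-1 q) = is-1 (*-cong≋ p q)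
  Sign8-* (is+1 p) (is+3 q) = is+3 (*-cong≋ p q)
  Sign8-* (is+1 p) (is-3 q) = is-3 (*-cong≋ p q)
  Sign8-* (is-1 p) (is+1 q) = is-1 (*-cong≋ p q)
  Sign8-* (is-1 p) (is-1 q) = is+1 (*-cong≋ p q)
  Sign8-* (is-1 p) (is+3 q) = is-3 (*-cong≋ p q)
  Sign8-* (is-1 p) (is-3 q) = is+3 (*-cong≋ p q)
  Sign8-* (is+3 p) (is+1 q) = is+3 (*-cong≋ p q)
  Sign8-* (is+3 p) (is-1 q) = is-3 (*-cong≋ p q)
  Sign8-* (is+3 p) (is+3 q) = is+1 (≋-trans (*-cong≋ p q) (by (+ 1) refl))
  Sign8-* (is+3 p) (is-3 q) = is-1 (≋-trans (*-cong≋ p q) (by -1ℤ refl))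
  Sign8-* (is-3 p) (is+1 q) = is-3 (*-cong≋ p q)
  Sign8-* (is-3 p) (is-1 q) = is+3 (*-cong≋ p q)
  Sign8-* (is-3 p) (is+3 q) = is-1 (≋-trans (*-cong≋ p q) (by -1ℤ refl))
  Sign8-* (is-3 p) (is-3 q) = is+1 (≋-trans (*-cong≋ p q) (by (+ 1) refl))

  even≢odd-residue : ∀ {n r} → Odd n → n ≋ + 2 * r ⟨ + 8 ⟩ → ∀ {A : Set} → A
  even≢odd-residue {r = r} o e = contradiction
    (≋-trans (modulus-∣ (+ 4) e) (≋-trans (≋-reflexive (*-comm (+ 2) r)) (multiple≋0 r)))
    (λ ev → Even⇒¬Odd ev o)

  odd-Sign8 : ∀ {n} → Odd n → ∃ λ ε → Sign8 n ε
  odd-Sign8 {n} o with n %ℕ 8 | residue n 8 | DivMod.n%ℕd<d n 8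
  ... | 0 | e | _ = even≢odd-residue {r = 0ℤ} o e
  ... | 1 | e | _ = _ , is+1 e
  ... | 2 | e | _ = even≢odd-residue {r = 1ℤ} o e
  ... | 3 | e | _ = _ , is+3 e
  ... | 4 | e | _ = even≢odd-residue {r = + 2} o e
  ... | 5 | e | _ = _ , is-3 (≋-trans e (by 1ℤ refl))
  ... | 6 | e | _ = even≢odd-residue {r = + 3} o e
  ... | 7 | e | _ = _ , is-1 (≋-trans e (by 1ℤ refl))
  ... | suc (suc (suc (suc (suc (suc (suc (suc _))))))) | _ |
        ℕ.s≤s (ℕ.s≤s (ℕ.s≤s (ℕ.s≤s (ℕ.s≤s (ℕ.s≤s (ℕ.s≤s (ℕ.s≤s ())))))))

  odd-square≋1[8] : ∀ {x} → Odd x → x * x ≋ 1ℤ ⟨ + 8 ⟩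
  odd-square≋1[8] o with odd-Sign8 o
  ... | _ , is+1 p = *-cong≋ p p
  ... | _ , is-1 p = *-cong≋ p p
  ... | _ , is+3 p = ≋-trans (*-cong≋ p p) (by 1ℤ refl)
  ... | _ , is-3 p = ≋-trans (*-cong≋ p p) (by 1ℤ refl)

  IsSquare2 : ℕ → Set
  IsSquare2 n = ∃ λ x → x * x ≋ + 2 ⟨ + n ⟩

  Sign8⇒Odd : ∀ {n ε} → Sign8 n ε → Odd n
  Sign8⇒Odd (is+1 p) = modulus-∣ (+ 4) p
  Sign8⇒Odd (is-1 p) = ≋-trans (modulus-∣ (+ 4) p) (by -1ℤ refl)
  Sign8⇒Odd (is+3 p) = ≋-trans (modulus-∣ (+ 4) p) (by 1ℤ refl)
  Sign8⇒Odd (is-3 p) = ≋-trans (modulus-∣ (+ 4) p) (by (- + 2) refl)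

  -- For odd `n` the residues `r` and `n - r` have opposite parities and the same square.
  odd-representative : ∀ n → Odd (+ n) → ∀ x → ∃ λ y → + y * + y ≋ x * x ⟨ + n ⟩ × Odd (+ y) × y ℕ.≤ n
  odd-representative zero o x = contradiction o (Even⇒¬Odd ≋-refl)
  odd-representative n@(suc _) o x with parity (+ (x %ℕ n))
  ... | inj₂ odd = x %ℕ n , ≋-sym (*-cong≋ (residue x n) (residue x n)) , odd , ℕ.<⇒≤ (DivMod.n%ℕd<d x n)
  ... | inj₁ even = n ℕ.∸ r , square , odd , ℕ.m∸n≤m n r
    where
    r = x %ℕ n
    eq : + (n ℕ.∸ r) ≡ + n - + r
    eq = sym (trans (m-n≡m⊖n n r) (⊖-≥ (ℕ.<⇒≤ (DivMod.n%ℕd<d x n))))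
    negated : + (n ℕ.∸ r) ≋ - x ⟨ + n ⟩
    negated = ≋-trans (≋-reflexive eq) (≋-trans (+-cong≋ (≋-trans (≋-reflexive (sym (*-identityˡ (+ n)))) (multiple≋0 1ℤ))
            (-‿cong≋ (≋-sym (residue x n)))) (≋-reflexive (+-identityˡ (- x))))
    square : + (n ℕ.∸ r) * + (n ℕ.∸ r) ≋ x * x ⟨ + n ⟩
    square = ≋-trans (*-cong≋ negated negated) (≋-reflexive (lemma x))
      where
      lemma : ∀ x → - x * - x ≡ x * x
      lemma = solve-∀
    odd : Odd (+ (n ℕ.∸ r))
    odd = ≋-trans (≋-reflexive eq) (+-cong≋ o (-‿cong≋ even))

  >2 : ∀ n → Sign8 (+ n) -1ℤ → 2 ℕ.< n
  >2 n s = ℕ.≰⇒> (λ n≤2 → absurd n n≤2 s)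
    where
    absurd : ∀ n → n ℕ.≤ 2 → ¬ Sign8 (+ n) -1ℤ
    absurd 0 _ (is+3 p) = contradiction (ℕ.∣⇒≤ (to-[mod] p)) λ { (ℕ.s≤s (ℕ.s≤s (ℕ.s≤s ()))) }
    absurd 0 _ (is-3 p) = contradiction (ℕ.∣⇒≤ (to-[mod] p)) λ { (ℕ.s≤s (ℕ.s≤s (ℕ.s≤s ()))) }
    absurd 1 _ (is+3 p) = contradiction (ℕ.∣⇒≤ (to-[mod] p)) λ { (ℕ.s≤s (ℕ.s≤s ())) }
    absurd 1 _ (is-3 p) = contradiction (ℕ.∣⇒≤ (to-[mod] p)) λ { (ℕ.s≤s (ℕ.s≤s (ℕ.s≤s (ℕ.s≤s ())))) }
    absurd 2 _ (is+3 p) = contradiction (ℕ.∣⇒≤ (to-[mod] p)) λ { (ℕ.s≤s ()) }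
    absurd 2 _ (is-3 p) = contradiction (ℕ.∣⇒≤ (to-[mod] p)) λ { (ℕ.s≤s (ℕ.s≤s (ℕ.s≤s (ℕ.s≤s (ℕ.s≤s ()))))) }
    absurd (suc (suc (suc _))) (ℕ.s≤s (ℕ.s≤s ()))

  -- Descent: an odd x ≤ n with x² = 2 + n q has q < n and n q ≡ -1 (mod 8), so that q inherits the properties of n.
  2-nonsquare : ∀ n → Sign8 (+ n) -1ℤ → ¬ IsSquare2 n
  2-nonsquare = <-rec (λ n → Sign8 (+ n) -1ℤ → ¬ IsSquare2 n) step
    where
    step : ∀ n → (∀ {m} → m ℕ.< n → Sign8 (+ m) -1ℤ → ¬ IsSquare2 m) → Sign8 (+ n) -1ℤ → ¬ IsSquare2 n
    step n rec s (x , x²≋2) with odd-representative n (Sign8⇒Odd s) x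
    ... | y , y²≋x² , odd-y , y≤n with ≋-trans y²≋x² x²≋2
    ...   | by (+ zero) eq = Even⇒¬Odd {+ y * + y} (≋-trans (≋-reflexive eq) (by 1ℤ refl)) (Odd-* odd-y odd-y)
    ...   | by -[1+ w ] eq = contradiction (ℕ.≤-trans (ℕ.≤-trans (ℕ.m≤m+n n (w ℕ.* n)) (ℕ.m≤n+m _ (y ℕ.* y)))
                                (ℕ.≤-reflexive eqℕ)) (ℕ.<⇒≱ (>2 n s))
      where
      eqℕ : y ℕ.* y ℕ.+ suc w ℕ.* n ≡ 2
      eqℕ = +-injective (begin
        + (y ℕ.* y ℕ.+ suc w ℕ.* n) ≡⟨ cong₂ _+_ (pos-* y y) (pos-* (suc w) n) ⟩
        + y * + y + + suc w * + n ≡⟨ cong (_+ + suc w * + n) eq ⟩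
        + 2 + -[1+ w ] * + n + + suc w * + n ≡⟨ lemma (+ suc w) (+ n) ⟩
        + 2 ∎)
        where
        open ≡-Reasoning
        lemma : ∀ w n → + 2 + - w * n + w * n ≡ + 2
        lemma = solve-∀
    ...   | by (+ suc w) eq = rec q<n q-sign (+ y , by (+ n) (trans eq (cong (λ z → + 2 + z) (*-comm (+ suc w) (+ n)))))
      where
      eqℕ : y ℕ.* y ≡ 2 ℕ.+ suc w ℕ.* n
      eqℕ = +-injective (trans (pos-* y y) (trans eq (cong (λ z → + 2 + z) (sym (pos-* (suc w) n)))))
      q<n : suc w ℕ.< n
      q<n = ℕ.*-cancelʳ-< n (suc w) n (ℕ.<-≤-trans (ℕ.≤-<-trans (ℕ.n≤1+n _) (ℕ.n<1+n _))
              (ℕ.≤-trans (ℕ.≤-reflexive (sym eqℕ)) (ℕ.*-mono-≤ y≤n y≤n)))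
      qn≋-1 : + suc w * + n ≋ -1ℤ ⟨ + 8 ⟩
      qn≋-1 = ≋-trans (≋-reflexive (lemma (+ suc w * + n))) (+-congˡ≋ (- + 2)
                (≋-trans (≋-reflexive (sym eq)) (odd-square≋1[8] odd-y)))
        where
        lemma : ∀ z → z ≡ - + 2 + (+ 2 + z)
        lemma = solve-∀
      q-sign : Sign8 (+ suc w) -1ℤ
      q-sign = inherit s
        where
        inherit : Sign8 (+ n) -1ℤ → Sign8 (+ suc w) -1ℤ
        inherit (is+3 e) = is-3 (≋-trans (by (- (+ suc w)) (lemma (+ suc w)))
              (*-congʳ≋ (+ 3) (≋-trans (*-congˡ≋ (+ suc w) (≋-sym e)) qn≋-1)))
          where
          lemma : ∀ z → z ≡ z * + 3 * + 3 + - z * + 8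
          lemma = solve-∀
        inherit (is-3 e) = is+3 (≋-trans (by (- (+ suc w)) (lemma (+ suc w)))
              (*-congʳ≋ (- + 3) (≋-trans (*-congˡ≋ (+ suc w) (≋-sym e)) qn≋-1)))
          where
          lemma : ∀ z → z ≡ z * - + 3 * - + 3 + - z * + 8
          lemma = solve-∀

  -- The maps t ↦ - t, 1 / t, (1 - t) / (1 + t) generate a dihedral group of order 8.  A fixed point
  -- of one of its elements on the regular t would give a square root of 2, so if there is none the
  -- p - 3 or p - 5 regular residues split into orbits of length 8.
  module _ {p} (prime : Prime p) (nonsquare : ¬ IsSquare2 p) where
    private
      instance
        p≢0 : ℕ.NonZero p
        p≢0 = prime⇒nonZero prime

      infix 4 _~_
      _~_ : ℤ → ℤ → Set
      a ~ b = a ≋ b ⟨ + p ⟩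

      2≁0 : ¬ (+ 2 ~ 0ℤ)
      2≁0 e = nonsquare (0ℤ , ≋-sym e)

      module F = PrimeField.Arithmetic prime
      open F using (from-combination; from-combination₂)
      Regular : ℤ → Set
      Regular = F.Regular 2≁0
      module Regular {v} (r : F.Regular 2≁0 v) = F.Regular r
      inv = F.inv
      möbius = F.möbius

      X : Fin p → Set
      X i = Regular (val i)

      X? : (i : Fin p) → Dec (X i)
      X? i = F.regular? 2≁0 (val i)

      s₁ s₂ s₃ : Fin p → Fin p
      s₁ i = idx (- val i)
      s₂ i = idx (inv (val i))
      s₃ i = idx (möbius (val i))

      X-s₁ : ∀ {i} → X i → X (s₁ i)
      X-s₁ r = F.regular-cong 2≁0 (≋-sym (val-idx _)) (F.regular-neg 2≁0 r)
      X-s₂ : ∀ {i} → X i → X (s₂ i)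
      X-s₂ r = F.regular-cong 2≁0 (≋-sym (val-idx _)) (F.regular-inv 2≁0 r)
      X-s₃ : ∀ {i} → X i → X (s₃ i)
      X-s₃ r = F.regular-cong 2≁0 (≋-sym (val-idx _)) (F.regular-möbius 2≁0 r)

      s₁s₁ : ∀ i → s₁ (s₁ i) ≡ i
      s₁s₁ i = trans (idx-cong (≋-trans (-‿cong≋ (val-idx (- val i))) (≋-reflexive (neg-involutive (val i))))) (idx-val i)

      s₂s₂ : ∀ {i} → X i → s₂ (s₂ i) ≡ i
      s₂s₂ {i} r = trans (idx-cong (≋-trans (F.inv-cong (val-idx _)) (F.inv-inv 2≁0 r))) (idx-val i)

      s₃s₃ : ∀ {i} → X i → s₃ (s₃ i) ≡ i
      s₃s₃ {i} r = trans (idx-cong (≋-trans (F.möbius-cong (val-idx _)) (F.möbius-möbius 2≁0 r))) (idx-val i)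

      s₂s₁ : ∀ {i} → X i → s₂ (s₁ i) ≡ s₁ (s₂ i)
      s₂s₁ r = idx-cong (≋-trans (F.inv-cong (val-idx _)) (≋-trans (F.inv-neg 2≁0 r) (-‿cong≋ (≋-sym (val-idx _)))))

      s₃s₁ : ∀ {i} → X i → s₃ (s₁ i) ≡ s₂ (s₃ i)
      s₃s₁ r = idx-cong (≋-trans (F.möbius-cong (val-idx _)) (≋-trans (F.möbius-neg 2≁0 r) (F.inv-cong (≋-sym (val-idx _)))))

      s₃s₂ : ∀ {i} → X i → s₃ (s₂ i) ≡ s₁ (s₃ i)
      s₃s₂ r = idx-cong (≋-trans (F.möbius-cong (val-idx _)) (≋-trans (F.möbius-inv 2≁0 r) (-‿cong≋ (≋-sym (val-idx _)))))

      at : ∀ {y} {i : Fin p} → idx y ≡ i → y ~ val i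
      at {y} eq = ≋-trans (≋-sym (val-idx y)) (≋-reflexive (cong val eq))

      s₁≢ : ∀ {i} → X i → s₁ i ≢ i
      s₁≢ {i} r eq = Regular.≁0 r (F.cancel (+ 2) 2≁0 (from-combination (at eq) -1ℤ (lemma (val i))))
        where
        lemma : ∀ v → + 2 * v ≡ + 2 * 0ℤ + -1ℤ * (- v - v)
        lemma = solve-∀

      s₂≢ : ∀ {i} → X i → s₂ i ≢ i
      s₂≢ {i} r eq with F.zero-product (v - 1ℤ) (v + 1ℤ)
                          (from-combination₂ (F.inv-* (Regular.≁0 r)) (at eq) 1ℤ (- v) (lemma v (inv v)))
        where
        v = val i
        lemma : ∀ v w → (v - 1ℤ) * (v + 1ℤ) ≡ 0ℤ + 1ℤ * (v * w - 1ℤ) + - v * (w - v)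
        lemma = solve-∀
      ... | inj₁ e = Regular.≁1 r (from-combination e 1ℤ (lemma (val i)))
        where
        lemma : ∀ v → v ≡ 1ℤ + 1ℤ * (v - 1ℤ - 0ℤ)
        lemma = solve-∀
      ... | inj₂ e = Regular.≁-1 r (from-combination e 1ℤ (lemma (val i)))
        where
        lemma : ∀ v → v ≡ -1ℤ + 1ℤ * (v + 1ℤ - 0ℤ)
        lemma = solve-∀

      s₂≢s₁ : ∀ {i} → X i → s₂ i ≢ s₁ i
      s₂≢s₁ {i} r eq = Regular.≁i r (from-combination₂ (F.inv-* (Regular.≁0 r)) (idx-injective eq)
          -1ℤ v (lemma v (inv v)))
        where
        v = val i
        lemma : ∀ v w → v * v ≡ -1ℤ + -1ℤ * (v * w - 1ℤ) + v * (w - - v)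
        lemma = solve-∀

      -- Here `v + 1` would be a square root of 2, and in `s₃≢s₁s₂` it is `v - 1`. The other
      -- coincidences force `v` to be 0, 1, -1 or a square root of -1, which regularity excludes.
      s₃≢ : ∀ {i} → X i → s₃ i ≢ i
      s₃≢ {i} r eq = nonsquare (v + 1ℤ , from-combination₂ (Regular.möbius-* r) (at eq)
          1ℤ (- (1ℤ + v)) (lemma v (möbius v)))
        where
        v = val i
        lemma : ∀ v s → (v + 1ℤ) * (v + 1ℤ) ≡ + 2 + 1ℤ * (s * (1ℤ + v) - (1ℤ - v)) + - (1ℤ + v) * (s - v)
        lemma = solve-∀

      s₃≢s₁ : ∀ {i} → X i → s₃ i ≢ s₁ i
      s₃≢s₁ {i} r eq = Regular.≁i r (from-combination₂ (Regular.möbius-* r) (idx-injective eq)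
          -1ℤ (1ℤ + v) (lemma v (möbius v)))
        where
        v = val i
        lemma : ∀ v s → v * v ≡ -1ℤ + -1ℤ * (s * (1ℤ + v) - (1ℤ - v)) + (1ℤ + v) * (s - - v)
        lemma = solve-∀

      s₃≢s₂ : ∀ {i} → X i → s₃ i ≢ s₂ i
      s₃≢s₂ {i} r eq = Regular.≁i r (from-combination₂ m (F.inv-* (Regular.≁0 r)) 1ℤ (- (1ℤ + v)) (lemma v (inv v)))
        where
        v = val i
        m : inv v * (1ℤ + v) * v ~ (1ℤ - v) * v
        m = *-congʳ≋ v (≋-trans (*-congʳ≋ (1ℤ + v) (≋-sym (idx-injective eq))) (Regular.möbius-* r))
        lemma : ∀ v w → v * v ≡ -1ℤ + 1ℤ * (w * (1ℤ + v) * v - (1ℤ - v) * v) + - (1ℤ + v) * (v * w - 1ℤ)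
        lemma = solve-∀

      s₃≢s₁s₂ : ∀ {i} → X i → s₃ i ≢ s₁ (s₂ i)
      s₃≢s₁s₂ {i} r eq = nonsquare (v - 1ℤ , from-combination₂ m (F.inv-* (Regular.≁0 r)) 1ℤ (1ℤ + v) (lemma v (inv v)))
        where
        v = val i
        m : - inv v * (1ℤ + v) * v ~ (1ℤ - v) * v
        m = *-congʳ≋ v (≋-trans (*-congʳ≋ (1ℤ + v) (≋-trans (-‿cong≋ (≋-sym (val-idx (inv v)))) (≋-sym (idx-injective eq))))
              (Regular.möbius-* r))
        lemma : ∀ v w → (v - 1ℤ) * (v - 1ℤ) ≡ + 2 + 1ℤ * (- w * (1ℤ + v) * v - (1ℤ - v) * v) + (1ℤ + v) * (v * w - 1ℤ)
        lemma = solve-∀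

      open Representatives X?
      open Choice using (rep; chosen?)

      -- The partition into single points. Merging along `s₁`, `s₂` and `s₃` in turn gives classes
      -- of 2, 4 and 8 points.
      C₀ : Choice
      C₀ = record { rep = λ i → i ; rep∈ = λ r → r ; idem = λ _ → refl }

      R₁ : Refinement C₀ s₁
      R₁ = refine C₀ s₁ record
        { closed = X-s₁ ; compatible = λ _ _ → cong s₁ ; involutive = λ {i} _ → s₁s₁ i ; free = s₁≢ }
      module R₁ = Refinement R₁
      C₁ = R₁.refined
      c₁ = rep C₁

      c₁-class : ∀ {x y} → c₁ x ≡ c₁ y → y ≡ x ⊎ y ≡ s₁ x
      c₁-class {x} {y} eq with R₁.one-of x | R₁.one-of y
      ... | inj₁ a | inj₁ b = inj₁ (trans (sym b) (trans (sym eq) a))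
      ... | inj₂ a | inj₁ b = inj₂ (trans (sym b) (trans (sym eq) a))
      ... | inj₁ a | inj₂ b = inj₂ (trans (sym (s₁s₁ y)) (cong s₁ (trans (sym b) (trans (sym eq) a))))
      ... | inj₂ a | inj₂ b = inj₁ (trans (sym (s₁s₁ y)) (trans (cong s₁ (trans (sym b) (trans (sym eq) a))) (s₁s₁ x)))

      R₂ : Refinement C₁ s₂
      R₂ = refine C₁ s₂ record
        { closed = X-s₂ ; compatible = compatible ; involutive = λ r → cong c₁ (s₂s₂ r) ; free = free }
        where
        compatible : ∀ {x y} → X x → X y → c₁ x ≡ c₁ y → c₁ (s₂ x) ≡ c₁ (s₂ y)
        compatible {x} {y} r _ eq with c₁-class {x} {y} eq
        ... | inj₁ refl = refl
        ... | inj₂ refl = sym (trans (cong c₁ (s₂s₁ r)) (R₁.absorbs (X-s₂ r)))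
        free : ∀ {x} → X x → c₁ (s₂ x) ≢ c₁ x
        free {x} r eq with c₁-class {x} {s₂ x} (sym eq)
        ... | inj₁ e = s₂≢ r e
        ... | inj₂ e = s₂≢s₁ r e
      module R₂ = Refinement R₂
      C₂ = R₂.refined
      c₂ = rep C₂

      c₂-s₁ : ∀ {x} → X x → c₂ (s₁ x) ≡ c₂ x
      c₂-s₁ r = R₂.respects (X-s₁ r) r (R₁.absorbs r)

      -- The orbit of `x` under the Klein group of `s₁` and `s₂`, written out in order that `s₃ x`
      -- can be shown to avoid each of its four points.
      Class₂ : Fin p → Fin p → Set
      Class₂ x y = (y ≡ x ⊎ y ≡ s₁ x) ⊎ (y ≡ s₂ x ⊎ y ≡ s₁ (s₂ x))

      c₂-class : ∀ {x y} → X x → X y → c₂ x ≡ c₂ y → Class₂ x y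
      c₂-class {x} {y} r q eq with R₂.one-of x | R₂.one-of y
      ... | inj₁ a | inj₁ b = inj₁ (c₁-class (trans (sym a) (trans eq b)))
      ... | inj₂ a | inj₁ b = inj₂ (c₁-class (trans (sym a) (trans eq b)))
      ... | inj₁ a | inj₂ b with c₁-class (trans (sym a) (trans eq b))
      ...   | inj₁ e = inj₂ (inj₁ (trans (sym (s₂s₂ q)) (cong s₂ e)))
      ...   | inj₂ e = inj₂ (inj₂ (trans (sym (s₂s₂ q)) (trans (cong s₂ e) (s₂s₁ r))))
      c₂-class {x} {y} r q eq | inj₂ a | inj₂ b with c₁-class (trans (sym a) (trans eq b))
      ...   | inj₁ e = inj₁ (inj₁ (trans (sym (s₂s₂ q)) (trans (cong s₂ e) (s₂s₂ r))))
      ...   | inj₂ e = inj₁ (inj₂ (trans (sym (s₂s₂ q)) (trans (cong s₂ e) (trans (s₂s₁ (X-s₂ r)) (cong s₁ (s₂s₂ r))))))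

      R₃ : Refinement C₂ s₃
      R₃ = refine C₂ s₃ record
        { closed = X-s₃ ; compatible = compatible ; involutive = λ r → cong c₂ (s₃s₃ r) ; free = free }
        where
        c₂s₃s₁ : ∀ {x} → X x → c₂ (s₃ (s₁ x)) ≡ c₂ (s₃ x)
        c₂s₃s₁ r = trans (cong c₂ (s₃s₁ r)) (R₂.absorbs (X-s₃ r))
        c₂s₃s₂ : ∀ {x} → X x → c₂ (s₃ (s₂ x)) ≡ c₂ (s₃ x)
        c₂s₃s₂ r = trans (cong c₂ (s₃s₂ r)) (c₂-s₁ (X-s₃ r))
        compatible : ∀ {x y} → X x → X y → c₂ x ≡ c₂ y → c₂ (s₃ x) ≡ c₂ (s₃ y)
        compatible r q eq with c₂-class r q eq
        ... | inj₁ (inj₁ refl) = refl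
        ... | inj₁ (inj₂ refl) = sym (c₂s₃s₁ r)
        ... | inj₂ (inj₁ refl) = sym (c₂s₃s₂ r)
        ... | inj₂ (inj₂ refl) = sym (trans (c₂s₃s₁ (X-s₂ r)) (c₂s₃s₂ r))
        free : ∀ {x} → X x → c₂ (s₃ x) ≢ c₂ x
        free r eq with c₂-class r (X-s₃ r) (sym eq)
        ... | inj₁ (inj₁ e) = s₃≢ r e
        ... | inj₁ (inj₂ e) = s₃≢s₁ r e
        ... | inj₂ (inj₁ e) = s₃≢s₂ r e
        ... | inj₂ (inj₂ e) = s₃≢s₁s₂ r e
      module R₃ = Refinement R₃

      irregular : ℕ
      irregular = count (λ i → ¬? (X? i))

      total : p ≡ 8 ℕ.* count (chosen? R₃.refined) ℕ.+ irregular
      total = begin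
        p ≡⟨ ℕ.*-identityʳ p ⟨
        p ℕ.* 1 ≡⟨ sum-replicate-ℕ p ⟨
        sum {p} (λ _ → 1) ≡⟨ sum-cong-≗ (λ i → split (X? i)) ⟩
        sum (λ i → indicator (X? i) ℕ.+ indicator (¬? (X? i))) ≡⟨ ∑-distrib-+ (λ i → indicator (X? i)) _ ⟩
        count X? ℕ.+ irregular ≡⟨ cong (ℕ._+ irregular) (count-⇔ X? (chosen? C₀) (λ _ r → r , refl) (λ _ → proj₁)) ⟩
        count (chosen? C₀) ℕ.+ irregular ≡⟨ cong (ℕ._+ irregular) (trans R₁.halved (cong (2 ℕ.*_) (trans R₂.halved (cong (2 ℕ.*_) R₃.halved)))) ⟩
        2 ℕ.* (2 ℕ.* (2 ℕ.* N)) ℕ.+ irregular ≡⟨ cong (ℕ._+ irregular) (trans (cong (2 ℕ.*_) (sym (ℕ.*-assoc 2 2 N))) (sym (ℕ.*-assoc 2 4 N))) ⟩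
        8 ℕ.* N ℕ.+ irregular ∎
        where
        open ≡-Reasoning
        N = count (chosen? R₃.refined)
        split : ∀ {P : Set} (d : Dec P) → 1 ≡ indicator d ℕ.+ indicator (¬? d)
        split (yes _) = refl
        split (no _)  = refl
        sum-replicate-ℕ : ∀ n → sum {n} (λ _ → 1) ≡ n ℕ.* 1
        sum-replicate-ℕ zero    = refl
        sum-replicate-ℕ (suc n) = cong suc (sum-replicate-ℕ n)

      irregular-list : ∀ {L} → Unique L → (∀ i → ¬ X i → i ∈ L) → All (λ i → ¬ X i) L →
        irregular ≡ foldr (λ _ → suc) 0 L
      irregular-list {L} uniq complete sound = trans
        (sum-support uniq (λ i i∉L → indicator-no (¬? (X? i)) (λ ¬x → i∉L (complete i ¬x)))) (ones sound)
        where
        ones : ∀ {K} → All (λ i → ¬ X i) K → foldr ℕ._+_ 0 (map (λ i → indicator (¬? (X? i))) K) ≡ foldr (λ _ → suc) 0 K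
        ones [] = refl
        ones (¬x ∷ ps) = cong₂ ℕ._+_ (indicator-yes (¬? (X? _)) ¬x) (ones ps)

      at-idx : ∀ {i : Fin p} {y} → val i ~ y → i ≡ idx y
      at-idx {i} e = trans (sym (idx-val i)) (idx-cong e)

      0≢1 : idx {p} 0ℤ ≢ idx 1ℤ
      0≢1 eq = F.¬1~0 (≋-sym (idx-injective eq))

      0≢-1 : idx {p} 0ℤ ≢ idx -1ℤ
      0≢-1 eq = F.¬1~0 (from-combination (idx-injective eq) 1ℤ refl)

      1≢-1 : idx {p} 1ℤ ≢ idx -1ℤ
      1≢-1 eq = 2≁0 (from-combination (idx-injective eq) 1ℤ refl)

      irregular-0 : ¬ X (idx 0ℤ)
      irregular-0 r = Regular.≁0 r (val-idx 0ℤ)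
      irregular-1 : ¬ X (idx 1ℤ)
      irregular-1 r = Regular.≁1 r (val-idx 1ℤ)
      irregular₋₁ : ¬ X (idx -1ℤ)
      irregular₋₁ r = Regular.≁-1 r (val-idx -1ℤ)

      classify : ∀ i → ¬ X i → (i ≡ idx 0ℤ ⊎ i ≡ idx 1ℤ ⊎ i ≡ idx -1ℤ) ⊎ val i * val i ~ -1ℤ
      classify i ¬x with val i ≋? 0ℤ ⟨ + p ⟩ | val i ≋? 1ℤ ⟨ + p ⟩ | val i ≋? -1ℤ ⟨ + p ⟩ | (val i * val i) ≋? -1ℤ ⟨ + p ⟩
      ... | yes e | _ | _ | _ = inj₁ (inj₁ (at-idx e))
      ... | no _ | yes e | _ | _ = inj₁ (inj₂ (inj₁ (at-idx e)))
      ... | no _ | no _ | yes e | _ = inj₁ (inj₂ (inj₂ (at-idx e)))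
      ... | no _ | no _ | no _ | yes e = inj₂ e
      ... | no a | no b | no c | no d = contradiction (F.regular a b c d) ¬x

      -- Besides 0, 1 and -1 there are either no square roots of -1 or exactly two. All these are
      -- distinct since `p` is odd: modulo 2 the number 0 would be a square root of 2.
      irregular≡3⊎5 : irregular ≡ 3 ⊎ irregular ≡ 5
      irregular≡3⊎5 with any? (λ i → (val {p} i * val i) ≋? -1ℤ ⟨ + p ⟩)
      ... | no none = inj₁ (irregular-list
              ((0≢1 ∷ 0≢-1 ∷ []) ∷ (1≢-1 ∷ []) ∷ [] ∷ []) complete (irregular-0 ∷ irregular-1 ∷ irregular₋₁ ∷ []))
        where
        complete : ∀ i → ¬ X i → i ∈ idx 0ℤ ∷ idx 1ℤ ∷ idx -1ℤ ∷ []
        complete i ¬x with classify i ¬x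
        ... | inj₁ (inj₁ e) = here e
        ... | inj₁ (inj₂ (inj₁ e)) = there (here e)
        ... | inj₁ (inj₂ (inj₂ e)) = there (there (here e))
        ... | inj₂ e = contradiction (i , e) none
      ... | yes (j , j²~-1) = inj₂ (irregular-list
              ((0≢1 ∷ 0≢-1 ∷ 0≢ j²~-1 ∷ 0≢ [-j]²~-1 ∷ []) ∷ (1≢-1 ∷ 1≢ j²~-1 ∷ 1≢ [-j]²~-1 ∷ []) ∷
               (-1≢ j²~-1 ∷ -1≢ [-j]²~-1 ∷ []) ∷ (j≢-j ∷ []) ∷ [] ∷ [])
              complete (irregular-0 ∷ irregular-1 ∷ irregular₋₁ ∷ irregular-i j²~-1 ∷ irregular-i [-j]²~-1 ∷ []))
        where
        v = val j
        [-v]²~-1 : - v * - v ~ -1ℤ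
        [-v]²~-1 = ≋-trans (≋-reflexive (lemma v)) j²~-1
          where
          lemma : ∀ v → - v * - v ≡ v * v
          lemma = solve-∀
        [-j]²~-1 : val (s₁ j) * val (s₁ j) ~ -1ℤ
        [-j]²~-1 = ≋-trans (*-cong≋ (val-idx (- v)) (val-idx (- v))) [-v]²~-1
        irregular-i : ∀ {i : Fin p} → val i * val i ~ -1ℤ → ¬ X i
        irregular-i e r = Regular.≁i r e
        0≢ : ∀ {i : Fin p} → val i * val i ~ -1ℤ → idx 0ℤ ≢ i
        0≢ e eq = F.¬1~0 (from-combination (≋-trans (*-cong≋ (at eq) (at eq)) e) 1ℤ refl)
        1≢ : ∀ {i : Fin p} → val i * val i ~ -1ℤ → idx 1ℤ ≢ i
        1≢ e eq = 2≁0 (from-combination (≋-trans (*-cong≋ (at eq) (at eq)) e) 1ℤ refl)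
        -1≢ : ∀ {i : Fin p} → val i * val i ~ -1ℤ → idx -1ℤ ≢ i
        -1≢ e eq = 2≁0 (from-combination (≋-trans (*-cong≋ (at eq) (at eq)) e) 1ℤ refl)
        v≁0 : ¬ (v ~ 0ℤ)
        v≁0 e = F.¬1~0 (from-combination (≋-trans (≋-sym (*-cong≋ e e)) j²~-1) 1ℤ refl)
        j≢-j : j ≢ s₁ j
        j≢-j eq = v≁0 (F.cancel (+ 2) 2≁0 (from-combination (≋-sym (at (sym eq))) 1ℤ (lemma v)))
          where
          lemma : ∀ v → + 2 * v ≡ + 2 * 0ℤ + 1ℤ * (v - - v)
          lemma = solve-∀
        complete : ∀ i → ¬ X i → i ∈ idx 0ℤ ∷ idx 1ℤ ∷ idx -1ℤ ∷ j ∷ s₁ j ∷ []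
        complete i ¬x with classify i ¬x
        ... | inj₁ (inj₁ e) = here e
        ... | inj₁ (inj₂ (inj₁ e)) = there (here e)
        ... | inj₁ (inj₂ (inj₂ e)) = there (there (here e))
        ... | inj₂ e with F.zero-product (val i - v) (val i + v)
                            (from-combination₂ e j²~-1 1ℤ -1ℤ (lemma (val i) v))
          where
          lemma : ∀ a v → (a - v) * (a + v) ≡ 0ℤ + 1ℤ * (a * a - -1ℤ) + -1ℤ * (v * v - -1ℤ)
          lemma = solve-∀
        ...   | inj₁ z = there (there (there (here (val-injective (from-combination z 1ℤ (lemma (val i) v))))))
          where
          lemma : ∀ a v → a ≡ v + 1ℤ * (a - v - 0ℤ)
          lemma = solve-∀
        ...   | inj₂ z = there (there (there (there (here (at-idx (from-combination z 1ℤ (lemma (val i) v)))))))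
          where
          lemma : ∀ a v → a ≡ - v + 1ℤ * (a + v - 0ℤ)
          lemma = solve-∀

      p≋irregular : + p ≋ + irregular ⟨ + 8 ⟩
      p≋irregular = by (+ N) (trans (cong +_ (trans total (ℕ.+-comm (8 ℕ.* N) irregular)))
          (cong (λ z → + irregular + z) (trans (pos-* 8 N) (*-comm (+ 8) (+ N)))))
        where N = count (chosen? R₃.refined)

    -- The regular residues fill orbits of length 8, so `p` is congruent modulo 8 to the number of
    -- irregular ones, 3 or 5.
    nonsquare⇒Sign8 : Sign8 (+ p) -1ℤ
    nonsquare⇒Sign8 with irregular≡3⊎5
    ... | inj₁ eq = is+3 (≋-trans p≋irregular (≋-reflexive (cong +_ eq)))
    ... | inj₂ eq = is-3 (≋-trans p≋irregular (≋-trans (≋-reflexive (cong +_ eq)) (by 1ℤ refl)))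

  odd-prime∤2 : ∀ {p} → Prime p → Odd (+ p) → ¬ (p ℕ.∣ 2)
  odd-prime∤2 {p} p-prime odd p∣2 = go p p-prime odd (ℕ.∣⇒≤ p∣2)
    where
    go : ∀ p → Prime p → Odd (+ p) → ¬ (p ℕ.≤ 2)
    go 0 p-prime _   _ = contradiction refl (ℕ.≢-nonZero⁻¹ 0 {{prime⇒nonZero p-prime}})
    go 1 p-prime _   _ = contradiction refl (ℕ.nonTrivial⇒≢1 {{prime⇒nonTrivial p-prime}})
    go 2 _     odd _ = Even⇒¬Odd {+ 2} (by 1ℤ refl) odd
    go (suc (suc (suc _))) _ _ (ℕ.s≤s (ℕ.s≤s ()))

  square : ∀ {p} (x : Fin p) → p ℕ.∣ ∣ (+ toℕ x) ^ 2 - + 2 ∣ → IsSquare2 p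
  square x d = + toℕ x , ≋-trans (≋-reflexive (cong (+ toℕ x *_) (sym (*-identityʳ (+ toℕ x))))) (from-[mod] d)

  -- If 2 is no square, the orbit count gives the residue of `p`; if it is one, the descent excludes
  -- 3 and -3.
  legendre-2 : ∀ {p} → Prime p → Odd (+ p) → Sign8 (+ p) (legendre (+ 2) p)
  legendre-2 {p} p-prime odd with p ℕ.∣? 2
  ... | yes p∣2 = contradiction p∣2 (odd-prime∤2 p-prime odd)
  ... | no _ with any? {n = p} (λ x → p ℕ.∣? ∣ (+ toℕ x) ^ 2 - + 2 ∣)
  ...   | no none = nonsquare⇒Sign8 p-prime nonsquare
    where
    instance
      p≢0 : ℕ.NonZero p
      p≢0 = prime⇒nonZero p-prime
    nonsquare : ¬ IsSquare2 p
    nonsquare (x , x²≋2) = none (fromℕ< r<p , to-[mod] (≋-trans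
        (≋-reflexive (trans (cong (λ r → (+ r) ^ 2) (toℕ-fromℕ< r<p)) (cong (+ (x %ℕ p) *_) (*-identityʳ (+ (x %ℕ p))))))
        (≋-trans (*-cong≋ (≋-sym (residue x p)) (≋-sym (residue x p))) x²≋2)))
      where
      r<p : x %ℕ p ℕ.< p
      r<p = DivMod.n%ℕd<d x p
  ...   | yes (x , d) with odd-Sign8 odd
  ...     | _ , is+1 e = is+1 e
  ...     | _ , is-1 e = is-1 e
  ...     | _ , s@(is+3 _) = contradiction (square x d) (2-nonsquare p s)
  ...     | _ , s@(is-3 _) = contradiction (square x d) (2-nonsquare p s)

  product-Sign8 : ∀ {ps} → All Prime ps → Odd (+ product ps) →
    Sign8 (+ product ps) (foldr (λ p s → legendre (+ 2) p * s) 1ℤ ps)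
  product-Sign8 [] _ = is+1 ≋-refl
  product-Sign8 {p ∷ ps} (p-prime ∷ primes) odd =
    subst (λ n → Sign8 n (foldr (λ p s → legendre (+ 2) p * s) 1ℤ (p ∷ ps))) (sym eq) (Sign8-* (legendre-2 p-prime (Odd-*ˡ (+ p) (+ product ps) odd′))
                                              (product-Sign8 primes (Odd-*ʳ (+ p) (+ product ps) odd′)))
    where
    eq : + (p ℕ.* product ps) ≡ + p * + product ps
    eq = pos-* p (product ps)
    odd′ : Odd (+ p * + product ps)
    odd′ = subst Odd eq odd

  Sign8-neg : ∀ {n ε} → Sign8 n ε → Sign8 (- n) ε
  Sign8-neg (is+1 p) = is-1 (-‿cong≋ p)
  Sign8-neg (is-1 p) = is+1 (-‿cong≋ p)
  Sign8-neg (is+3 p) = is-3 (-‿cong≋ p)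
  Sign8-neg (is-3 p) = is+3 (-‿cong≋ p)

  private
    jacobi-2-pos : ∀ n → Odd (+ suc n) → Sign8 (+ suc n) (jacobi (+ 2) (+ suc n))
    jacobi-2-pos n odd = subst (λ m → Sign8 (+ m) (jacobi (+ 2) (+ suc n))) (sym F.isFactorisation)
        (product-Sign8 F.factorsPrime (subst (λ m → Odd (+ m)) F.isFactorisation odd))
      where module F = PrimeFactorisation (factorise (suc n))

  -- The pairs of classes 1, -1 and 3, -3 are symmetric, so the symbol of a negative `h`, taken at
  -- its absolute value, has the right sign. This matters because `h` may be negative.
  jacobi-2 : ∀ h → Odd h → Sign8 h (jacobi (+ 2) h)
  jacobi-2 (+ zero)  odd = contradiction odd (Even⇒¬Odd ≋-refl)
  jacobi-2 (+ suc n) odd = jacobi-2-pos n odd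
  jacobi-2 -[1+ n ]  odd = Sign8-neg (jacobi-2-pos n (Odd-neg odd))

-- The characteristic equation: effect of shifts by powers of 5, and its solutions.

module Characteristic
  (s t n P : ℕ) (0<n : 0 ℕ.< n) (n+t≤P : n ℕ.+ t ℕ.≤ P) (P≤n+2t+s+2 : P ℕ.≤ n ℕ.+ t ℕ.+ (2 ℕ.+ (s ℕ.+ t)))
  (A A₁ B c₁ c₂ R′ : ℤ) (k k₁ : ℕ)
  (A≡ : A ≡ Congruence.2^ n ℤ.* A₁) (k≡ : k ≡ 2 ℕ.^ t ℕ.* k₁)
  (odd-A₁ : Congruence.Odd A₁) (odd-B : Congruence.Odd B) (odd-k₁ : Congruence.Odd (+ k₁)) (odd-c₂ : Congruence.Odd c₂)
  (R′-inverse : R (2 ℕ.+ (s ℕ.+ t) ℕ.+ n) ℤ.* R′ Congruence.≋ ℤ.1ℤ ⟨ Congruence.2^ (2 ℕ.+ (s ℕ.+ P)) ⟩)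
  where

  open import Data.Integer.Base hiding (suc; _≤_; _<_)
  open import Data.Integer.Properties
  open import Data.Integer.Tactic.RingSolver using (solve-∀)
  open import Data.Nat.Base using (suc)
  import Data.Nat.Properties as ℕ
  import Data.Nat.Tactic.RingSolver as ℕSolver
  open import Data.Product.Base using (∃; _,_; _×_; proj₁; proj₂)
  open import Relation.Binary.PropositionalEquality
  open Congruence
  open Powers

  -- The modulus of the characteristic equation is 2 ^ P with P = m - N + t; the sum is averaged over x ↦ x 5 ^ (2 ^ s v).
  N m : ℕ
  N = 2 ℕ.+ (s ℕ.+ t)
  m = 2 ℕ.+ (s ℕ.+ P)

  +k≡ : + k ≡ 2^ t * + k₁
  +k≡ = trans (cong +_ k≡) (trans (pos-* (2 ℕ.^ t) k₁) (cong (_* + k₁) (sym (2^≡ t))))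

  -- The hypothesis on `P` in the form in which it serves: the terms of `(1 + r * 2^ N) ^ j` beyond
  -- the first order contain `2^ (N + N)`, and multiplied by `A` they vanish modulo `2^ m`.
  m≤n+2N : m ℕ.≤ n ℕ.+ (N ℕ.+ N)
  m≤n+2N = ℕ.≤-trans (ℕ.+-monoʳ-≤ 2 (ℕ.+-monoʳ-≤ s P≤n+2t+s+2)) (ℕ.≤-reflexive (lemma s t n))
    where
    lemma : ∀ s t n → 2 ℕ.+ (s ℕ.+ (n ℕ.+ t ℕ.+ (2 ℕ.+ (s ℕ.+ t)))) ≡ n ℕ.+ (2 ℕ.+ (s ℕ.+ t) ℕ.+ (2 ℕ.+ (s ℕ.+ t)))
    lemma = ℕSolver.solve-∀

  even-A : Even A
  even-A = go n 0<n A≡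
    where
    go : ∀ n → 0 ℕ.< n → A ≡ 2^ n * A₁ → Even A
    go (suc n) _ eq = ≋-trans (≋-reflexive (trans eq (trans (cong (_* A₁) (2^-suc n)) (lemma (2^ n) A₁)))) (multiple≋0 (2^ n * A₁))
      where
      lemma : ∀ p a → + 2 * p * a ≡ p * a * + 2
      lemma = solve-∀

  odd-R′ : Odd R′
  odd-R′ = Odd-*ʳ (R (N ℕ.+ n)) R′ (mod2 R′-inverse)

  odd-R[N] : Odd (R N)
  odd-R[N] = R-odd (s ℕ.+ t)

  opaque
    f C : ℤ → ℤ
    f x = A * x ^ k + B
    C x = c₁ * f x + c₂ * A * + k * x ^ k * R N * R′

    f≡ : ∀ x → f x ≡ A * x ^ k + B
    f≡ x = refl

    C-def : ∀ x → C x ≡ c₁ * f x + c₂ * A * + k * x ^ k * R N * R′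
    C-def x = refl

  odd-f : ∀ x → Odd (f x)
  odd-f x = subst Odd (sym (f≡ x)) (+-cong≋ (*-congʳ≋ (x ^ k) even-A) odd-B)

  lower-square : ∀ {a c q} i → m ℕ.≤ i ℕ.+ i → a ≋ c ⟨ q * 2^ i * (q * 2^ i) ⟩ → a ≋ c ⟨ 2^ m ⟩
  lower-square {a} {c} {q} i m≤ p = lower m≤ (subst (λ z → a ≋ c ⟨ z ⟩) (sym (2^-+ i i))
      (modulus-∣ (q * q) (subst (λ z → a ≋ c ⟨ z ⟩) (lemma q (2^ i)) p)))
    where
    lemma : ∀ r p → r * p * (r * p) ≡ p * p * (r * r)
    lemma = solve-∀

  -- With D = 1 / f x, the terms of the sum at x y and at x, for y = 5 ^ (2 ^ s v), differ by the factor e(v D C(x) / 2 ^ P).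
  shift : ∀ x D v → f x * D ≋ 1ℤ ⟨ 2^ m ⟩ → ∃ λ w →
    f (x * 5^[2^ s * v ]) ≋ f x * (+ 5) ^ w ⟨ 2^ m ⟩ ×
    c₁ * + (2 ℕ.^ s ℕ.* v) + c₂ * + w ≋ 2^ s * (+ v * (D * C x)) ⟨ 2^ m ⟩
  shift x D v fD = w , shifted , exponent
    where
    y = 5^[2^ s * v ]
    -- Comparing first-order terms of `f (x * y)` and `f x * 5 ^ w` leads to
    -- `F * w′ * r′ ≋ A₁ * k₁ * X * r`; this is its solution, `D` and `R′` being the inverses of `F`
    -- and `r′`. As an exponent it is then reduced to a natural number.
    target = A₁ * + k₁ * x ^ k * R N * R′ * D
    w′ = _%ℕ_ target (2 ℕ.^ m) {{ℕ.m^n≢0 2 m}}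
    w′≋ : + w′ ≋ target ⟨ 2^ m ⟩
    w′≋ = ≋-sym (subst (λ q → target ≋ + w′ ⟨ q ⟩) (sym (2^≡ m)) (residue target (2 ℕ.^ m) {{ℕ.m^n≢0 2 m}}))
    w = 2 ℕ.^ (s ℕ.+ t ℕ.+ n) ℕ.* (v ℕ.* w′)
    F = f x
    X = x ^ k
    p = 2^ N
    r = R N
    r′ = R (N ℕ.+ n)

    y^k : y ^ k ≋ 1ℤ + + (k₁ ℕ.* v) * (r * p) ⟨ 2^ (N ℕ.+ N) ⟩
    y^k = ≋-trans (≋-reflexive (begin
      y ^ k ≡⟨ ^-*-assoc (+ 5) (2 ℕ.^ s ℕ.* v) k ⟩
      (+ 5) ^ (2 ℕ.^ s ℕ.* v ℕ.* k) ≡⟨ cong ((+ 5) ^_) expo ⟩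
      (+ 5) ^ (2 ℕ.^ (s ℕ.+ t) ℕ.* (k₁ ℕ.* v)) ≡⟨ ^-*-assoc (+ 5) (2 ℕ.^ (s ℕ.+ t)) (k₁ ℕ.* v) ⟨
      ((+ 5) ^ (2 ℕ.^ (s ℕ.+ t))) ^ (k₁ ℕ.* v) ≡⟨ cong (_^ (k₁ ℕ.* v)) (5^2^≡1+R (s ℕ.+ t)) ⟩
      (1ℤ + r * p) ^ (k₁ ℕ.* v) ∎))
      (subst (λ q → (1ℤ + r * p) ^ (k₁ ℕ.* v) ≋ 1ℤ + + (k₁ ℕ.* v) * (r * p) ⟨ q ⟩) (sym (2^-+ N N))
        (modulus-∣ (r * r) (subst (λ q → (1ℤ + r * p) ^ (k₁ ℕ.* v) ≋ 1ℤ + + (k₁ ℕ.* v) * (r * p) ⟨ q ⟩) (lemma r p)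
          (binomial₁ (r * p) (k₁ ℕ.* v)))))
      where
      open ≡-Reasoning
      lemma : ∀ r p → r * p * (r * p) ≡ p * p * (r * r)
      lemma = solve-∀
      expo : 2 ℕ.^ s ℕ.* v ℕ.* k ≡ 2 ℕ.^ (s ℕ.+ t) ℕ.* (k₁ ℕ.* v)
      expo = trans (cong (2 ℕ.^ s ℕ.* v ℕ.*_) k≡) (trans (lemma′ (2 ℕ.^ s) v (2 ℕ.^ t) k₁)
               (cong (ℕ._* (k₁ ℕ.* v)) (sym (ℕ.^-distribˡ-+-* 2 s t))))
        where
        lemma′ : ∀ a v b k → a ℕ.* v ℕ.* (b ℕ.* k) ≡ a ℕ.* b ℕ.* (k ℕ.* v)
        lemma′ = ℕSolver.solve-∀

    lhs : f (x * y) ≋ F + 2^ n * p * (A₁ * + k₁ * X * r) * + v ⟨ 2^ m ⟩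
    lhs = begin
      f (x * y) ≡⟨ f≡ (x * y) ⟩
      A * (x * y) ^ k + B ≡⟨ cong₂ (λ a z → a * z + B) A≡ (^-*-distrib x y k) ⟩
      2^ n * A₁ * (X * y ^ k) + B ≡⟨ lemma₁ (2^ n) A₁ X (y ^ k) B ⟩
      A₁ * X * (2^ n * y ^ k) + B ≈⟨ +-congʳ≋ B (*-congˡ≋ (A₁ * X) (lower m≤n+2N (scale-2^ n y^k))) ⟩
      A₁ * X * (2^ n * (1ℤ + + (k₁ ℕ.* v) * (r * p))) + B ≡⟨ cong (λ z → A₁ * X * (2^ n * (1ℤ + z * (r * p))) + B) (pos-* k₁ v) ⟩
      A₁ * X * (2^ n * (1ℤ + + k₁ * + v * (r * p))) + B ≡⟨ lemma₂ (2^ n) A₁ X (+ k₁) (+ v) r p B ⟩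
      2^ n * A₁ * X + B + 2^ n * p * (A₁ * + k₁ * X * r) * + v ≡⟨ cong (λ z → z + 2^ n * p * (A₁ * + k₁ * X * r) * + v) (trans (f≡ x) (cong (λ a → a * X + B) A≡)) ⟨
      F + 2^ n * p * (A₁ * + k₁ * X * r) * + v ∎
      where
      open ≋-Reasoning (2^ m)
      lemma₁ : ∀ q a x y b → q * a * (x * y) + b ≡ a * x * (q * y) + b
      lemma₁ = solve-∀
      lemma₂ : ∀ q a x k v r p b → a * x * (q * (1ℤ + k * v * (r * p))) + b ≡
        q * a * x + b + q * p * (a * k * x * r) * v
      lemma₂ = solve-∀

    5^w : (+ 5) ^ w ≋ 1ℤ + + v * + w′ * (r′ * (2^ n * p)) ⟨ 2^ m ⟩
    5^w = ≋-trans (≋-reflexive (begin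
      (+ 5) ^ w ≡⟨ ^-*-assoc (+ 5) (2 ℕ.^ (s ℕ.+ t ℕ.+ n)) (v ℕ.* w′) ⟨
      ((+ 5) ^ (2 ℕ.^ (s ℕ.+ t ℕ.+ n))) ^ (v ℕ.* w′) ≡⟨ cong (_^ (v ℕ.* w′)) (5^2^≡1+R (s ℕ.+ t ℕ.+ n)) ⟩
      (1ℤ + r′ * 2^ (N ℕ.+ n)) ^ (v ℕ.* w′) ∎))
      (≋-trans (lower-square {q = r′} (N ℕ.+ n) m≤ (binomial₁ (r′ * 2^ (N ℕ.+ n)) (v ℕ.* w′)))
        (≋-reflexive (cong₂ (λ z q → 1ℤ + z * (r′ * q)) (pos-* v w′) (trans (2^-+ N n) (*-comm p (2^ n))))))
      where
      open ≡-Reasoning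
      m≤ : m ℕ.≤ (N ℕ.+ n) ℕ.+ (N ℕ.+ n)
      m≤ = ℕ.≤-trans m≤n+2N (ℕ.≤-trans (ℕ.m≤m+n _ n) (ℕ.≤-reflexive (lemma′ n N)))
        where
        lemma′ : ∀ n N → n ℕ.+ (N ℕ.+ N) ℕ.+ n ≡ N ℕ.+ n ℕ.+ (N ℕ.+ n)
        lemma′ = ℕSolver.solve-∀

    match : F * (+ w′ * r′) ≋ A₁ * + k₁ * X * r ⟨ 2^ m ⟩
    match = begin
      F * (+ w′ * r′) ≈⟨ *-congˡ≋ F (*-congʳ≋ r′ w′≋) ⟩
      F * (A₁ * + k₁ * X * r * R′ * D * r′) ≡⟨ lemma F (A₁ * + k₁ * X * r) R′ D r′ ⟩
      A₁ * + k₁ * X * r * (F * D * (r′ * R′)) ≈⟨ *-congˡ≋ (A₁ * + k₁ * X * r) (*-cong≋ fD R′-inverse) ⟩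
      A₁ * + k₁ * X * r * (1ℤ * 1ℤ) ≡⟨ *-identityʳ (A₁ * + k₁ * X * r) ⟩
      A₁ * + k₁ * X * r ∎
      where
      open ≋-Reasoning (2^ m)
      lemma : ∀ f z r d q → f * (z * r * d * q) ≡ z * (f * d * (q * r))
      lemma = solve-∀

    shifted : f (x * y) ≋ F * (+ 5) ^ w ⟨ 2^ m ⟩
    shifted = begin
      f (x * y) ≈⟨ lhs ⟩
      F + 2^ n * p * (A₁ * + k₁ * X * r) * + v ≈⟨ +-congˡ≋ F (*-congʳ≋ (+ v) (*-congˡ≋ (2^ n * p) match)) ⟨
      F + 2^ n * p * (F * (+ w′ * r′)) * + v ≡⟨ lemma F (2^ n * p) (+ w′) r′ (+ v) ⟩
      F * (1ℤ + + v * + w′ * (r′ * (2^ n * p))) ≈⟨ *-congˡ≋ F 5^w ⟨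
      F * (+ 5) ^ w ∎
      where
      open ≋-Reasoning (2^ m)
      lemma : ∀ f q w r v → f + q * (f * (w * r)) * v ≡ f * (1ℤ + v * w * (r * q))
      lemma = solve-∀

    exponent : c₁ * + (2 ℕ.^ s ℕ.* v) + c₂ * + w ≋ 2^ s * (+ v * (D * C x)) ⟨ 2^ m ⟩
    exponent = begin
      c₁ * + (2 ℕ.^ s ℕ.* v) + c₂ * + w
        ≡⟨ cong₂ (λ a b → c₁ * a + c₂ * b) (pos-2^* s v) (trans (pos-2^* (s ℕ.+ t ℕ.+ n) (v ℕ.* w′))
             (cong₂ _*_ (trans (2^-+ (s ℕ.+ t) n) (cong (_* 2^ n) (2^-+ s t))) (pos-* v w′))) ⟩
      c₁ * (2^ s * + v) + c₂ * (2^ s * 2^ t * 2^ n * (+ v * + w′))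
        ≈⟨ +-cong≋ (≋-trans (≋-reflexive (sym (*-identityʳ (c₁ * (2^ s * + v))))) (*-congˡ≋ (c₁ * (2^ s * + v)) (≋-sym fD)))
                   (*-congˡ≋ c₂ (*-congˡ≋ (2^ s * 2^ t * 2^ n) (*-congˡ≋ (+ v) w′≋))) ⟩
      c₁ * (2^ s * + v) * (F * D) + c₂ * (2^ s * 2^ t * 2^ n * (+ v * (A₁ * + k₁ * X * r * R′ * D)))
        ≡⟨ lemma c₁ (2^ s) (+ v) F D c₂ (2^ t) (2^ n) A₁ (+ k₁) X r R′ ⟩
      2^ s * (+ v * (D * (c₁ * F + c₂ * (2^ n * A₁) * (2^ t * + k₁) * X * r * R′)))
        ≡⟨ cong (λ z → 2^ s * (+ v * (D * z))) (trans (C-def x) (cong₂ (λ a b → c₁ * F + c₂ * a * b * X * r * R′) A≡ +k≡)) ⟨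
      2^ s * (+ v * (D * C x)) ∎
      where
      open ≋-Reasoning (2^ m)
      lemma : ∀ c s v f d c′ t n a k x r r′ →
        c * (s * v) * (f * d) + c′ * (s * t * n * (v * (a * k * x * r * r′ * d))) ≡
        s * (v * (d * (c * f + c′ * (n * a) * (t * k) * x * r * r′)))
      lemma = solve-∀

  opaque
    -- The odd part of the coefficient `c₂ * A * k * R N * R′` of `x ^ k`; its even part is
    -- `2^ (n + t)`.
    unit : ℤ
    unit = c₂ * A₁ * + k₁ * R N * R′

    unit≡ : unit ≡ c₂ * A₁ * + k₁ * R N * R′
    unit≡ = refl

  odd-unit : Odd unit
  odd-unit = subst Odd (sym unit≡) (Odd-* (Odd-* (Odd-* (Odd-* odd-c₂ odd-A₁) odd-k₁) odd-R[N]) odd-R′)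

  C≡ : ∀ x → C x ≡ c₁ * f x + 2^ (n ℕ.+ t) * (unit * x ^ k)
  C≡ x = trans (C-def x) (trans (cong₂ (λ a b → c₁ * f x + c₂ * a * b * x ^ k * R N * R′) A≡ +k≡)
    (trans (lemma (c₁ * f x) c₂ (2^ n) A₁ (2^ t) (+ k₁) (x ^ k) (R N) R′)
      (cong₂ (λ q u → c₁ * f x + q * (u * x ^ k)) (sym (2^-+ n t)) (sym unit≡))))
    where
    lemma : ∀ z c n a t k x r r′ → z + c * (n * a) * (t * k) * x * r * r′ ≡
      z + n * t * (c * a * k * r * r′ * x)
    lemma = solve-∀

  Solves : ℤ → Set
  Solves x = C x ≋ 0ℤ ⟨ 2^ P ⟩

  -- Modulo `2^ (n + t)` only `c₁ * f x` is left of `C x`, and `f x` is odd. A single solution thus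
  -- forces the divisibility of `c₁`.
  solves⇒c₁ : ∀ {x} → Solves x → ∃ λ c₃ → c₁ ≡ 2^ (n ℕ.+ t) * c₃
  solves⇒c₁ {x} Cx≋0 = ≋0⇒multiple (odd-cancelˡ {c₁} {0ℤ} (f x) (odd-f x) zero′)
    where
    zero′ : f x * c₁ ≋ f x * 0ℤ ⟨ 2^ (n ℕ.+ t) ⟩
    zero′ = begin
      f x * c₁ ≡⟨ lemma (f x) c₁ (2^ (n ℕ.+ t)) (unit * x ^ k) ⟩
      c₁ * f x + 2^ (n ℕ.+ t) * (unit * x ^ k) + - (unit * x ^ k) * 2^ (n ℕ.+ t) ≡⟨ cong (_+ - (unit * x ^ k) * 2^ (n ℕ.+ t)) (C≡ x) ⟨
      C x + - (unit * x ^ k) * 2^ (n ℕ.+ t) ≈⟨ +-cong≋ {C x} {0ℤ} {2^ (n ℕ.+ t)} { - (unit * x ^ k) * 2^ (n ℕ.+ t)} {0ℤ} (lower n+t≤P Cx≋0) (multiple≋0 (- (unit * x ^ k))) ⟩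
      0ℤ ≡⟨ *-zeroʳ (f x) ⟨
      f x * 0ℤ ∎
      where
      open ≋-Reasoning (2^ (n ℕ.+ t))
      lemma : ∀ f c q z → f * c ≡ c * f + q * z + - z * q
      lemma = solve-∀

  module _ (c₃ : ℤ) (c₁≡ : c₁ ≡ 2^ (n ℕ.+ t) * c₃) where

    C-reduced : ∀ x → C x ≡ 2^ (n ℕ.+ t) * (c₃ * f x + unit * x ^ k)
    C-reduced x = trans (C≡ x) (trans (cong (λ c → c * f x + 2^ (n ℕ.+ t) * (unit * x ^ k)) c₁≡)
        (lemma (2^ (n ℕ.+ t)) c₃ (f x) (unit * x ^ k)))
      where
      lemma : ∀ q c f z → q * c * f + q * z ≡ q * (c * f + z)
      lemma = solve-∀

    -- One digit beyond `2^ (n + t)` is needed: it says that `c₃ * f x + unit * x ^ k` is even,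
    -- while its second term is odd.
    odd-c₃ : n ℕ.+ t ℕ.< P → ∀ {x} → Odd x → Solves x → Odd c₃
    odd-c₃ n+t<P {x} odd-x Cx≋0 = Odd-*ˡ c₃ (f x)
      (≋-trans (≋-reflexive (lemma (c₃ * f x) (unit * x ^ k)))
        (≋-trans (+-congʳ≋ {b = 0ℤ} (- (unit * x ^ k)) even-sum)
          (≋-trans (≋-reflexive (+-identityˡ (- (unit * x ^ k))))
            (Odd-neg (Odd-* odd-unit (Odd-^ k odd-x))))))
      where
      even-sum : c₃ * f x + unit * x ^ k ≋ 0ℤ ⟨ + 2 ⟩
      even-sum = mod2 (unscale-2^ {c₃ * f x + unit * x ^ k} {0ℤ} (n ℕ.+ t) {1} (≋-trans (≋-reflexive (sym (C-reduced x)))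
        (≋-trans (lower (ℕ.≤-trans (ℕ.≤-reflexive (ℕ.+-comm (n ℕ.+ t) 1)) n+t<P) Cx≋0)
          (≋-reflexive (sym (*-zeroʳ (2^ (n ℕ.+ t))))))))
      lemma : ∀ a b → a ≡ a + b + - b
      lemma = solve-∀

    opaque
      -- `C` is an affine function of `x ^ k` with leading coefficient `2^ (n + t) * slope * A₁`. As
      -- `n > 0`, `slope` is odd, so solving the equation amounts to prescribing `x ^ k` modulo
      -- `2^ L`.
      slope : ℤ
      slope = 2^ n * c₃ + c₂ * + k₁ * R N * R′

      slope≡ : slope ≡ 2^ n * c₃ + c₂ * + k₁ * R N * R′
      slope≡ = refl

    odd-slope : Odd slope
    odd-slope = subst Odd (sym slope≡) (+-cong≋ (*-congʳ≋ c₃ (even-2^ n 0<n))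
        (Odd-* (Odd-* (Odd-* odd-c₂ odd-k₁) odd-R[N]) odd-R′))
      where
      even-2^ : ∀ n → 0 ℕ.< n → Even (2^ n)
      even-2^ (suc n) _ = ≋-trans (≋-reflexive (trans (2^-suc n) (*-comm (+ 2) (2^ n)))) (multiple≋0 (2^ n))

    C-difference : ∀ x y → C x ≡ C y + 2^ (n ℕ.+ t) * (slope * A₁ * (x ^ k - y ^ k))
    C-difference x y = begin
      C x ≡⟨ expand x ⟩
      q * (c₃ * (2^ n * A₁ * x ^ k + B) + c₂ * A₁ * + k₁ * R N * R′ * x ^ k)
        ≡⟨ lemma q c₃ (2^ n) A₁ B c₂ (+ k₁) (R N) R′ (x ^ k) (y ^ k) ⟩
      q * (c₃ * (2^ n * A₁ * y ^ k + B) + c₂ * A₁ * + k₁ * R N * R′ * y ^ k)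
        + q * ((2^ n * c₃ + c₂ * + k₁ * R N * R′) * A₁ * (x ^ k - y ^ k))
        ≡⟨ cong₂ (λ z σ → z + q * (σ * A₁ * (x ^ k - y ^ k))) (expand y) slope≡ ⟨
      C y + q * (slope * A₁ * (x ^ k - y ^ k)) ∎
      where
      open ≡-Reasoning
      q = 2^ (n ℕ.+ t)
      expand : ∀ x → C x ≡ q * (c₃ * (2^ n * A₁ * x ^ k + B) + c₂ * A₁ * + k₁ * R N * R′ * x ^ k)
      expand x = trans (C-reduced x) (cong₂ (λ w u → q * (c₃ * w + u * x ^ k))
        (trans (f≡ x) (cong (λ a → a * x ^ k + B) A≡)) unit≡)
      lemma : ∀ q c n a b c′ k r r′ x y →
        q * (c * (n * a * x + b) + c′ * a * k * r * r′ * x) ≡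
        q * (c * (n * a * y + b) + c′ * a * k * r * r′ * y) + q * ((n * c + c′ * k * r * r′) * a * (x - y))
      lemma = solve-∀

    module _ (L : ℕ) (P≡ : P ≡ n ℕ.+ t ℕ.+ L) where

      solves-by-power : ∀ x y → x ^ k ≋ y ^ k ⟨ 2^ L ⟩ → Solves y → Solves x
      solves-by-power x y p Cy≋0 = ≋-trans (≋-reflexive (C-difference x y)) (+-cong≋ Cy≋0
        (recast (sym P≡) (≋-trans (scale-2^ {slope * A₁ * (x ^ k - y ^ k)} {0ℤ} (n ℕ.+ t) {L} (begin
          slope * A₁ * (x ^ k - y ^ k) ≈⟨ *-congˡ≋ (slope * A₁) (+-congʳ≋ (- y ^ k) p) ⟩
          slope * A₁ * (y ^ k - y ^ k) ≡⟨ cong (slope * A₁ *_) (+-inverseʳ (y ^ k)) ⟩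
          slope * A₁ * 0ℤ ≡⟨ *-zeroʳ (slope * A₁) ⟩
          0ℤ ∎)) (≋-reflexive (*-zeroʳ (2^ (n ℕ.+ t)))))))
        where open ≋-Reasoning (2^ L)

      equal-powers : ∀ x y → Solves x → Solves y → x ^ k ≋ y ^ k ⟨ 2^ L ⟩
      equal-powers x y Cx≋0 Cy≋0 = subst (λ z → z ≋ y ^ k ⟨ 2^ L ⟩) (lemma (x ^ k) (y ^ k))
        (≋-trans (+-congˡ≋ (y ^ k) (odd-cancelˡ {x ^ k - y ^ k} {0ℤ} (slope * A₁) (Odd-* odd-slope odd-A₁) (unscale-2^ {slope * A₁ * (x ^ k - y ^ k)} {slope * A₁ * 0ℤ} (n ℕ.+ t) {L} (recast P≡ diff))))
          (≋-reflexive (+-identityʳ (y ^ k))))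
        where
        open ≋-Reasoning (2^ P)
        q = 2^ (n ℕ.+ t)
        lemma : ∀ a b → b + (a - b) ≡ a
        lemma = solve-∀
        lemma′ : ∀ a b → b ≡ a + b + - a
        lemma′ = solve-∀
        diff : q * (slope * A₁ * (x ^ k - y ^ k)) ≋ q * (slope * A₁ * 0ℤ) ⟨ 2^ P ⟩
        diff = begin
          q * (slope * A₁ * (x ^ k - y ^ k)) ≡⟨ lemma′ (C y) _ ⟩
          C y + q * (slope * A₁ * (x ^ k - y ^ k)) + - C y ≡⟨ cong (_+ - C y) (C-difference x y) ⟨
          C x + - C y ≈⟨ +-cong≋ Cx≋0 (-‿cong≋ Cy≋0) ⟩
          0ℤ ≡⟨ *-zeroʳ q ⟨
          q * 0ℤ ≡⟨ cong (q *_) (*-zeroʳ (slope * A₁)) ⟨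
          q * (slope * A₁ * 0ℤ) ∎

  -- The k-th power gains `t` digits, so `x ^ k` is known modulo `2^ (2 + s + t)`, and the bound on
  -- `P` says that this covers `2^ L`.
  solves-periodic : ∀ {x y} → x ≋ y ⟨ 2^ (2 ℕ.+ s) ⟩ → Solves y → Solves x
  solves-periodic {x} {y} x≋y Cy≋0 = go (solves⇒c₁ Cy≋0)
    where
    L = P ℕ.∸ (n ℕ.+ t)
    L≤ : L ℕ.≤ 2 ℕ.+ s ℕ.+ t
    L≤ = ℕ.≤-trans (ℕ.∸-monoˡ-≤ (n ℕ.+ t) P≤n+2t+s+2)
           (ℕ.≤-reflexive (ℕ.m+n∸m≡n (n ℕ.+ t) (2 ℕ.+ (s ℕ.+ t))))
    powers : x ^ k ≋ y ^ k ⟨ 2^ (2 ℕ.+ s ℕ.+ t) ⟩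
    powers = subst (λ j → x ^ j ≋ y ^ j ⟨ 2^ (2 ℕ.+ s ℕ.+ t) ⟩) (sym k≡) (^-lift t k₁ (suc s) x≋y)
    go : (∃ λ c₃ → c₁ ≡ 2^ (n ℕ.+ t) * c₃) → Solves x
    go (c₃ , c₁≡) = solves-by-power c₃ c₁≡ L (sym (ℕ.m+[n∸m]≡n n+t≤P)) x y (lower L≤ powers) Cy≋0

  -- For odd m - n the two solutions modulo 2 ^ (s + 2) differ by the factor 5 ^ 2 ^ (s - 1), a shift that is linear only
  -- up to a term of order 2 ^ (m - 1): it contributes k₁ - 1 to h, and R_N / R_{N-1}, R_{N+n} / R_{N+n-1} contribute (2 ^ n - 1) c₃.
  module HalfStep (s′ : ℕ) (s≡ : s ≡ suc s′) (P≡ : P ≡ n ℕ.+ t ℕ.+ (2 ℕ.+ (s′ ℕ.+ t)))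
    (b : ℕ) (k₁≡ : k₁ ≡ suc (2 ℕ.* b)) (c₃ : ℤ) (c₁≡ : c₁ ≡ 2^ (n ℕ.+ t) * c₃)
    (x D l : ℤ) (odd-x : Odd x) (fD : f x * D ≋ 1ℤ ⟨ 2^ m ⟩) (Cx≡ : C x ≡ l * 2^ P) where

    private
      i j g : ℕ
      i = s′ ℕ.+ t
      j = suc i
      g = i ℕ.+ n

      F = f x
      X = x ^ k
      y = (+ 5) ^ (2 ℕ.^ s′)
      -- Here `2 + i = N - 1` and `2 + g = N + n - 1`: half the exponent of 5 lowers both indices of
      -- `R` by one.
      r = R (2 ℕ.+ i)
      r′ = R (2 ℕ.+ g)

      N≡ : N ≡ 2 ℕ.+ j
      N≡ = cong (λ s → 2 ℕ.+ (s ℕ.+ t)) s≡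

      m≡ : m ≡ 4 ℕ.+ (g ℕ.+ j)
      m≡ = trans (cong₂ (λ s P → 2 ℕ.+ (s ℕ.+ P)) s≡ P≡) (lemma s′ t n)
        where
        lemma : ∀ s t n → 2 ℕ.+ (suc s ℕ.+ (n ℕ.+ t ℕ.+ (2 ℕ.+ (s ℕ.+ t)))) ≡ 4 ℕ.+ (s ℕ.+ t ℕ.+ n ℕ.+ suc (s ℕ.+ t))
        lemma = ℕSolver.solve-∀

      R[N] : R N ≡ r + r * r * 2^ j
      R[N] = trans (cong R N≡) (R-suc i)

      R[N+n] : R (N ℕ.+ n) ≡ r′ + r′ * r′ * 2^ (suc g)
      R[N+n] = trans (cong (λ N → R (N ℕ.+ n)) N≡) (R-suc g)

      R[N]≋-1 : R N ≋ -1ℤ ⟨ + 4 ⟩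
      R[N]≋-1 = ≋-trans (≋-reflexive (cong R N≡)) (R≋-1[4] i)

      r″ : ℤ
      r″ = proj₁ (odd-inverse m (R-odd g))

      r″-inverse : r′ * r″ ≋ 1ℤ ⟨ 2^ m ⟩
      r″-inverse = proj₂ (odd-inverse m (R-odd g))

      target : ℤ
      target = A₁ * + k₁ * X * r * r″ * D

      w₀ w₁ w : ℕ
      w₀ = _%ℕ_ target (2 ℕ.^ m) {{ℕ.m^n≢0 2 m}}
      w₁ = 2 ℕ.^ g ℕ.* w₀
      -- The second summand contributes the factor `1 + H * b`, which matches the quadratic term of
      -- `y ^ k`.
      w  = w₁ ℕ.+ 2 ℕ.^ suc (g ℕ.+ j) ℕ.* b

      w₀≋ : + w₀ ≋ target ⟨ 2^ m ⟩
      w₀≋ = ≋-sym (subst (λ q → target ≋ + w₀ ⟨ q ⟩) (sym (2^≡ m)) (residue target (2 ℕ.^ m) {{ℕ.m^n≢0 2 m}}))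

      odd-D : Odd D
      odd-D = Odd-*ʳ F D (mod2 fD)

      +k₁≡ : + k₁ ≡ 1ℤ + + 2 * + b
      +k₁≡ = trans (cong +_ k₁≡) (cong (λ z → 1ℤ + z) (pos-* 2 b))

      -- This is `2^ (m - 1)`, so that only the parity of its cofactor counts.
      H : ℤ
      H = 2^ (3 ℕ.+ (g ℕ.+ j))

      H-parity : ∀ {a c} → a ≋ c ⟨ + 2 ⟩ → H * a ≋ H * c ⟨ 2^ m ⟩
      H-parity p = recast (trans (lemma (g ℕ.+ j)) (sym m≡)) (scale-2^ (3 ℕ.+ (g ℕ.+ j)) (mod2^1 p))
        where
        lemma : ∀ a → 3 ℕ.+ a ℕ.+ 1 ≡ 4 ℕ.+ a
        lemma = ℕSolver.solve-∀

      -- First order no longer suffices, as `n + 2 (N - 1) = m - 1` misses the modulus by one digit;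
      -- the cubic term does vanish.
      y^k : y ^ k ≋ 1ℤ + + k₁ * (r * 2^ (2 ℕ.+ i)) + triangular k₁ * (r * 2^ (2 ℕ.+ i) * (r * 2^ (2 ℕ.+ i)))
        ⟨ 2^ (3 ℕ.* (2 ℕ.+ i)) ⟩
      y^k = ≋-trans (≋-reflexive (begin
        y ^ k ≡⟨ ^-*-assoc (+ 5) (2 ℕ.^ s′) k ⟩
        (+ 5) ^ (2 ℕ.^ s′ ℕ.* k) ≡⟨ cong ((+ 5) ^_) expo ⟩
        (+ 5) ^ (2 ℕ.^ i ℕ.* k₁) ≡⟨ ^-*-assoc (+ 5) (2 ℕ.^ i) k₁ ⟨
        ((+ 5) ^ (2 ℕ.^ i)) ^ k₁ ≡⟨ cong (_^ k₁) (5^2^≡1+R i) ⟩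
        (1ℤ + a) ^ k₁ ∎))
        (subst (λ q → (1ℤ + a) ^ k₁ ≋ 1ℤ + + k₁ * a + triangular k₁ * (a * a) ⟨ q ⟩) (sym cube) (modulus-∣ (r * r * r)
          (subst (λ q → (1ℤ + a) ^ k₁ ≋ 1ℤ + + k₁ * a + triangular k₁ * (a * a) ⟨ q ⟩) (lemma r p) (binomial₂ a k₁))))
        where
        open ≡-Reasoning
        p = 2^ (2 ℕ.+ i)
        a = r * p
        lemma : ∀ r p → r * p * (r * p) * (r * p) ≡ p * p * p * (r * r * r)
        lemma = solve-∀
        cube : 2^ (3 ℕ.* (2 ℕ.+ i)) ≡ p * p * p
        cube = trans (2^-+ (2 ℕ.+ i) (2 ℕ.+ i ℕ.+ (2 ℕ.+ i ℕ.+ 0))) (trans (cong (p *_)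
          (trans (2^-+ (2 ℕ.+ i) (2 ℕ.+ i ℕ.+ 0)) (cong (λ z → p * 2^ z) (ℕ.+-identityʳ (2 ℕ.+ i))))) (sym (*-assoc p p p)))
        expo : 2 ℕ.^ s′ ℕ.* k ≡ 2 ℕ.^ i ℕ.* k₁
        expo = trans (cong (2 ℕ.^ s′ ℕ.*_) k≡) (trans (sym (ℕ.*-assoc (2 ℕ.^ s′) (2 ℕ.^ t) k₁))
               (cong (ℕ._* k₁) (sym (ℕ.^-distribˡ-+-* 2 s′ t))))

      2^n*p : 2^ n * 2^ (2 ℕ.+ i) ≡ 2^ (2 ℕ.+ g)
      2^n*p = trans (sym (2^-+ n (2 ℕ.+ i))) (cong 2^_ (trans (ℕ.+-comm n (2 ℕ.+ i)) refl))

      2^n*p*p : 2^ n * (2^ (2 ℕ.+ i) * 2^ (2 ℕ.+ i)) ≡ H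
      2^n*p*p = trans (cong (2^ n *_) (sym (2^-+ (2 ℕ.+ i) (2 ℕ.+ i)))) (trans (sym (2^-+ n (2 ℕ.+ i ℕ.+ (2 ℕ.+ i)))) (cong 2^_ (lemma n i)))
        where
        lemma : ∀ n i → n ℕ.+ (2 ℕ.+ i ℕ.+ (2 ℕ.+ i)) ≡ 3 ℕ.+ (i ℕ.+ n ℕ.+ suc i)
        lemma = ℕSolver.solve-∀

      lhs : f (x * y) ≋ F + A₁ * + k₁ * X * r * 2^ (2 ℕ.+ g) + H * + b ⟨ 2^ m ⟩
      lhs = begin
        f (x * y) ≡⟨ f≡ (x * y) ⟩
        A * (x * y) ^ k + B ≡⟨ cong₂ (λ a z → a * z + B) A≡ (^-*-distrib x y k) ⟩
        2^ n * A₁ * (X * y ^ k) + B ≡⟨ lemma₁ (2^ n) A₁ X (y ^ k) B ⟩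
        A₁ * X * (2^ n * y ^ k) + B ≈⟨ +-congʳ≋ B (*-congˡ≋ (A₁ * X) (lower m≤ (scale-2^ n y^k))) ⟩
        A₁ * X * (2^ n * (1ℤ + + k₁ * (r * p) + triangular k₁ * (r * p * (r * p)))) + B
          ≡⟨ lemma₂ (2^ n) A₁ X (+ k₁) (triangular k₁) r p B ⟩
        2^ n * A₁ * X + B + A₁ * + k₁ * X * r * (2^ n * p) + 2^ n * (p * p) * (A₁ * X * r * r * triangular k₁)
          ≡⟨ cong₂ (λ u v → 2^ n * A₁ * X + B + A₁ * + k₁ * X * r * u + v * (A₁ * X * r * r * triangular k₁)) 2^n*p 2^n*p*p ⟩
        2^ n * A₁ * X + B + A₁ * + k₁ * X * r * 2^ (2 ℕ.+ g) + H * (A₁ * X * r * r * triangular k₁)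
          ≡⟨ cong (λ z → z + A₁ * + k₁ * X * r * 2^ (2 ℕ.+ g) + H * (A₁ * X * r * r * triangular k₁)) (trans (f≡ x) (cong (λ a → a * X + B) A≡)) ⟨
        F + A₁ * + k₁ * X * r * 2^ (2 ℕ.+ g) + H * (A₁ * X * r * r * triangular k₁)
          ≈⟨ +-congˡ≋ (F + A₁ * + k₁ * X * r * 2^ (2 ℕ.+ g)) (H-parity twist) ⟩
        F + A₁ * + k₁ * X * r * 2^ (2 ℕ.+ g) + H * + b ∎
        where
        open ≋-Reasoning (2^ m)
        p = 2^ (2 ℕ.+ i)
        m≤ : m ℕ.≤ n ℕ.+ 3 ℕ.* (2 ℕ.+ i)
        m≤ = ℕ.≤-trans (ℕ.≤-reflexive m≡) (ℕ.≤-trans (ℕ.m≤m+n _ (suc i)) (ℕ.≤-reflexive (lemma n i)))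
          where
          lemma : ∀ n i → 4 ℕ.+ (i ℕ.+ n ℕ.+ suc i) ℕ.+ suc i ≡ n ℕ.+ 3 ℕ.* (2 ℕ.+ i)
          lemma = ℕSolver.solve-∀
        lemma₁ : ∀ q a x y b → q * a * (x * y) + b ≡ a * x * (q * y) + b
        lemma₁ = solve-∀
        lemma₂ : ∀ q a x k t r p b → a * x * (q * (1ℤ + k * (r * p) + t * (r * p * (r * p)))) + b ≡
          q * a * x + b + a * k * x * r * (q * p) + q * (p * p) * (a * x * r * r * t)
        lemma₂ = solve-∀
        twist : A₁ * X * r * r * triangular k₁ ≋ + b ⟨ + 2 ⟩
        twist = ≋-trans (*-cong≋ (Odd-* (Odd-* (Odd-* odd-A₁ (Odd-^ k odd-x)) (R-odd i)) (R-odd i))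
            (≋-trans (≋-reflexive (cong triangular k₁≡)) (triangular-odd b)))
          (≋-reflexive (*-identityˡ (+ b)))

      5^w₁ : (+ 5) ^ w₁ ≋ 1ℤ + + w₀ * (r′ * 2^ (2 ℕ.+ g)) ⟨ 2^ m ⟩
      5^w₁ = ≋-trans (≋-reflexive (trans (sym (^-*-assoc (+ 5) (2 ℕ.^ g) w₀)) (cong (_^ w₀) (5^2^≡1+R g))))
          (lower-square {q = r′} (2 ℕ.+ g) m≤ (binomial₁ (r′ * 2^ (2 ℕ.+ g)) w₀))
        where
        m≤ : m ℕ.≤ 2 ℕ.+ g ℕ.+ (2 ℕ.+ g)
        m≤ = ℕ.≤-trans (ℕ.≤-reflexive (trans m≡ (lemma g i)))
               (ℕ.+-monoʳ-≤ (2 ℕ.+ g) (ℕ.+-monoʳ-≤ 2 (ℕ.≤-trans (ℕ.+-monoʳ-≤ i 0<n) (ℕ.≤-reflexive refl))))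
          where
          lemma : ∀ g i → 4 ℕ.+ (g ℕ.+ suc i) ≡ 2 ℕ.+ g ℕ.+ (2 ℕ.+ (i ℕ.+ 1))
          lemma = ℕSolver.solve-∀

      5^w₂ : (+ 5) ^ (2 ℕ.^ suc (g ℕ.+ j) ℕ.* b) ≋ 1ℤ + H * + b ⟨ 2^ m ⟩
      5^w₂ = ≋-trans (≋-reflexive (trans (sym (^-*-assoc (+ 5) (2 ℕ.^ suc (g ℕ.+ j)) b)) (cong (_^ b) (5^2^≡1+R (suc (g ℕ.+ j))))))
          (≋-trans (lower-square {q = ρ} (3 ℕ.+ (g ℕ.+ j)) m≤ (binomial₁ (ρ * H) b))
            (≋-trans (≋-reflexive (cong (λ z → 1ℤ + z) (lemma (+ b) ρ H)))
              (+-congˡ≋ 1ℤ (H-parity (≋-trans (*-congʳ≋ (+ b) (R-odd (suc (g ℕ.+ j)))) (≋-reflexive (*-identityˡ (+ b))))))))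
        where
        ρ = R (3 ℕ.+ (g ℕ.+ j))
        lemma : ∀ b ρ H → b * (ρ * H) ≡ H * (ρ * b)
        lemma = solve-∀
        m≤ : m ℕ.≤ 3 ℕ.+ (g ℕ.+ j) ℕ.+ (3 ℕ.+ (g ℕ.+ j))
        m≤ = ℕ.≤-trans (ℕ.≤-reflexive m≡) (ℕ.≤-trans (ℕ.m≤m+n _ (2 ℕ.+ (g ℕ.+ j))) (ℕ.≤-reflexive (lemma′ (g ℕ.+ j))))
          where
          lemma′ : ∀ a → 4 ℕ.+ a ℕ.+ (2 ℕ.+ a) ≡ 3 ℕ.+ a ℕ.+ (3 ℕ.+ a)
          lemma′ = ℕSolver.solve-∀

      match : F * (+ w₀ * r′) ≋ A₁ * + k₁ * X * r ⟨ 2^ m ⟩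
      match = begin
        F * (+ w₀ * r′) ≈⟨ *-congˡ≋ F (*-congʳ≋ r′ w₀≋) ⟩
        F * (A₁ * + k₁ * X * r * r″ * D * r′) ≡⟨ lemma F (A₁ * + k₁ * X * r) r″ D r′ ⟩
        A₁ * + k₁ * X * r * (F * D * (r′ * r″)) ≈⟨ *-congˡ≋ (A₁ * + k₁ * X * r) (*-cong≋ fD r″-inverse) ⟩
        A₁ * + k₁ * X * r * (1ℤ * 1ℤ) ≡⟨ *-identityʳ (A₁ * + k₁ * X * r) ⟩
        A₁ * + k₁ * X * r ∎
        where
        open ≋-Reasoning (2^ m)
        lemma : ∀ f z r d q → f * (z * r * d * q) ≡ z * (f * d * (q * r))
        lemma = solve-∀

      rhs : F * (+ 5) ^ w ≋ F + A₁ * + k₁ * X * r * 2^ (2 ℕ.+ g) + H * + b ⟨ 2^ m ⟩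
      rhs = begin
        F * (+ 5) ^ w ≡⟨ cong (F *_) (^-distribˡ-+-* (+ 5) w₁ (2 ℕ.^ suc (g ℕ.+ j) ℕ.* b)) ⟩
        F * ((+ 5) ^ w₁ * (+ 5) ^ (2 ℕ.^ suc (g ℕ.+ j) ℕ.* b)) ≈⟨ *-congˡ≋ F (*-cong≋ 5^w₁ 5^w₂) ⟩
        F * ((1ℤ + + w₀ * (r′ * q)) * (1ℤ + H * + b)) ≡⟨ lemma F (+ w₀) r′ q H (+ b) ⟩
        F + F * (+ w₀ * r′) * q + H * (F * + b * (1ℤ + + w₀ * r′ * q))
          ≈⟨ +-cong≋ (+-congˡ≋ F (*-congʳ≋ q match)) (H-parity parity-F) ⟩
        F + A₁ * + k₁ * X * r * q + H * + b ∎
        where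
        open ≋-Reasoning (2^ m)
        q = 2^ (2 ℕ.+ g)
        lemma : ∀ f w r q h b → f * ((1ℤ + w * (r * q)) * (1ℤ + h * b)) ≡
          f + f * (w * r) * q + h * (f * b * (1ℤ + w * r * q))
        lemma = solve-∀
        odd-factor : 1ℤ + + w₀ * r′ * q ≋ 1ℤ ⟨ + 2 ⟩
        odd-factor = ≋-trans (≋-reflexive (cong (λ z → 1ℤ + + w₀ * r′ * z) (2^-suc (suc g)))) (by (+ w₀ * r′ * 2^ (suc g)) (lemma′ (+ w₀ * r′) (2^ (suc g))))
          where
          lemma′ : ∀ a p → 1ℤ + a * (+ 2 * p) ≡ 1ℤ + a * p * + 2
          lemma′ = solve-∀
        parity-F : F * + b * (1ℤ + + w₀ * r′ * q) ≋ + b ⟨ + 2 ⟩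
        parity-F = ≋-trans (*-cong≋ (*-congʳ≋ (+ b) (odd-f x)) odd-factor)
          (≋-reflexive (trans (*-identityʳ (1ℤ * + b)) (*-identityˡ (+ b))))

      2+j≤m : 2 ℕ.+ j ℕ.≤ m
      2+j≤m = ℕ.≤-trans (ℕ.m≤n+m (2 ℕ.+ j) (2 ℕ.+ g)) (ℕ.≤-reflexive (trans (lemma g j) (sym m≡)))
        where
        lemma : ∀ g j → 2 ℕ.+ g ℕ.+ (2 ℕ.+ j) ≡ 4 ℕ.+ (g ℕ.+ j)
        lemma = ℕSolver.solve-∀

      W : ℤ
      W = A₁ * + k₁ * X * D

      -- The equality `C x ≡ l * 2^ P`, divided by `2^ (n + t)` and by the unit `f x`. The odd
      -- factor `D` that should accompany `l` disappears, as only one digit of `l` is visible.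
      c₃-equation : c₃ + c₂ * W * (R N * R′) ≋ 2^ (suc j) * l ⟨ 2^ (2 ℕ.+ j) ⟩
      c₃-equation = begin
        c₃ + c₂ * W * (R N * R′) ≡⟨ cong (_+ c₂ * W * (R N * R′)) (*-identityʳ c₃) ⟨
        c₃ * 1ℤ + c₂ * W * (R N * R′) ≈⟨ +-congʳ≋ (c₂ * W * (R N * R′)) (*-congˡ≋ c₃ (lower 2+j≤m fD)) ⟨
        c₃ * (F * D) + c₂ * W * (R N * R′) ≡⟨ lemma c₃ F D c₂ A₁ (+ k₁) X (R N) R′ ⟩
        D * (c₃ * F + c₂ * A₁ * + k₁ * R N * R′ * X) ≡⟨ cong (λ z → D * z) divided ⟩
        D * (2^ (suc j) * l) ≡⟨ lemma₂ D (2^ (suc j)) l ⟩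
        2^ (suc j) * (D * l) ≈⟨ recast (lemma₃ j) (scale-2^ (suc j) (mod2^1 (≋-trans (*-congʳ≋ l odd-D) (≋-reflexive (*-identityˡ l))))) ⟩
        2^ (suc j) * l ∎
        where
        open ≋-Reasoning (2^ (2 ℕ.+ j))
        lemma : ∀ c f d c′ a k x r r′ → c * (f * d) + c′ * (a * k * x * d) * (r * r′) ≡ d * (c * f + c′ * a * k * r * r′ * x)
        lemma = solve-∀
        lemma₂ : ∀ d q l → d * (q * l) ≡ q * (d * l)
        lemma₂ = solve-∀
        lemma₃ : ∀ j → suc j ℕ.+ 1 ≡ 2 ℕ.+ j
        lemma₃ = ℕSolver.solve-∀
        divided : c₃ * F + c₂ * A₁ * + k₁ * R N * R′ * X ≡ 2^ (suc j) * l
        divided = *-cancelˡ-≡ (2^ (n ℕ.+ t)) _ _ {{2^-nonZero (n ℕ.+ t)}} (trans (cong (λ u → 2^ (n ℕ.+ t) * (c₃ * F + u * X)) (sym unit≡))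
          (trans (sym (C-reduced c₃ c₁≡ x)) (trans Cx≡ (trans (*-comm l (2^ P)) (trans (cong (_* l) (trans (cong 2^_ P≡) (2^-+ (n ℕ.+ t) (suc j))))
            (*-assoc (2^ (n ℕ.+ t)) (2^ (suc j)) l))))))

      c₃-mod4 : c₃ ≋ - (c₂ * W * (R N * R′)) ⟨ + 4 ⟩
      c₃-mod4 = begin
        c₃ ≡⟨ lemma c₃ (c₂ * W * (R N * R′)) ⟩
        c₃ + c₂ * W * (R N * R′) + - (c₂ * W * (R N * R′)) ≈⟨ +-congʳ≋ (- (c₂ * W * (R N * R′))) (mod4 c₃-equation) ⟩
        2^ (suc j) * l + - (c₂ * W * (R N * R′)) ≡⟨ cong (λ z → z * l + - (c₂ * W * (R N * R′))) (2^-suc-suc i) ⟩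
        + 4 * 2^ i * l + - (c₂ * W * (R N * R′)) ≈⟨ by (2^ i * l) (lemma₂ (2^ i) l (- (c₂ * W * (R N * R′)))) ⟩
        - (c₂ * W * (R N * R′)) ∎
        where
        open ≋-Reasoning (+ 4)
        lemma : ∀ a b → a ≡ a + b + - b
        lemma = solve-∀
        lemma₂ : ∀ p l z → + 4 * p * l + z ≡ z + p * l * + 4
        lemma₂ = solve-∀

      mod4-identity : c₂ * W * r * r′ * (2^ n * r′ - r) ≋ r′ * R (N ℕ.+ n) * ((2^ n - 1ℤ) * c₃) ⟨ + 4 ⟩
      mod4-identity = ≋-sym (begin
        r′ * r₁ * ((2^ n - 1ℤ) * c₃) ≈⟨ *-congˡ≋ (r′ * r₁) (*-congˡ≋ (2^ n - 1ℤ) c₃-mod4) ⟩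
        r′ * r₁ * ((2^ n - 1ℤ) * - (c₂ * W * (R N * R′))) ≡⟨ lemma₁ r′ r₁ (2^ n) (c₂ * W) (R N) R′ ⟩
        - (r′ * (2^ n - 1ℤ) * (c₂ * W)) * (r₁ * R′) * R N
          ≈⟨ *-cong≋ (*-congˡ≋ (- (r′ * (2^ n - 1ℤ) * (c₂ * W))) (mod4 R′-inverse)) R[N]≋-1 ⟩
        - (r′ * (2^ n - 1ℤ) * (c₂ * W)) * 1ℤ * -1ℤ ≡⟨ lemma₂ r′ (2^ n) (c₂ * W) ⟩
        c₂ * W * r′ * (2^ n - 1ℤ) ≈⟨ *-congˡ≋ (c₂ * W * r′) (+-cong≋ small (-‿cong≋ (odd-square≋1[4] (R-odd i)))) ⟨
        c₂ * W * r′ * (2^ n * (r * r′) - r * r) ≡⟨ lemma₃ (c₂ * W) r r′ (2^ n) ⟩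
        c₂ * W * r * r′ * (2^ n * r′ - r) ∎)
        where
        open ≋-Reasoning (+ 4)
        r₁ = R (N ℕ.+ n)
        small : 2^ n * (r * r′) ≋ 2^ n ⟨ + 4 ⟩
        small = go n 0<n
          where
          go : ∀ n → 0 ℕ.< n → 2^ n * (r * r′) ≋ 2^ n ⟨ + 4 ⟩
          go (suc n′) _ = ≋-trans (mod4 {j = n′} (recast (lemma n′) (scale-2^ (suc n′) (mod2^1 (Odd-* (R-odd i) (R-odd g))))))
            (≋-reflexive (*-identityʳ (2^ (suc n′))))
            where
            lemma : ∀ n → suc n ℕ.+ 1 ≡ 2 ℕ.+ n
            lemma = ℕSolver.solve-∀
        lemma₁ : ∀ a b q w r r′ → a * b * ((q - 1ℤ) * - (w * (r * r′))) ≡ - (a * (q - 1ℤ) * w) * (b * r′) * r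
        lemma₁ = solve-∀
        lemma₂ : ∀ a q w → - (a * (q - 1ℤ) * w) * 1ℤ * -1ℤ ≡ w * a * (q - 1ℤ)
        lemma₂ = solve-∀
        lemma₃ : ∀ w r r′ q → w * r′ * (q * (r * r′) - r * r) ≡ w * r * r′ * (q * r′ - r)
        lemma₃ = solve-∀

      -- The exponent `w₀` contains the ratio `r / r′`, whereas `C` contains `R N / R (N + n)`. By
      -- `R-suc`, `r * R (N + n) - R N * r′ = 2^ j * r * r′ * (2^ n * r′ -
      -- r)`, whose cofactor of `2^ j` is needed modulo 4 only.
      correction : c₂ * W * (r * r″) - c₂ * W * (R N * R′) ≋ 2^ j * ((2^ n - 1ℤ) * c₃) ⟨ 2^ (2 ℕ.+ j) ⟩
      correction = odd-cancelˡ (r′ * r₁) (Odd-* (R-odd g) odd-r₁) (begin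
        r′ * r₁ * (c₂ * W * (r * r″) - c₂ * W * (R N * R′)) ≡⟨ lemma₁ r′ r₁ (c₂ * W) r r″ (R N) R′ ⟩
        c₂ * W * (r * r₁ * (r′ * r″) - R N * r′ * (r₁ * R′))
          ≈⟨ *-congˡ≋ (c₂ * W) (+-cong≋ (*-congˡ≋ (r * r₁) (lower 2+j≤m r″-inverse)) (-‿cong≋ (*-congˡ≋ (R N * r′) (lower 2+j≤m R′-inverse)))) ⟩
        c₂ * W * (r * r₁ * 1ℤ - R N * r′ * 1ℤ) ≡⟨ cong₂ (λ a b → c₂ * W * (r * a * 1ℤ - b * r′ * 1ℤ)) (trans R[N+n] (cong (λ z → r′ + r′ * r′ * z) 2^-split)) R[N] ⟩
        c₂ * W * (r * (r′ + r′ * r′ * (2^ j * 2^ n)) * 1ℤ - (r + r * r * 2^ j) * r′ * 1ℤ) ≡⟨ lemma₂ (c₂ * W) r r′ (2^ j) (2^ n) ⟩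
        2^ j * (c₂ * W * r * r′ * (2^ n * r′ - r)) ≈⟨ recast (ℕ.+-comm j 2) (scale-2^ j (mod2^2 mod4-identity)) ⟩
        2^ j * (r′ * r₁ * ((2^ n - 1ℤ) * c₃)) ≡⟨ lemma₃ (2^ j) (r′ * r₁) ((2^ n - 1ℤ) * c₃) ⟩
        r′ * r₁ * (2^ j * ((2^ n - 1ℤ) * c₃)) ∎)
        where
        open ≋-Reasoning (2^ (2 ℕ.+ j))
        r₁ = R (N ℕ.+ n)
        odd-r₁ : Odd r₁
        odd-r₁ = subst Odd (cong (λ N → R (N ℕ.+ n)) (sym N≡)) (R-odd (suc g))
        2^-split : 2^ (suc g) ≡ 2^ j * 2^ n
        2^-split = 2^-+ j n
        lemma₁ : ∀ a b w r r″ R R′ → a * b * (w * (r * r″) - w * (R * R′)) ≡ w * (r * b * (a * r″) - R * a * (b * R′))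
        lemma₁ = solve-∀
        lemma₂ : ∀ w r r′ p q → w * (r * (r′ + r′ * r′ * (p * q)) * 1ℤ - (r + r * r * p) * r′ * 1ℤ) ≡ p * (w * r * r′ * (q * r′ - r))
        lemma₂ = solve-∀
        lemma₃ : ∀ a b c → a * (b * c) ≡ b * (a * c)
        lemma₃ = solve-∀

      h : ℤ
      h = + 2 * l + (+ k₁ - 1ℤ) + (2^ n - 1ℤ) * c₃

      reduced-exponent : c₃ + c₂ * + w₀ + 2^ (suc j) * (c₂ * + b) ≋ 2^ j * h ⟨ 2^ (2 ℕ.+ j) ⟩
      reduced-exponent = begin
        c₃ + c₂ * + w₀ + 2^ (suc j) * (c₂ * + b)
          ≈⟨ +-cong≋ (+-congˡ≋ c₃ (*-congˡ≋ c₂ (lower 2+j≤m w₀≋)))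
               (recast (ℕ.+-comm (suc j) 1) (scale-2^ (suc j) (mod2^1 (≋-trans (*-congʳ≋ (+ b) odd-c₂) (≋-reflexive (*-identityˡ (+ b))))))) ⟩
        c₃ + c₂ * target + 2^ (suc j) * + b
          ≡⟨ lemma₁ c₃ c₂ A₁ (+ k₁) X r r″ D (R N) R′ (2^ (suc j) * + b) ⟩
        (c₃ + c₂ * W * (R N * R′)) + (c₂ * W * (r * r″) - c₂ * W * (R N * R′)) + 2^ (suc j) * + b
          ≈⟨ +-congʳ≋ (2^ (suc j) * + b) (+-cong≋ c₃-equation correction) ⟩
        2^ (suc j) * l + 2^ j * ((2^ n - 1ℤ) * c₃) + 2^ (suc j) * + b
          ≡⟨ cong (λ z → z * l + 2^ j * ((2^ n - 1ℤ) * c₃) + z * + b) (2^-suc j) ⟩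
        + 2 * 2^ j * l + 2^ j * ((2^ n - 1ℤ) * c₃) + + 2 * 2^ j * + b
          ≡⟨ lemma₂ (2^ j) l ((2^ n - 1ℤ) * c₃) (+ b) ⟩
        2^ j * (+ 2 * l + (1ℤ + + 2 * + b - 1ℤ) + (2^ n - 1ℤ) * c₃)
          ≡⟨ cong (λ z → 2^ j * (+ 2 * l + (z - 1ℤ) + (2^ n - 1ℤ) * c₃)) +k₁≡ ⟨
        2^ j * h ∎
        where
        open ≋-Reasoning (2^ (2 ℕ.+ j))
        lemma₁ : ∀ c₃ c₂ a k x r r″ d R R′ z → c₃ + c₂ * (a * k * x * r * r″ * d) + z ≡
          (c₃ + c₂ * (a * k * x * d) * (R * R′)) + (c₂ * (a * k * x * d) * (r * r″) - c₂ * (a * k * x * d) * (R * R′)) + z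
        lemma₁ = solve-∀
        lemma₂ : ∀ p l z b → + 2 * p * l + p * z + + 2 * p * b ≡ p * (+ 2 * l + (1ℤ + + 2 * b - 1ℤ) + z)
        lemma₂ = solve-∀

    Q : ℕ
    Q = g ℕ.+ j

    s+P≡ : s ℕ.+ P ≡ 2 ℕ.+ Q
    s+P≡ = ℕ.+-cancelˡ-≡ 2 (s ℕ.+ P) (2 ℕ.+ Q) m≡

    -- As `s + P = 2 + Q`, the resulting factor is `e(2^ Q * h / 2^ (2 + Q)) = e(h / 4)`.
    half-shift : ∃ λ w → f (x * (+ 5) ^ (2 ℕ.^ s′)) ≋ f x * (+ 5) ^ w ⟨ 2^ m ⟩ ×
      c₁ * + (2 ℕ.^ s′) + c₂ * + w ≋ 2^ Q * (+ 2 * l + (+ k₁ - 1ℤ) + (2^ n - 1ℤ) * c₃) ⟨ 2^ (2 ℕ.+ Q) ⟩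
    half-shift = w , ≋-trans lhs (≋-sym rhs) , (begin
      c₁ * + (2 ℕ.^ s′) + c₂ * + w
        ≡⟨ cong₂ (λ a b → a * + (2 ℕ.^ s′) + c₂ * b) c₁≡ (trans (pos-+ w₁ _) (cong₂ _+_ (pos-2^* g w₀) (pos-2^* (suc (g ℕ.+ j)) b))) ⟩
      2^ (n ℕ.+ t) * c₃ * + (2 ℕ.^ s′) + c₂ * (2^ g * + w₀ + 2^ (suc (g ℕ.+ j)) * + b)
        ≡⟨ cong₂ (λ z u → 2^ (n ℕ.+ t) * c₃ * z + c₂ * (2^ g * + w₀ + u * + b)) (sym (2^≡ s′)) (trans (cong 2^_ (sym (ℕ.+-suc g j))) (2^-+ g (suc j))) ⟩
      2^ (n ℕ.+ t) * c₃ * 2^ s′ + c₂ * (2^ g * + w₀ + 2^ g * 2^ (suc j) * + b)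
        ≡⟨ cong (_+ c₂ * (2^ g * + w₀ + 2^ g * 2^ (suc j) * + b)) (trans (lemma₁ (2^ (n ℕ.+ t)) c₃ (2^ s′)) (cong (_* c₃) g-split)) ⟩
      2^ g * c₃ + c₂ * (2^ g * + w₀ + 2^ g * 2^ (suc j) * + b) ≡⟨ lemma₂ (2^ g) c₃ c₂ (+ w₀) (2^ (suc j)) (+ b) ⟩
      2^ g * (c₃ + c₂ * + w₀ + 2^ (suc j) * (c₂ * + b)) ≈⟨ recast (lemma₃ g j) (scale-2^ g reduced-exponent) ⟩
      2^ g * (2^ j * h) ≡⟨ trans (sym (*-assoc (2^ g) (2^ j) h)) (cong (_* h) (sym (2^-+ g j))) ⟩
      2^ Q * h ∎)
      where
      open ≋-Reasoning (2^ (2 ℕ.+ Q))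
      g-split : 2^ (n ℕ.+ t) * 2^ s′ ≡ 2^ g
      g-split = trans (sym (2^-+ (n ℕ.+ t) s′)) (cong 2^_ (lemma n t s′))
        where
        lemma : ∀ n t s → n ℕ.+ t ℕ.+ s ≡ s ℕ.+ t ℕ.+ n
        lemma = ℕSolver.solve-∀
      lemma₁ : ∀ a b c → a * b * c ≡ a * c * b
      lemma₁ = solve-∀
      lemma₂ : ∀ p c₃ c₂ w q b → p * c₃ + c₂ * (p * w + p * q * b) ≡ p * (c₃ + c₂ * w + q * (c₂ * b))
      lemma₂ = solve-∀
      lemma₃ : ∀ g j → g ℕ.+ (2 ℕ.+ j) ≡ 2 ℕ.+ (g ℕ.+ j)
      lemma₃ = ℕSolver.solve-∀

-- Addition and cancellation of fractions of integers.

module Fractions where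
  open import Data.Integer.Base using (+_)
  import Data.Integer.Base as ℤ
  import Data.Integer.Properties as ℤ
  open import Data.Integer.Tactic.RingSolver using (solve-∀)
  open import Data.Nat.Base using (suc; NonZero)
  import Data.Nat.Base as ℕ
  open import Data.Rational.Base using (_/_; _+_)
  open import Data.Rational.Properties using (toℚᵘ-injective; toℚᵘ-homo-+; toℚᵘ-fromℚᵘ; fromℚᵘ-cong)
  open import Data.Rational.Unnormalised.Base as ℚᵘ using (mkℚᵘ; *≡*)
  import Data.Rational.Unnormalised.Properties as ℚᵘ
  open import Relation.Binary.PropositionalEquality

  /-+ : ∀ q .{{_ : NonZero q}} x y → (x ℤ.+ y) / q ≡ x / q + y / q
  /-+ (suc q) x y = toℚᵘ-injective (ℚᵘ.≃-trans (toℚᵘ-fromℚᵘ (mkℚᵘ (x ℤ.+ y) q))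
    (ℚᵘ.≃-trans (*≡* (lemma x y (+ suc q)))
      (ℚᵘ.≃-sym (ℚᵘ.≃-trans (toℚᵘ-homo-+ (x / suc q) (y / suc q))
        (ℚᵘ.+-cong (toℚᵘ-fromℚᵘ (mkℚᵘ x q)) (toℚᵘ-fromℚᵘ (mkℚᵘ y q)))))))
    where
    lemma : ∀ x y q → (x ℤ.+ y) ℤ.* (q ℤ.* q) ≡ (x ℤ.* q ℤ.+ y ℤ.* q) ℤ.* q
    lemma = solve-∀

  /-cancel : ∀ a q b .{{_ : NonZero q}} .{{_ : NonZero b}} → b ≡ a ℕ.* q → ∀ x → (+ a ℤ.* x) / b ≡ x / q
  /-cancel a (suc q) (suc b) eq x = fromℚᵘ-cong {mkℚᵘ (+ a ℤ.* x) b} {mkℚᵘ x q}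
    (*≡* (trans (lemma (+ a) x (+ suc q)) (cong (x ℤ.*_) (trans (sym (ℤ.pos-* a (suc q))) (cong +_ (sym eq))))))
    where
    lemma : ∀ a x q → a ℤ.* x ℤ.* q ≡ x ℤ.* (a ℤ.* q)
    lemma = solve-∀

-- Roots of unity of 2-power order, geometric sums, and 1 + i^h.

module Exponential {c ℓ₁ ℓ₂} (ℂ : ComplexField c ℓ₁ ℓ₂) where
  open import Data.Integer.Base using (ℤ; +_; -[1+_]; 1ℤ; -1ℤ; 0ℤ)
  import Data.Integer.Base as ℤ
  import Data.Integer.Properties as ℤ
  open import Data.Nat.Base as ℕ using (ℕ; zero; suc; NonZero)
  import Data.Nat.Properties as ℕ
  open import Data.Fin.Base using (toℕ)
  import Data.Rational.Base as ℚ
  open import Data.Product.Base using (_,_; proj₁; proj₂)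
  open import Data.Sum.Base using (inj₁; inj₂)
  open import Relation.Nullary.Negation using (¬_; contradiction)
  import Relation.Binary.PropositionalEquality as ≡
  open ≡ using (_≡_)
  open ComplexField ℂ
  open CharacterSums ℂ using (e; √2; 2#; fromℤ)
  open import Algebra.Bundles using (CommutativeRing)
  open CommutativeRing commutativeRing using (ring)
  open import Algebra.Properties.Ring ring
  open import Algebra.Properties.Semiring.Exp semiring using (^-congˡ)
  open import Algebra.Properties.Semiring.Mult semiring using (×1-homo-*)
  open import Algebra.Properties.Semiring.Sum semiring using (sum; *-distribˡ-sum)
  open import Relation.Binary.Reasoning.Setoid setoid
  open Congruence
  open Powers using (even-part)
  open Fractions

  -- Tightness of the apartness relation. It permits assuming `¬ S ≈ 0#` in order to prove `S ≈ 0#`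
  -- without deciding equality.
  ≈-stable : ∀ {x y} → ¬ ¬ x ≈ y → x ≈ y
  ≈-stable {x} {y} ¬¬eq = proj₁ (tight x y) (λ x#y → ¬¬eq (λ x≈y → proj₂ (tight x y) x≈y x#y))

  #-cancel : ∀ {x y} → x * y ≈ 0# → x # 0# → y ≈ 0#
  #-cancel {x} {y} xy≈0 x#0 with #⇒invertible x#0
  ... | i , i*x≈1 , _ = begin
    y ≈⟨ *-identityˡ y ⟨
    1# * y ≈⟨ *-congʳ i*x≈1 ⟨
    i * (x - 0#) * y ≈⟨ *-congʳ (*-congˡ (trans (+-congˡ -0#≈0#) (+-identityʳ x))) ⟩
    i * x * y ≈⟨ *-assoc i x y ⟩
    i * (x * y) ≈⟨ *-congˡ xy≈0 ⟩
    i * 0# ≈⟨ zeroʳ i ⟩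
    0# ∎

  no-zero-divisors : ∀ {x y} → x * y ≈ 0# → ¬ x ≈ 0# → y ≈ 0#
  no-zero-divisors {x} {y} xy≈0 x≉0 = proj₁ (tight y 0#)
    (λ y#0 → x≉0 (#-cancel (trans (*-comm y x) xy≈0) y#0))

  -- Serves twice: for geometric sums over a root of unity, and for `S` under the substitution of
  -- `- x` for `x`.
  fixed⇒0 : ∀ {a x} → a * x ≈ x → ¬ a ≈ 1# → x ≈ 0#
  fixed⇒0 {a} {x} ax≈x a≉1 = no-zero-divisors {a - 1#} (begin
    (a - 1#) * x ≈⟨ distribʳ x a (- 1#) ⟩
    a * x + - 1# * x ≈⟨ +-cong ax≈x (-1*x≈-x x) ⟩
    x + - x ≈⟨ -‿inverseʳ x ⟩
    0# ∎) (λ a-1≈0 → a≉1 (x∙y⁻¹≈ε⇒x≈y a 1# a-1≈0))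

  ×-cancel : ∀ n .{{_ : NonZero n}} {x y} → (n × 1#) * x ≈ (n × 1#) * y → x ≈ y
  ×-cancel (suc n) {x} {y} eq = x∙y⁻¹≈ε⇒x≈y x y (#-cancel (begin
    (suc n × 1#) * (x - y) ≈⟨ distribˡ _ x (- y) ⟩
    (suc n × 1#) * x + (suc n × 1#) * - y ≈⟨ +-cong eq (sym (-‿distribʳ-* _ y)) ⟩
    (suc n × 1#) * y - (suc n × 1#) * y ≈⟨ -‿inverseʳ _ ⟩
    0# ∎) (char0 n))

  -1≉1 : ¬ - 1# ≈ 1#
  -1≉1 eq = proj₂ (tight _ _) (begin
    1# + (1# + 0#) ≈⟨ +-congˡ (+-identityʳ 1#) ⟩
    1# + 1# ≈⟨ +-congˡ eq ⟨
    1# - 1# ≈⟨ -‿inverseʳ 1# ⟩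
    0# ∎) (char0 1)

  -1*-1≈1 : - 1# * - 1# ≈ 1#
  -1*-1≈1 = trans (-1*x≈-x (- 1#)) (-‿involutive 1#)

  1^ : ∀ j → 1# ^ j ≈ 1#
  1^ zero    = refl
  1^ (suc j) = trans (*-identityˡ _) (1^ j)

  -- From `½ + 0 = ½`: multiplication by `exp2πi 0` fixes `- 1#`, which is invertible.
  exp-0 : exp2πi ℚ.0ℚ ≈ 1#
  exp-0 = begin
    x ≈⟨ *-identityˡ x ⟨
    1# * x ≈⟨ *-congʳ -1*-1≈1 ⟨
    - 1# * - 1# * x ≈⟨ *-assoc (- 1#) (- 1#) x ⟩
    - 1# * (- 1# * x) ≈⟨ *-congˡ (*-congʳ exp2πi-½) ⟨
    - 1# * (exp2πi ℚ.½ * x) ≈⟨ *-congˡ (exp2πi-homo ℚ.½ ℚ.0ℚ) ⟨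
    - 1# * exp2πi ℚ.½ ≈⟨ *-congˡ exp2πi-½ ⟩
    - 1# * - 1# ≈⟨ -1*-1≈1 ⟩
    1# ∎
    where x = exp2πi ℚ.0ℚ

  e-cong : ∀ q .{{_ : NonZero q}} {x y} → x ≡ y → e q x ≈ e q y
  e-cong q eq = reflexive (≡.cong (e q) eq)

  e-+ : ∀ q .{{_ : NonZero q}} x y → e q (x ℤ.+ y) ≈ e q x * e q y
  e-+ q x y = trans (reflexive (≡.cong exp2πi (/-+ q x y))) (exp2πi-homo _ _)

  e-cancel : ∀ a q b .{{_ : NonZero q}} .{{_ : NonZero b}} → b ≡ a ℕ.* q → ∀ x → e b (+ a ℤ.* x) ≈ e q x
  e-cancel a q b eq x = reflexive (≡.cong exp2πi (/-cancel a q b eq x))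

  e₁-pos : ∀ n → e 1 (+ n) ≈ 1#
  e₁-pos zero = exp-0
  e₁-pos (suc n) = begin
    e 1 (1ℤ ℤ.+ + n) ≈⟨ e-+ 1 1ℤ (+ n) ⟩
    e 1 1ℤ * e 1 (+ n) ≈⟨ *-cong e1≈1 (e₁-pos n) ⟩
    1# * 1# ≈⟨ *-identityˡ 1# ⟩
    1# ∎
    where
    e1≈1 : e 1 1ℤ ≈ 1#
    e1≈1 = trans (sym (e-cancel 2 1 2 ≡.refl 1ℤ)) (trans (e-+ 2 1ℤ 1ℤ) (trans (*-cong exp2πi-½ exp2πi-½) -1*-1≈1))

  e₁ : ∀ x → e 1 x ≈ 1#
  e₁ (+ n)    = e₁-pos n
  e₁ -[1+ n ] = begin
    e 1 -[1+ n ] ≈⟨ *-identityʳ _ ⟨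
    e 1 -[1+ n ] * 1# ≈⟨ *-congˡ (e₁-pos (suc n)) ⟨
    e 1 -[1+ n ] * e 1 (+ suc n) ≈⟨ e-+ 1 -[1+ n ] (+ suc n) ⟨
    e 1 (-[1+ n ] ℤ.+ + suc n) ≈⟨ e-cong 1 (ℤ.+-inverseˡ (+ suc n)) ⟩
    e 1 0ℤ ≈⟨ exp-0 ⟩
    1# ∎

  e-periodic : ∀ q .{{_ : NonZero q}} {x y} → x ≋ y ⟨ + q ⟩ → e q x ≈ e q y
  e-periodic q {y = y} (by z ≡.refl) = begin
    e q (y ℤ.+ z ℤ.* + q) ≈⟨ e-+ q y (z ℤ.* + q) ⟩
    e q y * e q (z ℤ.* + q) ≈⟨ *-congˡ (trans (e-cong q (ℤ.*-comm z (+ q))) multiple) ⟩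
    e q y * 1# ≈⟨ *-identityʳ _ ⟩
    e q y ∎
    where
    multiple : e q (+ q ℤ.* z) ≈ 1#
    multiple = trans (e-cancel q 1 q (≡.sym (ℕ.*-identityʳ q)) z) (e₁ z)

  opaque
    E : ℕ → ℤ → Carrier
    E d x = e (2 ℕ.^ d) {{ℕ.m^n≢0 2 d}} x

    E≡ : ∀ d x → E d x ≈ e (2 ℕ.^ d) {{ℕ.m^n≢0 2 d}} x
    E≡ d x = refl

    E-+ : ∀ d x y → E d (x ℤ.+ y) ≈ E d x * E d y
    E-+ d = e-+ (2 ℕ.^ d) {{ℕ.m^n≢0 2 d}}

    E-0 : ∀ d → E d 0ℤ ≈ 1#
    E-0 d = trans (e-cong (2 ℕ.^ d) {{ℕ.m^n≢0 2 d}} (≡.sym (ℤ.*-zeroʳ (+ (2 ℕ.^ d))))) (trans (e-cancel (2 ℕ.^ d) 1 (2 ℕ.^ d) {{_}} {{ℕ.m^n≢0 2 d}} (≡.sym (ℕ.*-identityʳ (2 ℕ.^ d))) 0ℤ) exp-0)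

    E-cong : ∀ d {x y} → x ≋ y ⟨ 2^ d ⟩ → E d x ≈ E d y
    E-cong d {x} {y} p = e-periodic (2 ℕ.^ d) {{ℕ.m^n≢0 2 d}} (≡.subst (λ q → x ≋ y ⟨ q ⟩) (2^≡ d) p)

    E-cancel : ∀ i d x → E (i ℕ.+ d) (2^ i ℤ.* x) ≈ E d x
    E-cancel i d x = trans (e-cong (2 ℕ.^ (i ℕ.+ d)) {{ℕ.m^n≢0 2 (i ℕ.+ d)}} (≡.cong (ℤ._* x) (2^≡ i)))
      (e-cancel (2 ℕ.^ i) (2 ℕ.^ d) (2 ℕ.^ (i ℕ.+ d)) {{ℕ.m^n≢0 2 d}} {{ℕ.m^n≢0 2 (i ℕ.+ d)}} (ℕ.^-distribˡ-+-* 2 i d) x)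

  E-^ : ∀ d x j → E d x ^ j ≈ E d (x ℤ.* + j)
  E-^ d x zero    = sym (trans (E-cong d (≋-reflexive (ℤ.*-zeroʳ x))) (E-0 d))
  E-^ d x (suc j) = begin
    E d x * E d x ^ j ≈⟨ *-congˡ (E-^ d x j) ⟩
    E d x * E d (x ℤ.* + j) ≈⟨ E-+ d x (x ℤ.* + j) ⟨
    E d (x ℤ.+ x ℤ.* + j) ≈⟨ E-cong d (≋-reflexive (≡.sym (ℤ.*-suc x (+ j)))) ⟩
    E d (x ℤ.* + suc j) ∎

  E-odd : ∀ {x} → Odd x → E 1 x ≈ - 1#
  E-odd o = trans (E≡ 1 _) (trans (e-periodic 2 o) exp2πi-½)

  -- Faithfulness follows from the value at `½`: for odd `x` the `2 ^ d`-th power of `E (suc d) x`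
  -- is `E 1 x`, that is `- 1#`, and not 1; an even `x` reduces to the denominator `2 ^ d`.
  E-primitive : ∀ d {x} → E d x ≈ 1# → x ≋ 0ℤ ⟨ 2^ d ⟩
  E-primitive zero    {x} _   = mod2^0 x 0ℤ
  E-primitive (suc d) {x} Ex≈1 = go (parity x)
    where
    open import Data.Sum.Base using (_⊎_)
    go : Even x ⊎ Odd x → x ≋ 0ℤ ⟨ 2^ (suc d) ⟩
    go (inj₁ ev) with even-part ev
    ... | y , ≡.refl = ≋-trans (≋-reflexive (≡.cong (ℤ._* y) (≡.sym (2^≡ 1))))
      (≋-trans (scale-2^ 1 (E-primitive d (trans (sym (E-cancel 1 d y))
        (trans (E-cong (suc d) (≋-reflexive (≡.cong (ℤ._* y) (2^≡ 1)))) Ex≈1))))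
        (≋-reflexive (ℤ.*-zeroʳ (2^ 1))))
    go (inj₂ od) = contradiction (begin
      - 1# ≈⟨ E-odd od ⟨
      E 1 x ≈⟨ E-cancel d 1 x ⟨
      E (d ℕ.+ 1) (2^ d ℤ.* x) ≈⟨ reflexive (≡.cong (λ j → E j (2^ d ℤ.* x)) (ℕ.+-comm d 1)) ⟩
      E (suc d) (2^ d ℤ.* x) ≈⟨ E-cong (suc d) (≋-reflexive (≡.trans (ℤ.*-comm (2^ d) x) (≡.cong (x ℤ.*_) (2^≡ d)))) ⟩
      E (suc d) (x ℤ.* + (2 ℕ.^ d)) ≈⟨ E-^ (suc d) x (2 ℕ.^ d) ⟨
      E (suc d) x ^ (2 ℕ.^ d) ≈⟨ ^-congˡ (2 ℕ.^ d) Ex≈1 ⟩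
      1# ^ (2 ℕ.^ d) ≈⟨ 1^ (2 ℕ.^ d) ⟩
      1# ∎) -1≉1

  geometric : ℕ → Carrier → Carrier
  geometric K ζ = sum {K} (λ v → ζ ^ toℕ v)

  geometric-suc : ∀ K ζ → geometric (suc K) ζ ≈ 1# + ζ * geometric K ζ
  geometric-suc K ζ = +-congˡ (sym (*-distribˡ-sum {K} ζ (λ v → ζ ^ toℕ v)))

  geometric-shift : ∀ K ζ → geometric K ζ + ζ ^ K ≈ 1# + ζ * geometric K ζ
  geometric-shift zero    ζ = trans (+-comm 0# 1#) (+-congˡ (sym (zeroʳ ζ)))
  geometric-shift (suc K) ζ = begin
    geometric (suc K) ζ + ζ * ζ ^ K ≈⟨ +-congʳ (geometric-suc K ζ) ⟩
    1# + ζ * geometric K ζ + ζ * ζ ^ K ≈⟨ +-assoc _ _ _ ⟩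
    1# + (ζ * geometric K ζ + ζ * ζ ^ K) ≈⟨ +-congˡ (distribˡ ζ _ _) ⟨
    1# + ζ * (geometric K ζ + ζ ^ K) ≈⟨ +-congˡ (*-congˡ (geometric-shift K ζ)) ⟩
    1# + ζ * (1# + ζ * geometric K ζ) ≈⟨ +-congˡ (*-congˡ (geometric-suc K ζ)) ⟨
    1# + ζ * geometric (suc K) ζ ∎

  -- When `ζ ^ K` is 1, `geometric-shift` says that the sum is fixed by multiplication with `ζ`.
  geometric-root : ∀ K ζ → ζ ^ K ≈ 1# → ¬ ζ ≈ 1# → geometric K ζ ≈ 0#
  geometric-root K ζ ζ^K≈1 = fixed⇒0 (sym (+-cancelˡ 1# _ _ (begin
    1# + geometric K ζ ≈⟨ +-comm 1# _ ⟩
    geometric K ζ + 1# ≈⟨ +-congˡ ζ^K≈1 ⟨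
    geometric K ζ + ζ ^ K ≈⟨ geometric-shift K ζ ⟩
    1# + ζ * geometric K ζ ∎)))

  geometric-1 : ∀ K {ζ} → ζ ≈ 1# → geometric K ζ ≈ K × 1#
  geometric-1 zero    ζ≈1 = refl
  geometric-1 (suc K) {ζ} ζ≈1 = trans (geometric-suc K ζ) (+-congˡ (trans (*-congʳ ζ≈1) (trans (*-identityˡ _) (geometric-1 K ζ≈1))))

  2^× : ∀ a → (2 ℕ.^ a) × 1# ≈ 2# ^ a
  2^× zero    = +-identityʳ 1#
  2^× (suc a) = trans (×1-homo-* 2 (2 ℕ.^ a)) (*-cong (+-congˡ (+-identityʳ 1#)) (2^× a))

  e₄-shift : ∀ x → e 4 (x ℤ.+ + 2) ≈ - e 4 x
  e₄-shift x = begin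
    e 4 (x ℤ.+ + 2) ≈⟨ e-+ 4 x (+ 2) ⟩
    e 4 x * e 4 (+ 2) ≈⟨ *-congˡ (trans (e-cancel 2 2 4 ≡.refl 1ℤ) exp2πi-½) ⟩
    e 4 x * - 1# ≈⟨ *-comm _ _ ⟩
    - 1# * e 4 x ≈⟨ -1*x≈-x _ ⟩
    - e 4 x ∎

  e₈-even : ∀ x → e 8 (+ 2 ℤ.* x) ≈ e 4 x
  e₈-even = e-cancel 2 4 8 ≡.refl

  √2*e₈ : ∀ h → √2 * e 8 h ≈ e 8 (1ℤ ℤ.+ h) + e 8 (-1ℤ ℤ.+ h)
  √2*e₈ h = trans (distribʳ (e 8 h) _ _) (+-cong (sym (e-+ 8 1ℤ h)) (sym (e-+ 8 -1ℤ h)))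

  √2²≈2 : √2 ^ 2 ≈ 2#
  √2²≈2 = begin
    √2 * (√2 * 1#) ≈⟨ *-congˡ (*-identityʳ √2) ⟩
    √2 * √2 ≈⟨ distribˡ √2 _ _ ⟩
    √2 * e 8 1ℤ + √2 * e 8 -1ℤ ≈⟨ +-cong (√2*e₈ 1ℤ) (√2*e₈ -1ℤ) ⟩
    (e 8 (+ 2) + e 8 0ℤ) + (e 8 0ℤ + e 8 (ℤ.- + 2)) ≈⟨ +-cong (+-cong (e₈-even 1ℤ) exp-0) (+-cong exp-0 (trans (e₈-even -1ℤ) (trans (sym (-‿involutive _)) (-‿cong (sym (e₄-shift -1ℤ)))))) ⟩
    (e 4 1ℤ + 1#) + (1# + - e 4 1ℤ) ≈⟨ +-assoc _ _ _ ⟩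
    e 4 1ℤ + (1# + (1# + - e 4 1ℤ)) ≈⟨ +-congˡ (+-assoc 1# 1# _) ⟨
    e 4 1ℤ + (2# + - e 4 1ℤ) ≈⟨ +-comm _ _ ⟩
    (2# + - e 4 1ℤ) + e 4 1ℤ ≈⟨ +-assoc _ _ _ ⟩
    2# + (- e 4 1ℤ + e 4 1ℤ) ≈⟨ +-congˡ (-‿inverseˡ _) ⟩
    2# + 0# ≈⟨ +-identityʳ 2# ⟩
    2# ∎

  -- As `√2` is the sum of `ω` and its inverse, `√2 * ω^h` equals `ω^(h+1) + ω^(h-1)`. For odd `h`
  -- these two terms are `1` and `i^h` in some order, up to a common sign depending on `h` modulo 8,
  -- which is `(2 / h)`.
  quadratic-Gauss : ∀ h → Odd h → 1# + e 4 h ≈ √2 * (e 8 h * fromℤ (jacobi (+ 2) h))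
  quadratic-Gauss h odd = go _ (jacobi-2 h odd)
    where
    open SecondSupplement
    +case : ∀ x y z → e 8 (1ℤ ℤ.+ h) ≈ y → e 8 (-1ℤ ℤ.+ h) ≈ z → x ≈ y + z → x ≈ √2 * (e 8 h * (1# + 0#))
    +case x y z p q eq = trans eq (trans (+-cong (sym p) (sym q)) (trans (sym (√2*e₈ h)) (*-congˡ (sym (trans (*-congˡ (+-identityʳ 1#)) (*-identityʳ _))))))
    -case : ∀ x y z → e 8 (1ℤ ℤ.+ h) ≈ y → e 8 (-1ℤ ℤ.+ h) ≈ z → x ≈ - (y + z) → x ≈ √2 * (e 8 h * - (1# + 0#))
    -case x y z p q eq = trans eq (trans (-‿cong (trans (+-cong (sym p) (sym q)) (sym (√2*e₈ h))))
      (trans (-‿distribʳ-* √2 (e 8 h)) (*-congˡ (sym (trans (sym (-‿distribʳ-* _ _)) (-‿cong (trans (*-congˡ (+-identityʳ 1#)) (*-identityʳ _))))))))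
    at : ∀ {a} j → h ≋ a ⟨ + 8 ⟩ → e 8 (j ℤ.+ h) ≈ e 8 (j ℤ.+ a)
    at j p = e-periodic 8 (+-congˡ≋ j p)
    e4 : ∀ {a} → h ≋ a ⟨ + 8 ⟩ → e 4 h ≈ e 4 a
    e4 p = e-periodic 4 (modulus-∣ (+ 2) p)
    e8-4 : e 8 (+ 4) ≈ - 1#
    e8-4 = trans (e₈-even (+ 2)) (trans (e-cancel 2 2 4 ≡.refl 1ℤ) exp2πi-½)
    go : ∀ ε → Sign8 h ε → 1# + e 4 h ≈ √2 * (e 8 h * fromℤ ε)
    go _ (is+1 p) = +case _ _ _ (trans (at 1ℤ p) (e₈-even 1ℤ)) (trans (at -1ℤ p) exp-0) (trans (+-congˡ (e4 p)) (+-comm _ _))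
    go _ (is-1 p) = +case _ _ _ (trans (at 1ℤ p) exp-0) (trans (at -1ℤ p) (e₈-even -1ℤ)) (+-congˡ (e4 p))
    go _ (is+3 p) = -case _ _ _ (trans (at 1ℤ p) e8-4) (trans (at -1ℤ p) (e₈-even 1ℤ)) (trans (+-congˡ (trans (e4 p) (e₄-shift 1ℤ))) (negate (e 4 1ℤ)))
      where
      negate : ∀ x → 1# + - x ≈ - (- 1# + x)
      negate x = trans (+-congʳ (sym (-‿involutive 1#))) (-‿+-comm (- 1#) x)
    go _ (is-3 p) = -case _ _ _ (trans (at 1ℤ p) (e₈-even -1ℤ)) (trans (at -1ℤ p) (trans (e-periodic 8 {ℤ.- + 4} {+ 4} (by -1ℤ ≡.refl)) e8-4))
        (trans (+-congˡ (trans (e4 p) (trans (e-periodic 4 {ℤ.- + 3} {1ℤ} (by -1ℤ ≡.refl)) (e₄-shift -1ℤ)))) (negate (e 4 -1ℤ)))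
      where
      negate : ∀ x → 1# + - x ≈ - (x + - 1#)
      negate x = trans (+-comm 1# (- x)) (trans (+-congˡ (sym (-‿involutive 1#))) (-‿+-comm x (- 1#)))

-- Sums of periodic functions over residue systems.

module ResidueSums {c ℓ₁ ℓ₂} (ℂ : ComplexField c ℓ₁ ℓ₂) where
  open import Data.Integer.Base using (1ℤ)
  import Data.Integer.Properties as ℤ
  open import Data.Integer.Tactic.RingSolver using (solve-∀)
  open import Data.Nat.Base using (zero; suc; NonZero)
  import Data.Nat.Properties as ℕ
  open import Data.Fin.Base using (Fin; toℕ)
  open import Data.Fin.Permutation using (Permutation′; permutation; _⟨$⟩ʳ_)
  open import Data.List.Base using (List; []; _∷_; foldr; map)
  open import Data.List.Relation.Unary.All as All using (All; []; _∷_)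
  import Data.List.Relation.Unary.All.Properties as All
  open import Data.List.Relation.Unary.AllPairs using (AllPairs; []; _∷_)
  open import Data.List.Relation.Unary.Any as Any using (Any)
  import Data.List.Relation.Unary.Any.Properties as Any
  open import Data.List.Relation.Unary.Unique.Propositional using (Unique)
  open import Relation.Nullary.Negation using (¬_)
  import Relation.Binary.PropositionalEquality as ≡
  open ComplexField ℂ
  open CharacterSums ℂ using (∑[1⋯_])
  open import Algebra.Bundles using (CommutativeRing)
  open CommutativeRing commutativeRing using (+-commutativeMonoid)
  open import Algebra.Properties.Semiring.Sum semiring using (sum; sum-cong-≋; sum-permute)
  open import Relation.Binary.Reasoning.Setoid setoid
  open FinSums +-commutativeMonoid using (sum-support)
  open Congruence
  open Residues

  Periodic : ℤ → (ℤ → Carrier) → Set ℓ₁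
  Periodic q F = ∀ {x y} → x ≋ y ⟨ q ⟩ → F x ≈ F y

  ∑-cong : ∀ q {F G : ℤ → Carrier} → (∀ x → F x ≈ G x) → ∑[1⋯ q ] F ≈ ∑[1⋯ q ] G
  ∑-cong q F≈G = sum-cong-≋ {q} (λ i → F≈G (+ suc (toℕ i)))

  ∑-val : ∀ q F → ∑[1⋯ q ] F ≈ sum {q} (λ i → F (val i))
  ∑-val q F = sum-cong-≋ {q} (λ i → reflexive (≡.cong F (≡.sym (val≡ i))))

  ∑-unit : ∀ q .{{_ : NonZero q}} {F} → Periodic (+ q) F → ∀ u u′ → u ℤ.* u′ ≋ 1ℤ ⟨ + q ⟩ →
    ∑[1⋯ q ] (λ x → F (u ℤ.* x)) ≈ ∑[1⋯ q ] F
  ∑-unit q {F} periodic u u′ uu′≋1 = begin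
    ∑[1⋯ q ] (λ x → F (u ℤ.* x)) ≈⟨ ∑-val q (λ x → F (u ℤ.* x)) ⟩
    sum {q} (λ i → F (u ℤ.* val i)) ≈⟨ sum-cong-≋ {q} (λ i → periodic (val-idx (u ℤ.* val i))) ⟨
    sum {q} (λ i → F (val (π ⟨$⟩ʳ i))) ≈⟨ sum-permute {q} {q} (λ i → F (val i)) π ⟨
    sum {q} (λ i → F (val i)) ≈⟨ ∑-val q F ⟨
    ∑[1⋯ q ] F ∎
    where
    undo : ∀ a b → a ℤ.* b ≋ 1ℤ ⟨ + q ⟩ → ∀ i → idx (a ℤ.* val (idx {q} (b ℤ.* val i))) ≡ i
    undo a b ab≋1 i = ≡.trans (idx-cong (≋-trans (*-congˡ≋ a (val-idx (b ℤ.* val i)))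
      (≋-trans (≋-reflexive (≡.sym (ℤ.*-assoc a b (val i))))
        (≋-trans (*-congʳ≋ (val i) ab≋1) (≋-reflexive (ℤ.*-identityˡ (val i))))))) (idx-val i)
    π : Permutation′ q
    π = permutation (λ i → idx (u ℤ.* val i)) (λ i → idx (u′ ℤ.* val i)) (undo u u′ uu′≋1)
          (undo u′ u (≋-trans (≋-reflexive (ℤ.*-comm u′ u)) uu′≋1))

  ∑-+ : ∀ a b F → ∑[1⋯ a ℕ.+ b ] F ≈ ∑[1⋯ a ] F + ∑[1⋯ b ] (λ x → F (+ a ℤ.+ x))
  ∑-+ zero    b F = trans (∑-cong b (λ x → reflexive (≡.cong F (≡.sym (ℤ.+-identityˡ x))))) (sym (+-identityˡ _))
  ∑-+ (suc a) b F = trans (+-congˡ (trans (shift (a ℕ.+ b)) (∑-+ a b (λ x → F (1ℤ ℤ.+ x)))))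
    (trans (sym (+-assoc _ _ _)) (+-cong (+-congˡ (sym (shift a)))
      (∑-cong b (λ x → reflexive (≡.cong F (≡.sym (ℤ.+-assoc 1ℤ (+ a) x)))))))
    where
    shift : ∀ n → sum {n} (λ i → F (+ suc (suc (toℕ i)))) ≈ ∑[1⋯ n ] (λ x → F (1ℤ ℤ.+ x))
    shift n = refl

  ∑-fold : ∀ a b {F} → Periodic (+ b) F → ∑[1⋯ a ℕ.* b ] F ≈ (a × 1#) * ∑[1⋯ b ] F
  ∑-fold zero    b periodic = sym (zeroˡ _)
  ∑-fold (suc a) b {F} periodic = begin
    ∑[1⋯ b ℕ.+ a ℕ.* b ] F ≈⟨ ∑-+ b (a ℕ.* b) F ⟩
    ∑[1⋯ b ] F + ∑[1⋯ a ℕ.* b ] (λ x → F (+ b ℤ.+ x)) ≈⟨ +-congˡ (∑-cong (a ℕ.* b) (λ x → periodic {+ b ℤ.+ x} {x} (by 1ℤ (lemma (+ b) x)))) ⟩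
    ∑[1⋯ b ] F + ∑[1⋯ a ℕ.* b ] F ≈⟨ +-cong (sym (*-identityˡ _)) (∑-fold a b periodic) ⟩
    1# * ∑[1⋯ b ] F + (a × 1#) * ∑[1⋯ b ] F ≈⟨ distribʳ _ _ _ ⟨
    (suc a × 1#) * ∑[1⋯ b ] F ∎
    where
    lemma : ∀ b x → b ℤ.+ x ≡ x ℤ.+ 1ℤ ℤ.* b
    lemma = solve-∀

  -- The entries of `rs` are arbitrary integers, such as `- x₀` or `x₀ * η`, which need not lie
  -- between 1 and `q`.
  ∑-support : ∀ q .{{_ : NonZero q}} {F} → Periodic (+ q) F → ∀ {rs} →
    AllPairs (λ r r′ → ¬ (r ≋ r′ ⟨ + q ⟩)) rs →
    (∀ x → ¬ Any (λ r → x ≋ r ⟨ + q ⟩) rs → F x ≈ 0#) →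
    ∑[1⋯ q ] F ≈ foldr _+_ 0# (map F rs)
  ∑-support q {F} periodic {rs} distinct vanish = begin
    ∑[1⋯ q ] F ≈⟨ ∑-val q F ⟩
    sum {q} (λ i → F (val i)) ≈⟨ sum-support {q} {λ i → F (val i)} (unique distinct) off ⟩
    foldr _+_ 0# (map (λ i → F (val i)) (map idx rs)) ≈⟨ on rs ⟩
    foldr _+_ 0# (map F rs) ∎
    where
    unique : ∀ {rs} → AllPairs (λ r r′ → ¬ (r ≋ r′ ⟨ + q ⟩)) rs → Unique (map (idx {q}) rs)
    unique []       = []
    unique (d ∷ ds) = All.map⁺ (All.map (λ ¬p eq → ¬p (idx-injective eq)) d) ∷ unique ds
    off : ∀ i → ¬ Any (i ≡_) (map (idx {q}) rs) → F (val i) ≈ 0#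
    off i i∉ = vanish (val i) (λ a → i∉ (Any.map⁺ (Any.map (λ p → ≡.trans (≡.sym (idx-val i)) (idx-cong p)) a)))
    on : ∀ rs → foldr _+_ 0# (map (λ i → F (val i)) (map (idx {q}) rs)) ≈ foldr _+_ 0# (map F rs)
    on []       = refl
    on (r ∷ rs) = +-cong (periodic (val-idx r)) (on rs)

-- Characters modulo powers of 2 and their values at powers of 5.

module Characters {c ℓ₁ ℓ₂} (ℂ : ComplexField c ℓ₁ ℓ₂) where
  open import Data.Integer.Base using (1ℤ; -1ℤ; 0ℤ)
  import Data.Integer.Properties as ℤ
  open import Data.Nat.Base using (zero; suc)
  import Data.Nat.Properties as ℕ
  import Data.Nat.Divisibility as ℕ
  open import Data.Product.Base using (_,_)
  open import Relation.Nullary.Negation using (¬_; contradiction)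
  import Relation.Binary.PropositionalEquality as ≡
  open ComplexField ℂ
  open CharacterSums ℂ using (DirichletCharacter; _⟨_⟩; Primitive)
  open import Relation.Binary.Reasoning.Setoid setoid
  open Congruence
  open Powers
  open Exponential ℂ

  module _ {q} (χ : DirichletCharacter q) where
    open DirichletCharacter χ using (periodic; *-homo; 1-homo; vanishes)

    χ-cong : ∀ {x y} → x ≋ y ⟨ + q ⟩ → χ ⟨ x ⟩ ≈ χ ⟨ y ⟩
    χ-cong {x} {y} p = periodic x y (to-[mod] p)

    χ-≡ : ∀ {x y} → x ≡ y → χ ⟨ x ⟩ ≈ χ ⟨ y ⟩
    χ-≡ eq = reflexive (≡.cong (χ ⟨_⟩) eq)

    χ-* : ∀ x y → χ ⟨ x ℤ.* y ⟩ ≈ χ ⟨ x ⟩ * χ ⟨ y ⟩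
    χ-* = *-homo

    χ-1 : χ ⟨ 1ℤ ⟩ ≈ 1#
    χ-1 = 1-homo

    χ-^ : ∀ x j → χ ⟨ x ℤ.^ j ⟩ ≈ χ ⟨ x ⟩ ^ j
    χ-^ x zero    = 1-homo
    χ-^ x (suc j) = trans (*-homo x (x ℤ.^ j)) (*-congˡ (χ-^ x j))

    χ-neg : ∀ x → χ ⟨ ℤ.- x ⟩ ≈ χ ⟨ -1ℤ ⟩ * χ ⟨ x ⟩
    χ-neg x = trans (χ-≡ (≡.sym (ℤ.-1*i≡-i x))) (*-homo -1ℤ x)

    χ-5^ : ∀ {d c} → χ ⟨ + 5 ⟩ ≈ E d c → ∀ w → χ ⟨ (+ 5) ℤ.^ w ⟩ ≈ E d (c ℤ.* + w)
    χ-5^ {d} {c} χ5 w = trans (χ-^ (+ 5) w) (trans (^-congˡ w χ5) (E-^ d c w))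
      where open import Algebra.Properties.Semiring.Exp semiring using (^-congˡ)

  module _ j (χ : DirichletCharacter (2 ℕ.^ suc j)) where
    open DirichletCharacter χ using (vanishes)

    χ-2^cong : ∀ {x y} → x ≋ y ⟨ 2^ (suc j) ⟩ → χ ⟨ x ⟩ ≈ χ ⟨ y ⟩
    χ-2^cong p = χ-cong χ (from-2^ {j = suc j} p)

    χ-even : ∀ {x} → Even x → χ ⟨ x ⟩ ≈ 0#
    χ-even {x} ev = vanishes x λ coprime → contradiction (coprime {2}
      (≡.subst (λ z → 2 ℕ.∣ ℤ.∣ z ∣) (ℤ.+-identityʳ x) (to-[mod] ev) , ℕ.divides (2 ℕ.^ j) (ℕ.*-comm 2 (2 ℕ.^ j)))) λ ()

  -- If χ(5) had an even exponent, χ would be trivial on the x ≡ 1 modulo 2 ^ (1 + d), these being powers of 5 ^ 2 ^ (d - 1).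
  primitive⇒odd : ∀ {d} → 0 ℕ.< d → (χ : DirichletCharacter (2 ℕ.^ (2 ℕ.+ d))) → Primitive χ →
    ∀ {c} → χ ⟨ + 5 ⟩ ≈ E d c → Odd c
  primitive⇒odd {suc d} _ χ prim {c} χ5 = ¬Even⇒Odd λ ev →
      prim (2 ℕ.^ (2 ℕ.+ d)) (ℕ.divides 2 ≡.refl) (ℕ.^-monoʳ-< 2 (ℕ.s≤s (ℕ.s≤s ℕ.z≤n)) {2 ℕ.+ d} {3 ℕ.+ d} ℕ.≤-refl)
        (λ x _ x≡1 → trivial ev x (to-2^ {j = 2 ℕ.+ d} (from-[mod] x≡1)))
    where
    trivial : Even c → ∀ x → x ≋ 1ℤ ⟨ 2^ (2 ℕ.+ d) ⟩ → χ ⟨ x ⟩ ≈ 1#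
    trivial ev x p with even-part ev | 5-generates d 1 p
    ... | b , ≡.refl | v , x≋ = begin
      χ ⟨ x ⟩ ≈⟨ χ-2^cong (2 ℕ.+ d) χ (recast (ℕ.+-comm (2 ℕ.+ d) 1) x≋) ⟩
      χ ⟨ 5^[2^ d * v ] ⟩ ≈⟨ χ-5^ χ {suc d} χ5 (2 ℕ.^ d ℕ.* v) ⟩
      E (suc d) (+ 2 ℤ.* b ℤ.* + (2 ℕ.^ d ℕ.* v)) ≈⟨ E-cong (suc d) (≋-trans (≋-reflexive eq) (multiple≋0 (b ℤ.* + v))) ⟩
      E (suc d) 0ℤ ≈⟨ E-0 (suc d) ⟩
      1# ∎
      where
      eq : + 2 ℤ.* b ℤ.* + (2 ℕ.^ d ℕ.* v) ≡ b ℤ.* + v ℤ.* 2^ (suc d)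
      eq = ≡.trans (≡.cong (+ 2 ℤ.* b ℤ.*_) (≡.trans (ℤ.pos-* (2 ℕ.^ d) v) (≡.cong (ℤ._* + v) (≡.sym (2^≡ d)))))
        (≡.trans (lemma b (2^ d) (+ v)) (≡.cong (b ℤ.* + v ℤ.*_) (≡.sym (2^-suc d))))
        where
        open import Data.Integer.Tactic.RingSolver using (solve-∀)
        lemma : ∀ b p v → + 2 ℤ.* b ℤ.* (p ℤ.* v) ≡ b ℤ.* v ℤ.* (+ 2 ℤ.* p)
        lemma = solve-∀

-- Reduction of the sum to the solutions of the characteristic equation.

module TwistedSum {c ℓ₁ ℓ₂} (ℂ : ComplexField c ℓ₁ ℓ₂)
  (s t n P : ℕ) (0<n : 0 ℕ.< n) (n+t≤P : n ℕ.+ t ℕ.≤ P) (P≤n+2t+s+2 : P ℕ.≤ n ℕ.+ t ℕ.+ (2 ℕ.+ (s ℕ.+ t)))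
  (A A₁ B c₁ c₂ R′ : ℤ) (k k₁ : ℕ)
  (A≡ : A ≡ Congruence.2^ n ℤ.* A₁) (k≡ : k ≡ 2 ℕ.^ t ℕ.* k₁)
  (odd-A₁ : Congruence.Odd A₁) (odd-B : Congruence.Odd B) (odd-k₁ : Congruence.Odd (+ k₁)) (odd-c₂ : Congruence.Odd c₂)
  (R′-inverse : R (2 ℕ.+ (s ℕ.+ t) ℕ.+ n) ℤ.* R′ Congruence.≋ ℤ.1ℤ ⟨ Congruence.2^ (2 ℕ.+ (s ℕ.+ P)) ⟩)
  (χ₁ χ₂ : CharacterSums.DirichletCharacter ℂ (2 ℕ.^ (2 ℕ.+ (s ℕ.+ P))))
  (χ₁5 : ComplexField._≈_ ℂ (CharacterSums._⟨_⟩ ℂ χ₁ (+ 5)) (Exponential.E ℂ (s ℕ.+ P) c₁))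
  (χ₂5 : ComplexField._≈_ ℂ (CharacterSums._⟨_⟩ ℂ χ₂ (+ 5)) (Exponential.E ℂ (s ℕ.+ P) c₂))
  where

  open import Data.Integer.Base using (1ℤ; -1ℤ; 0ℤ)
  import Data.Integer.Properties as ℤ
  open import Data.Integer.Tactic.RingSolver using (solve-∀)
  open import Data.Bool.Base using (if_then_else_)
  open import Data.Nat.Base using (zero; suc; NonZero)
  import Data.Nat.Properties as ℕ
  import Data.Nat.Divisibility as ℕ
  open import Data.Fin.Base using (toℕ)
  open import Data.Product.Base using (_,_; proj₁; proj₂; ∃; _×_)
  open import Data.Sum.Base using (_⊎_; inj₁; inj₂)
  open import Relation.Nullary.Negation using (¬_; contradiction)
  open import Relation.Nullary.Decidable using (Dec; yes; no; does)
  open import Data.List.Base using (List; []; _∷_; foldr; map)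
  open import Data.List.Relation.Unary.AllPairs as AllPairs using (AllPairs; []; _∷_)
  open import Data.List.Relation.Unary.All using ([]; _∷_)
  open import Data.List.Relation.Unary.Any as Any using (Any; here; there)
  import Relation.Binary.PropositionalEquality as ≡
  open ComplexField ℂ renaming (_×_ to _×′_)
  open CharacterSums ℂ using (DirichletCharacter; _⟨_⟩; ∑[1⋯_]; 2#)
  open import Algebra.Bundles using (CommutativeRing)
  open import Algebra.Properties.Semiring.Sum semiring using (sum; sum-cong-≋; *-distribˡ-sum; ∑-comm; sum-replicate)
  open import Algebra.Properties.Semiring.Exp semiring using (^-congˡ; ^-congʳ)
  open import Relation.Binary.Reasoning.Setoid setoid
  open Congruence
  open Powers
  open Exponential ℂ
  open ResidueSums ℂ
  open Characters ℂ
  open Characteristic s t n P 0<n n+t≤P P≤n+2t+s+2 A A₁ B c₁ c₂ R′ k k₁ A≡ k≡ odd-A₁ odd-B odd-k₁ odd-c₂ R′-inverse public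

  g : ℤ → Carrier
  g x = χ₁ ⟨ x ⟩ * χ₂ ⟨ A ℤ.* x ℤ.^ k ℤ.+ B ⟩

  g-f : ∀ x → g x ≈ χ₁ ⟨ x ⟩ * χ₂ ⟨ f x ⟩
  g-f x = *-congˡ (χ-≡ χ₂ (≡.sym (f≡ x)))

  g-even : ∀ {x} → Even x → g x ≈ 0#
  g-even ev = trans (*-congʳ (χ-even (suc (s ℕ.+ P)) χ₁ ev)) (zeroˡ _)

  g-periodic : Periodic (2^ m) g
  g-periodic p = *-cong (χ-2^cong (suc (s ℕ.+ P)) χ₁ p) (χ-2^cong (suc (s ℕ.+ P)) χ₂ (+-congʳ≋ B (*-congˡ≋ A (^-cong≋ k p))))

  -- Covers the averaging shift and the half shift alike: when both arguments change by powers of 5,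
  -- the factor is determined by `c₁` and `c₂`.
  g-shift : ∀ x y {w₁ w₂ z} → y ≡ (+ 5) ℤ.^ w₁ → f (x ℤ.* y) ≋ f x ℤ.* (+ 5) ℤ.^ w₂ ⟨ 2^ m ⟩ →
    c₁ ℤ.* + w₁ ℤ.+ c₂ ℤ.* + w₂ ≋ z ⟨ 2^ (s ℕ.+ P) ⟩ → g (x ℤ.* y) ≈ g x * E (s ℕ.+ P) z
  g-shift x y {w₁} {w₂} {z} ≡.refl f≋ exponent = begin
    g (x ℤ.* y) ≈⟨ g-f (x ℤ.* y) ⟩
    χ₁ ⟨ x ℤ.* y ⟩ * χ₂ ⟨ f (x ℤ.* y) ⟩ ≈⟨ *-cong (χ-* χ₁ x y) (trans (χ-2^cong (suc (s ℕ.+ P)) χ₂ f≋) (χ-* χ₂ (f x) _)) ⟩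
    (χ₁ ⟨ x ⟩ * χ₁ ⟨ y ⟩) * (χ₂ ⟨ f x ⟩ * χ₂ ⟨ (+ 5) ℤ.^ w₂ ⟩) ≈⟨ *-cong (*-congˡ (χ-5^ χ₁ χ₁5 w₁)) (*-congˡ (χ-5^ χ₂ χ₂5 w₂)) ⟩
    (χ₁ ⟨ x ⟩ * a) * (χ₂ ⟨ f x ⟩ * b) ≈⟨ interchange _ _ _ _ ⟩
    (χ₁ ⟨ x ⟩ * χ₂ ⟨ f x ⟩) * (a * b) ≈⟨ *-cong (g-f x) (trans (E-cong (s ℕ.+ P) (≋-sym exponent)) (E-+ (s ℕ.+ P) _ _)) ⟨
    g x * E (s ℕ.+ P) z ∎
    where
    a = E (s ℕ.+ P) (c₁ ℤ.* + w₁)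
    b = E (s ℕ.+ P) (c₂ ℤ.* + w₂)
    open import Algebra.Properties.CommutativeSemigroup (CommutativeRing.*-commutativeSemigroup commutativeRing) using (interchange)

  opaque
    D : ℤ → ℤ
    D x = proj₁ (odd-inverse m (odd-f x))

    D-inverse : ∀ x → f x ℤ.* D x ≋ 1ℤ ⟨ 2^ m ⟩
    D-inverse x = proj₂ (odd-inverse m (odd-f x))

  odd-D : ∀ x → Odd (D x)
  odd-D x = Odd-*ʳ (f x) (D x) (mod2 (D-inverse x))

  ζ : ℤ → Carrier
  ζ x = E P (D x ℤ.* C x)

  g-ζ : ∀ x v → g (x ℤ.* 5^[2^ s * v ]) ≈ g x * ζ x ^ v
  g-ζ x v = go (shift x (D x) v (D-inverse x))
    where
    m≥ : s ℕ.+ P ℕ.≤ m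
    m≥ = ℕ.m≤n+m (s ℕ.+ P) 2
    Z = D x ℤ.* C x
    go : _ → _
    go (w , f≋ , exponent) = trans (g-shift x _ ≡.refl f≋ (lower m≥ exponent)) (*-congˡ (begin
      E (s ℕ.+ P) (2^ s ℤ.* (+ v ℤ.* Z)) ≈⟨ E-cancel s P (+ v ℤ.* Z) ⟩
      E P (+ v ℤ.* Z) ≈⟨ E-cong P (≋-reflexive (ℤ.*-comm (+ v) Z)) ⟩
      E P (Z ℤ.* + v) ≈⟨ E-^ P Z v ⟨
      ζ x ^ v ∎))

  ζ-solves : ∀ {x} → Solves x → ζ x ≈ 1#
  ζ-solves {x} Cx≋0 = trans (E-cong P (≋-trans (*-congˡ≋ (D x) Cx≋0) (≋-reflexive (ℤ.*-zeroʳ (D x))))) (E-0 P)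

  ζ-root : ∀ x → ζ x ^ (2 ℕ.^ P) ≈ 1#
  ζ-root x = trans (E-^ P _ (2 ℕ.^ P)) (trans (E-cong P (≋-trans (≋-reflexive (≡.cong (D x ℤ.* C x ℤ.*_) (≡.sym (2^≡ P)))) (multiple≋0 (D x ℤ.* C x)))) (E-0 P))

  ζ≈1⇒solves : ∀ {x} → ζ x ≈ 1# → Solves x
  ζ≈1⇒solves {x} ζ≈1 = odd-cancelˡ {C x} {0ℤ} (D x) (odd-D x)
    (≋-trans (E-primitive P ζ≈1) (≋-reflexive (≡.sym (ℤ.*-zeroʳ (D x)))))

  solves? : ∀ x → Dec (Solves x)
  solves? x = C x ≋? 0ℤ ⟨ 2^ P ⟩

  G : ℤ → Carrier
  G x = if does (solves? x) then g x else 0#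

  G-yes : ∀ {x} → Solves x → G x ≈ g x
  G-yes {x} p with solves? x
  ... | yes _ = refl
  ... | no ¬p = contradiction p ¬p

  G-no : ∀ {x} → ¬ Solves x → G x ≈ 0#
  G-no {x} ¬p with solves? x
  ... | yes p = contradiction p ¬p
  ... | no _  = refl

  G-even : ∀ {x} → Even x → G x ≈ 0#
  G-even {x} ev with solves? x
  ... | yes _ = g-even ev
  ... | no _  = refl

  S : Carrier
  S = ∑[1⋯ 2 ℕ.^ m ] g

  private instance
    2^m≢0 : NonZero (2 ℕ.^ m)
    2^m≢0 = ℕ.m^n≢0 2 m

  inverse-5 : ∀ w → ∃ λ u → (+ 5) ℤ.^ w ℤ.* u ≋ 1ℤ ⟨ 2^ m ⟩
  inverse-5 w = odd-inverse m (5-odd^ w)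

  -- Multiplication by the unit `5^[2^ s * v ]` permutes the residues modulo `2 ^ m`.
  invariant : ∀ v → S ≈ ∑[1⋯ 2 ℕ.^ m ] (λ x → g x * ζ x ^ v)
  invariant v = begin
    S ≈⟨ ∑-unit (2 ℕ.^ m) (λ p → g-periodic (to-2^ {j = m} p)) y (proj₁ (inverse-5 w)) (from-2^ {j = m} (proj₂ (inverse-5 w))) ⟨
    ∑[1⋯ 2 ℕ.^ m ] (λ x → g (y ℤ.* x)) ≈⟨ ∑-cong (2 ℕ.^ m) (λ x → trans (reflexive (≡.cong g (ℤ.*-comm y x))) (g-ζ x v)) ⟩
    ∑[1⋯ 2 ℕ.^ m ] (λ x → g x * ζ x ^ v) ∎
    where
    w = 2 ℕ.^ s ℕ.* v
    y = 5^[2^ s * v ]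

  K : ℕ
  K = 2 ℕ.^ P

  averaged : ∀ x → g x * geometric K (ζ x) ≈ (K ×′ 1#) * G x
  averaged x with solves? x
  ... | yes p = trans (*-congˡ (geometric-1 K (ζ-solves p))) (*-comm _ _)
  ... | no ¬p = trans (*-congˡ (geometric-root K (ζ x) (ζ-root x) (λ ζ≈1 → ¬p (ζ≈1⇒solves ζ≈1)))) (trans (zeroʳ _) (sym (zeroʳ _)))

  S≈∑G : S ≈ ∑[1⋯ 2 ℕ.^ m ] G
  S≈∑G = ×-cancel K {{ℕ.m^n≢0 2 P}} (begin
    (K ×′ 1#) * S ≈⟨ ×-assoc-* K 1# S ⟩
    K ×′ (1# * S) ≈⟨ ×-congʳ K (*-identityˡ S) ⟩
    K ×′ S ≈⟨ sum-replicate K {S} ⟨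
    sum {K} (λ v → S) ≈⟨ sum-cong-≋ {K} (λ v → invariant (toℕ v)) ⟩
    sum {K} (λ v → ∑[1⋯ 2 ℕ.^ m ] (λ x → g x * ζ x ^ toℕ v)) ≈⟨ ∑-comm {K} {2 ℕ.^ m} _ ⟩
    ∑[1⋯ 2 ℕ.^ m ] (λ x → sum {K} (λ v → g x * ζ x ^ toℕ v)) ≈⟨ ∑-cong (2 ℕ.^ m) (λ x → sym (*-distribˡ-sum {K} (g x) (λ v → ζ x ^ toℕ v))) ⟩
    ∑[1⋯ 2 ℕ.^ m ] (λ x → g x * geometric K (ζ x)) ≈⟨ ∑-cong (2 ℕ.^ m) averaged ⟩
    ∑[1⋯ 2 ℕ.^ m ] (λ x → (K ×′ 1#) * G x) ≈⟨ *-distribˡ-sum {2 ℕ.^ m} (K ×′ 1#) _ ⟨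
    (K ×′ 1#) * ∑[1⋯ 2 ℕ.^ m ] G ∎)
    where open import Algebra.Properties.Semiring.Mult semiring using (×-assoc-*; ×-congʳ)

  -- The quotient `y / x` is 1 modulo `2^ (2 + s)`, hence a power of `5 ^ 2 ^ s`, and at a solution
  -- the factor `ζ x` belonging to such a shift is 1.
  g-coset : ∀ {x y} → Odd x → Solves x → y ≋ x ⟨ 2^ (2 ℕ.+ s) ⟩ → g y ≈ g x
  g-coset {x} {y} odd-x p y≋x = go (odd-inverse m odd-x)
    where
    go : (∃ λ u → x ℤ.* u ≋ 1ℤ ⟨ 2^ m ⟩) → g y ≈ g x
    go (u , xu≋1) = go′ (5-generates s P uy≋1)
      where
      2+s≤m : 2 ℕ.+ s ℕ.≤ m
      2+s≤m = ℕ.+-monoʳ-≤ 2 (ℕ.m≤m+n s P)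
      uy≋1 : u ℤ.* y ≋ 1ℤ ⟨ 2^ (2 ℕ.+ s) ⟩
      uy≋1 = ≋-trans (*-congˡ≋ u y≋x) (≋-trans (≋-reflexive (ℤ.*-comm u x)) (lower 2+s≤m xu≋1))
      go′ : (∃ λ v → u ℤ.* y ≋ 5^[2^ s * v ] ⟨ 2^ (2 ℕ.+ s ℕ.+ P) ⟩) → g y ≈ g x
      go′ (v , uy≋) = begin
        g y ≈⟨ g-periodic y≋ ⟩
        g (x ℤ.* 5^[2^ s * v ]) ≈⟨ g-ζ x v ⟩
        g x * ζ x ^ v ≈⟨ *-congˡ (trans (^-congˡ v (ζ-solves p)) (1^ v)) ⟩
        g x * 1# ≈⟨ *-identityʳ _ ⟩
        g x ∎
        where
        y≋ : y ≋ x ℤ.* 5^[2^ s * v ] ⟨ 2^ m ⟩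
        y≋ = ≋-trans (≋-reflexive (≡.sym (ℤ.*-identityˡ y))) (≋-trans (*-congʳ≋ y (≋-sym xu≋1))
          (≋-trans (≋-reflexive (ℤ.*-assoc x u y)) (*-congˡ≋ x (recast (≡.cong (2 ℕ.+_) ≡.refl) uy≋))))

  G-periodic : Periodic (2^ (2 ℕ.+ s)) G
  G-periodic {x} {y} p = go (solves? y) (parity y)
    where
    go : Dec (Solves y) → Even y ⊎ Odd y → G x ≈ G y
    go (no ¬q) _         = trans (G-no (λ q → ¬q (solves-periodic (≋-sym p) q))) (sym (G-no ¬q))
    go (yes q) (inj₁ ev) = trans (G-even (≋-trans (mod2 p) ev)) (sym (G-even ev))
    go (yes q) (inj₂ od) = trans (G-yes (solves-periodic p q)) (trans (g-coset od q p) (sym (G-yes q)))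

  S-reduced : S ≈ 2# ^ P * ∑[1⋯ 2 ℕ.^ (2 ℕ.+ s) ] G
  S-reduced = begin
    S ≈⟨ S≈∑G ⟩
    ∑[1⋯ 2 ℕ.^ m ] G ≈⟨ reflexive (≡.cong (λ q → ∑[1⋯ q ] G) split) ⟩
    ∑[1⋯ 2 ℕ.^ P ℕ.* 2 ℕ.^ (2 ℕ.+ s) ] G ≈⟨ ∑-fold (2 ℕ.^ P) (2 ℕ.^ (2 ℕ.+ s)) (λ p → G-periodic (to-2^ {j = 2 ℕ.+ s} p)) ⟩
    ((2 ℕ.^ P) ×′ 1#) * ∑[1⋯ 2 ℕ.^ (2 ℕ.+ s) ] G ≈⟨ *-congʳ (2^× P) ⟩
    2# ^ P * ∑[1⋯ 2 ℕ.^ (2 ℕ.+ s) ] G ∎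
    where
    split : 2 ℕ.^ m ≡ 2 ℕ.^ P ℕ.* 2 ℕ.^ (2 ℕ.+ s)
    split = ≡.trans (≡.cong (2 ℕ.^_) (ℕ.+-comm (2 ℕ.+ s) P)) (ℕ.^-distribˡ-+-* 2 P (2 ℕ.+ s))

  S-support : ∀ {rs} → AllPairs (λ r r′ → ¬ (r ≋ r′ ⟨ 2^ (2 ℕ.+ s) ⟩)) rs →
    (∀ x → Odd x → Solves x → Any (λ r → x ≋ r ⟨ 2^ (2 ℕ.+ s) ⟩) rs) →
    S ≈ 2# ^ P * foldr _+_ 0# (map G rs)
  S-support {rs} distinct complete = trans S-reduced (*-congˡ (∑-support q {{ℕ.m^n≢0 2 (2 ℕ.+ s)}}
      (λ p → G-periodic (to-2^ {j = 2 ℕ.+ s} p)) (AllPairs.map (λ ¬p p → ¬p (to-2^ {j = 2 ℕ.+ s} p)) distinct) vanish))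
    where
    q = 2 ℕ.^ (2 ℕ.+ s)
    vanish : ∀ x → ¬ Any (λ r → x ≋ r ⟨ + q ⟩) rs → G x ≈ 0#
    vanish x ¬any = go (solves? x) (parity x)
      where
      go : Dec (Solves x) → Even x ⊎ Odd x → G x ≈ 0#
      go (no ¬p) _         = G-no ¬p
      go (yes _) (inj₁ ev) = G-even ev
      go (yes p) (inj₂ od) = contradiction (Any.map (from-2^ {j = 2 ℕ.+ s}) (complete x od p)) ¬any

  no-solution⇒S≈0 : (∀ x → Odd x → ¬ Solves x) → S ≈ 0#
  no-solution⇒S≈0 none = trans (S-support [] (λ x od p → contradiction p (none x od))) (zeroʳ _)

  1≢-1 : ∀ {i} → ¬ (1ℤ ≋ -1ℤ ⟨ 2^ (2 ℕ.+ i) ⟩)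
  1≢-1 p = ¬1≋-1[4] (mod4 p)

  odd≢neg : ∀ {i x} → Odd x → ¬ (x ≋ ℤ.- x ⟨ 2^ (2 ℕ.+ i) ⟩)
  odd≢neg {i} {x} od p = 1≢-1 (odd-cancelˡ {1ℤ} { -1ℤ} {2 ℕ.+ i} x od
    (≋-trans (≋-reflexive (ℤ.*-identityʳ x)) (≋-trans p (≋-reflexive (lemma x)))))
    where
    lemma : ∀ x → ℤ.- x ≡ x ℤ.* -1ℤ
    lemma = solve-∀

  neg-power : Even (+ k) → ∀ x → (ℤ.- x) ℤ.^ k ≡ x ℤ.^ k
  neg-power ev x = go (even-ℕ ev)
    where
    even-ℕ : Even (+ k) → ∃ λ j → k ≡ 2 ℕ.* j
    even-ℕ ev with ≡.subst (λ z → 2 ℕ.∣ ℤ.∣ z ∣) (ℤ.+-identityʳ (+ k)) (to-[mod] ev)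
    ... | ℕ.divides j eq = j , ≡.trans eq (ℕ.*-comm j 2)
    lemma : ∀ x → ℤ.- x ℤ.* (ℤ.- x ℤ.* 1ℤ) ≡ x ℤ.* (x ℤ.* 1ℤ)
    lemma = solve-∀
    go : (∃ λ j → k ≡ 2 ℕ.* j) → (ℤ.- x) ℤ.^ k ≡ x ℤ.^ k
    go (j , eq) = ≡.trans (≡.cong ((ℤ.- x) ℤ.^_) eq) (≡.trans (≡.sym (ℤ.^-*-assoc (ℤ.- x) 2 j))
      (≡.trans (≡.cong (ℤ._^ j) (lemma x)) (≡.trans (ℤ.^-*-assoc x 2 j) (≡.cong (x ℤ.^_) (≡.sym eq)))))

  neg-power-odd : Odd (+ k) → (-1ℤ) ℤ.^ k ≡ -1ℤ
  neg-power-odd od = go (odd-ℕ k od)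
    where
    go : (∃ λ j → k ≡ suc (2 ℕ.* j)) → (-1ℤ) ℤ.^ k ≡ -1ℤ
    go (j , eq) = ≡.trans (≡.cong ((-1ℤ) ℤ.^_) eq) (≡.cong (-1ℤ ℤ.*_)
      (≡.trans (≡.sym (ℤ.^-*-assoc -1ℤ 2 j)) (ℤ.^-zeroˡ j)))

  even-k : 0 ℕ.< t → Even (+ k)
  even-k 0<t = go t 0<t +k≡
    where
    go : ∀ t → 0 ℕ.< t → + k ≡ 2^ t ℤ.* + k₁ → Even (+ k)
    go (suc t) _ eq = ≋-trans (≋-reflexive (≡.trans eq (≡.trans (≡.cong (ℤ._* + k₁) (2^-suc t)) (lemma (2^ t) (+ k₁))))) (multiple≋0 (2^ t ℤ.* + k₁))
      where
      lemma : ∀ p a → + 2 ℤ.* p ℤ.* a ≡ p ℤ.* a ℤ.* + 2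
      lemma = solve-∀

  g-neg : Even (+ k) → ∀ x → g (ℤ.- x) ≈ χ₁ ⟨ -1ℤ ⟩ * g x
  g-neg ev x = trans (*-cong (χ-neg χ₁ x) (χ-≡ χ₂ (≡.cong (λ z → A ℤ.* z ℤ.+ B) (neg-power ev x)))) (*-assoc _ _ _)

  solves-neg : Even (+ k) → ∀ {x} → Solves x → Solves (ℤ.- x)
  solves-neg ev {x} p = ≋-trans (≋-reflexive (≡.trans (C-def (ℤ.- x))
    (≡.trans (≡.cong₂ (λ a b → c₁ ℤ.* a ℤ.+ c₂ ℤ.* A ℤ.* + k ℤ.* b ℤ.* R N ℤ.* R′) f-neg (neg-power ev x)) (≡.sym (C-def x))))) p
    where
    f-neg : f (ℤ.- x) ≡ f x
    f-neg = ≡.trans (f≡ (ℤ.- x)) (≡.trans (≡.cong (λ z → A ℤ.* z ℤ.+ B) (neg-power ev x)) (≡.sym (f≡ x)))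

  -- For even `k` replacing `x` by `- x` multiplies every term, and therefore `S`, by `χ₁(-1)`.
  S≉0⇒χ₁[-1]≈1 : Even (+ k) → ¬ S ≈ 0# → χ₁ ⟨ -1ℤ ⟩ ≈ 1#
  S≉0⇒χ₁[-1]≈1 ev S≉0 = ≈-stable (λ χ≉1 → S≉0 (fixed⇒0 (begin
    χ₁ ⟨ -1ℤ ⟩ * S ≈⟨ *-distribˡ-sum {2 ℕ.^ m} (χ₁ ⟨ -1ℤ ⟩) (λ i → g (+ suc (toℕ i))) ⟩
    ∑[1⋯ 2 ℕ.^ m ] (λ x → χ₁ ⟨ -1ℤ ⟩ * g x) ≈⟨ ∑-cong (2 ℕ.^ m) (λ x → g-neg ev x) ⟨
    ∑[1⋯ 2 ℕ.^ m ] (λ x → g (ℤ.- x)) ≈⟨ ∑-cong (2 ℕ.^ m) (λ x → reflexive (≡.cong g (≡.sym (ℤ.-1*i≡-i x)))) ⟩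
    ∑[1⋯ 2 ℕ.^ m ] (λ x → g (-1ℤ ℤ.* x)) ≈⟨ ∑-unit (2 ℕ.^ m) (λ p → g-periodic (to-2^ {j = m} p)) -1ℤ -1ℤ ≋-refl ⟩
    S ∎) χ≉1))

  g-1 : g 1ℤ ≈ χ₂ ⟨ A ℤ.+ B ⟩
  g-1 = trans (*-cong (χ-1 χ₁) (χ-≡ χ₂ (≡.cong (ℤ._+ B) (≡.trans (≡.cong (A ℤ.*_) (ℤ.^-zeroˡ k)) (ℤ.*-identityʳ A))))) (*-identityˡ _)

  g₋₁-even : Even (+ k) → χ₁ ⟨ -1ℤ ⟩ ≈ 1# → g -1ℤ ≈ χ₂ ⟨ A ℤ.+ B ⟩
  g₋₁-even ev χ≈1 = trans (g-neg ev 1ℤ) (trans (*-congʳ χ≈1) (trans (*-identityˡ _) g-1))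

  g₋₁-odd : Odd (+ k) → g -1ℤ ≈ χ₁ ⟨ -1ℤ ⟩ * χ₂ ⟨ ℤ.- A ℤ.+ B ⟩
  g₋₁-odd od = *-congˡ (χ-≡ χ₂ (≡.cong (ℤ._+ B) (≡.trans (≡.cong (A ℤ.*_) (neg-power-odd od)) (lemma A))))
    where
    lemma : ∀ a → a ℤ.* -1ℤ ≡ ℤ.- a
    lemma = solve-∀

  double : ∀ x → 2# ^ P * (x + x) ≈ 2# ^ suc P * x
  double x = trans (*-congˡ (trans (+-cong (sym (*-identityˡ x)) (sym (*-identityˡ x))) (sym (distribʳ x 1# 1#))))
    (trans (sym (*-assoc _ _ _)) (*-congʳ (*-comm _ _)))

  -- For `s = 0` solutions count modulo 4, where 1 and -1 are the only odd classes.
  two-classes : s ≡ 0 → S ≈ 2# ^ P * (G 1ℤ + G -1ℤ)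
  two-classes s≡0 = trans (S-support ((1≢-1 ∷ []) ∷ [] ∷ []) (λ x od _ → complete (odd-mod4 od)))
      (*-congˡ (+-congˡ (+-identityʳ _)))
    where
    complete : ∀ {x} → x ≋ 1ℤ ⟨ + 4 ⟩ ⊎ x ≋ -1ℤ ⟨ + 4 ⟩ → Any (λ r → x ≋ r ⟨ 2^ (2 ℕ.+ s) ⟩) (1ℤ ∷ -1ℤ ∷ [])
    complete (inj₁ p) = here (recast (≡.cong (2 ℕ.+_) (≡.sym s≡0)) (mod2^2 p))
    complete (inj₂ p) = there (here (recast (≡.cong (2 ℕ.+_) (≡.sym s≡0)) (mod2^2 p)))

  -- The characteristic equation determines the k-th powers of its solutions modulo 2 ^ L.
  module Large (L i : ℕ) (P≡ : P ≡ n ℕ.+ t ℕ.+ L) (L≡ : L ≡ 2 ℕ.+ i ℕ.+ t)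
    (c₃ : ℤ) (c₁≡ : c₁ ≡ 2^ (n ℕ.+ t) ℤ.* c₃) (χ₁[-1]≈1 : Even (+ k) → χ₁ ⟨ -1ℤ ⟩ ≈ 1#)
    {x₀ : ℤ} (odd-x₀ : Odd x₀) (solves-x₀ : Solves x₀) where

    powers : ∀ {x y} → x ≋ y ⟨ 2^ (2 ℕ.+ i) ⟩ → x ℤ.^ k ≋ y ℤ.^ k ⟨ 2^ L ⟩
    powers {x} {y} p = recast (≡.sym L≡) (≡.subst (λ j → x ℤ.^ j ≋ y ℤ.^ j ⟨ 2^ (2 ℕ.+ i ℕ.+ t) ⟩) (≡.sym k≡) (^-lift t k₁ (suc i) p))

    solutions : ∀ x → Odd x → Solves x → x ≋ x₀ ⟨ 2^ (2 ℕ.+ i) ⟩ ⊎ (0 ℕ.< t × x ≋ ℤ.- x₀ ⟨ 2^ (2 ℕ.+ i) ⟩)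
    solutions x od p = ^-injective t k₁ i odd-k₁ od odd-x₀
      (≡.subst (λ j → x ℤ.^ j ≋ x₀ ℤ.^ j ⟨ 2^ (2 ℕ.+ i ℕ.+ t) ⟩) k≡ (recast L≡ (equal-powers c₃ c₁≡ L P≡ x x₀ p solves-x₀)))

    G-neg : 0 ℕ.< t → ∀ {x} → Solves x → G (ℤ.- x) ≈ g x
    G-neg 0<t {x} p = trans (G-yes (solves-neg (even-k 0<t) p)) (trans (g-neg (even-k 0<t) x)
      (trans (*-congʳ (χ₁[-1]≈1 (even-k 0<t))) (*-identityˡ _)))

    -- The solutions form the class of `x₀`, joined by that of `- x₀` when `t > 0`; with equal
    -- contributions of the two this gives the exponent `1 ⊓ t`.
    S-even : i ≡ s → S ≈ 2# ^ (P ℕ.+ (1 ℕ.⊓ t)) * g x₀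
    S-even i≡s = go t ≡.refl
      where
      go : ∀ t′ → t ≡ t′ → S ≈ 2# ^ (P ℕ.+ (1 ℕ.⊓ t′)) * g x₀
      go zero eq = begin
        S ≈⟨ S-support ([] ∷ []) complete ⟩
        2# ^ P * (G x₀ + 0#) ≈⟨ *-cong (^-congʳ 2# (≡.sym (ℕ.+-identityʳ P))) (trans (+-identityʳ _) (G-yes solves-x₀)) ⟩
        2# ^ (P ℕ.+ 0) * g x₀ ∎
        where
        complete : ∀ x → Odd x → Solves x → Any (λ r → x ≋ r ⟨ 2^ (2 ℕ.+ s) ⟩) (x₀ ∷ [])
        complete x od p = pick (solutions x od p)
          where
          pick : _ → _
          pick (inj₁ q) = here (recast (≡.cong (2 ℕ.+_) i≡s) q)
          pick (inj₂ (0<t , _)) = contradiction (≡.subst (0 ℕ.<_) eq 0<t) λ ()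
      go (suc t′) eq = begin
        S ≈⟨ S-support ((odd≢neg odd-x₀ ∷ []) ∷ [] ∷ []) complete ⟩
        2# ^ P * (G x₀ + (G (ℤ.- x₀) + 0#)) ≈⟨ *-congˡ (+-cong (G-yes solves-x₀) (trans (+-identityʳ _) (G-neg 0<t solves-x₀))) ⟩
        2# ^ P * (g x₀ + g x₀) ≈⟨ double (g x₀) ⟩
        2# ^ suc P * g x₀ ≈⟨ *-congʳ (^-congʳ 2# (ℕ.+-comm 1 P)) ⟩
        2# ^ (P ℕ.+ 1) * g x₀ ∎
        where
        0<t : 0 ℕ.< t
        0<t = ≡.subst (0 ℕ.<_) (≡.sym eq) (ℕ.s≤s ℕ.z≤n)
        complete : ∀ x → Odd x → Solves x → Any (λ r → x ≋ r ⟨ 2^ (2 ℕ.+ s) ⟩) (x₀ ∷ (ℤ.- x₀) ∷ [])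
        complete x od p = pick (solutions x od p)
          where
          pick : _ → _
          pick (inj₁ q) = here (recast (≡.cong (2 ℕ.+_) i≡s) q)
          pick (inj₂ (_ , q)) = there (here (recast (≡.cong (2 ℕ.+_) i≡s) q))

    module _ (s≡ : s ≡ suc i) where

      -- A class modulo `2^ (2 + i)` consists of two classes modulo `2^ (2 + s)`, and multiplication
      -- by `η` passes from one to the other, as `R (2 + i)` is odd.
      η x₁ : ℤ
      η = (+ 5) ℤ.^ (2 ℕ.^ i)
      x₁ = x₀ ℤ.* η

      private
        r = R (2 ℕ.+ i)

        η-odd-multiple : ∀ y → y ℤ.* η ≡ y ℤ.+ y ℤ.* r ℤ.* 2^ (2 ℕ.+ i)
        η-odd-multiple y = ≡.trans (≡.cong (y ℤ.*_) (5^2^≡1+R i)) (lemma y r (2^ (2 ℕ.+ i)))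
          where
          lemma : ∀ y r p → y ℤ.* (1ℤ ℤ.+ r ℤ.* p) ≡ y ℤ.+ y ℤ.* r ℤ.* p
          lemma = solve-∀

      x₁≋x₀ : x₁ ≋ x₀ ⟨ 2^ (2 ℕ.+ i) ⟩
      x₁≋x₀ = by (x₀ ℤ.* r) (η-odd-multiple x₀)

      solves-x₁ : Solves x₁
      solves-x₁ = solves-by-power c₃ c₁≡ L P≡ x₁ x₀ (powers x₁≋x₀) solves-x₀

      x₀≢x₁ : ¬ (x₀ ≋ x₁ ⟨ 2^ (2 ℕ.+ s) ⟩)
      x₀≢x₁ p = Even⇒¬Odd even-xr (Odd-* odd-x₀ (R-odd i))
        where
        xr = x₀ ℤ.* r
        even-xr : Even xr
        even-xr = mod2 (unscale-2^ {xr} {0ℤ} (2 ℕ.+ i) {1} (recast (≡.trans (≡.cong (2 ℕ.+_) s≡) (ℕ.+-comm 1 (2 ℕ.+ i)))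
          (≋-trans (≋-reflexive (≡.trans (lemma (2^ (2 ℕ.+ i)) xr x₀) (≡.cong (λ z → z ℤ.+ ℤ.- x₀) (≡.sym (η-odd-multiple x₀)))))
            (≋-trans (+-congʳ≋ (ℤ.- x₀) (≋-sym p)) (≋-reflexive (≡.trans (ℤ.+-inverseʳ x₀) (≡.sym (ℤ.*-zeroʳ (2^ (2 ℕ.+ i))))))))))
          where
          lemma : ∀ p z x → p ℤ.* z ≡ x ℤ.+ z ℤ.* p ℤ.+ ℤ.- x
          lemma = solve-∀

      dichotomy : ∀ {x y} → Odd y → x ≋ y ⟨ 2^ (2 ℕ.+ i) ⟩ → x ≋ y ⟨ 2^ (2 ℕ.+ s) ⟩ ⊎ x ≋ y ℤ.* η ⟨ 2^ (2 ℕ.+ s) ⟩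
      dichotomy {x} {y} odd-y (by z eq) = pick (parity z)
        where
        q = 2^ (2 ℕ.+ i)
        lift : ∀ {a b} → a ≋ b ⟨ + 2 ⟩ → y ℤ.+ a ℤ.* q ≋ y ℤ.+ b ℤ.* q ⟨ 2^ (2 ℕ.+ s) ⟩
        lift {a} {b} p = +-congˡ≋ y (≋-trans (≋-reflexive (ℤ.*-comm a q)) (≋-trans
          (recast (≡.trans (ℕ.+-comm (2 ℕ.+ i) 1) (≡.cong (2 ℕ.+_) (≡.sym s≡))) (scale-2^ (2 ℕ.+ i) (mod2^1 p)))
          (≋-reflexive (ℤ.*-comm q b))))
        pick : Even z ⊎ Odd z → _
        pick (inj₁ ev) = inj₁ (≋-trans (≋-reflexive eq) (≋-trans (lift ev) (≋-reflexive (ℤ.+-identityʳ y))))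
        pick (inj₂ od) = inj₂ (≋-trans (≋-reflexive eq) (≋-trans
          (lift (≋-trans od (≋-sym (Odd-* odd-y (R-odd i))))) (≋-reflexive (≡.sym (η-odd-multiple y)))))

      S-odd : S ≈ 2# ^ (P ℕ.+ (1 ℕ.⊓ t)) * (g x₀ + g x₁)
      S-odd = go t ≡.refl
        where
        neg-η : ∀ {x} → x ≋ ℤ.- x₀ ℤ.* η ⟨ 2^ (2 ℕ.+ s) ⟩ → x ≋ ℤ.- x₁ ⟨ 2^ (2 ℕ.+ s) ⟩
        neg-η q = ≋-trans q (≋-reflexive (≡.sym (ℤ.neg-distribˡ-* x₀ η)))
        go : ∀ t′ → t ≡ t′ → S ≈ 2# ^ (P ℕ.+ (1 ℕ.⊓ t′)) * (g x₀ + g x₁)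
        go zero eq = begin
          S ≈⟨ S-support ((x₀≢x₁ ∷ []) ∷ [] ∷ []) complete ⟩
          2# ^ P * (G x₀ + (G x₁ + 0#)) ≈⟨ *-cong (^-congʳ 2# (≡.sym (ℕ.+-identityʳ P))) (+-cong (G-yes solves-x₀) (trans (+-identityʳ _) (G-yes solves-x₁))) ⟩
          2# ^ (P ℕ.+ 0) * (g x₀ + g x₁) ∎
          where
          complete : ∀ x → Odd x → Solves x → Any (λ r → x ≋ r ⟨ 2^ (2 ℕ.+ s) ⟩) (x₀ ∷ x₁ ∷ [])
          complete x od p = pick (solutions x od p)
            where
            pick′ : _ ⊎ _ → _
            pick′ (inj₁ q) = here q
            pick′ (inj₂ q) = there (here q)
            pick : _ → _
            pick (inj₁ q) = pick′ (dichotomy odd-x₀ q)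
            pick (inj₂ (0<t , _)) = contradiction (≡.subst (0 ℕ.<_) eq 0<t) λ ()
        go (suc t′) eq = begin
          S ≈⟨ S-support distinct complete ⟩
          2# ^ P * (G x₀ + (G x₁ + (G (ℤ.- x₀) + (G (ℤ.- x₁) + 0#))))
            ≈⟨ *-congˡ (+-cong (G-yes solves-x₀) (+-cong (G-yes solves-x₁) (+-cong (G-neg 0<t solves-x₀) (trans (+-identityʳ _) (G-neg 0<t solves-x₁))))) ⟩
          2# ^ P * (g x₀ + (g x₁ + (g x₀ + g x₁))) ≈⟨ *-congˡ (+-assoc _ _ _) ⟨
          2# ^ P * ((g x₀ + g x₁) + (g x₀ + g x₁)) ≈⟨ double (g x₀ + g x₁) ⟩
          2# ^ suc P * (g x₀ + g x₁) ≈⟨ *-congʳ (^-congʳ 2# (ℕ.+-comm 1 P)) ⟩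
          2# ^ (P ℕ.+ 1) * (g x₀ + g x₁) ∎
          where
          0<t : 0 ℕ.< t
          0<t = ≡.subst (0 ℕ.<_) (≡.sym eq) (ℕ.s≤s ℕ.z≤n)
          coarse : ∀ {a b} → a ≋ b ⟨ 2^ (2 ℕ.+ s) ⟩ → a ≋ b ⟨ 2^ (2 ℕ.+ i) ⟩
          coarse = lower (ℕ.+-monoʳ-≤ 2 (ℕ.≤-trans (ℕ.n≤1+n i) (ℕ.≤-reflexive (≡.sym s≡))))
          opposite : ∀ {a b} → a ≋ x₀ ⟨ 2^ (2 ℕ.+ i) ⟩ → b ≋ x₀ ⟨ 2^ (2 ℕ.+ i) ⟩ → ¬ (a ≋ ℤ.- b ⟨ 2^ (2 ℕ.+ s) ⟩)
          opposite p q r = odd≢neg odd-x₀ (≋-trans (≋-sym p) (≋-trans (coarse r) (-‿cong≋ q)))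
          distinct : AllPairs (λ r r′ → ¬ (r ≋ r′ ⟨ 2^ (2 ℕ.+ s) ⟩)) (x₀ ∷ x₁ ∷ (ℤ.- x₀) ∷ (ℤ.- x₁) ∷ [])
          distinct = (x₀≢x₁ ∷ opposite ≋-refl ≋-refl ∷ opposite ≋-refl x₁≋x₀ ∷ [])
            ∷ (opposite x₁≋x₀ ≋-refl ∷ opposite x₁≋x₀ x₁≋x₀ ∷ [])
            ∷ ((λ p → x₀≢x₁ (≋-trans (≋-reflexive (≡.sym (ℤ.neg-involutive x₀))) (≋-trans (-‿cong≋ p) (≋-reflexive (ℤ.neg-involutive x₁))))) ∷ [])
            ∷ [] ∷ []
          complete : ∀ x → Odd x → Solves x → Any (λ r → x ≋ r ⟨ 2^ (2 ℕ.+ s) ⟩) (x₀ ∷ x₁ ∷ (ℤ.- x₀) ∷ (ℤ.- x₁) ∷ [])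
          complete x od p = pick (solutions x od p)
            where
            pick′ : _ ⊎ _ → _
            pick′ (inj₁ q) = here q
            pick′ (inj₂ q) = there (here q)
            pick″ : _ ⊎ _ → _
            pick″ (inj₁ q) = there (there (here q))
            pick″ (inj₂ q) = there (there (there (here (neg-η q))))
            pick : _ → _
            pick (inj₁ q) = pick′ (dichotomy odd-x₀ q)
            pick (inj₂ (_ , q)) = pick″ (dichotomy (Odd-neg odd-x₀) q)

-- The conclusion of the theorem with its clauses named.

module Conclusion {c ℓ₁ ℓ₂} (ℂ : ComplexField c ℓ₁ ℓ₂)
  (m : ℕ) (χ₁ χ₂ : CharacterSums.DirichletCharacter ℂ (2 ℕ.^ m))
  (A B : ℤ) (k k₁ n t : ℕ) (c₁ c₂ R′ : ℤ) where

  open import Data.Integer.Divisibility using (_∣_)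
  open import Data.Nat.Base using (_+_; _*_; _∸_; _^_; _≤_; _<_; _⊓_; ⌊_/2⌋)
  open import Data.Product.Base using (_×_; ∃)
  open import Data.Sum.Base using (_⊎_)
  open import Relation.Nullary.Negation using (¬_)
  open import Defs using (_≡_[mod_]; N)
  open CharacterSums ℂ

  f : ℤ → ℤ
  f x = A ℤ.* x ℤ.^ k ℤ.+ B

  S : Carrier
  S = ∑[1⋯ 2 ^ m ] (λ x → χ₁ ⟨ x ⟩ *ᶜ χ₂ ⟨ f x ⟩)

  C : ℤ → ℤ
  C x = c₁ ℤ.* f x ℤ.+ c₂ ℤ.* A ℤ.* + k ℤ.* x ℤ.^ k ℤ.* R (N m n t) ℤ.* R′

  M : ℕ
  M = 2 ^ (⌊ m + n /2⌋ + t)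

  Solution : ℤ → Set
  Solution x₀ = ¬ (+ 2 ∣ x₀ ℤ.* f x₀) × C x₀ ≡ ℤ.0ℤ [mod M ]

  Form : ℤ → Set
  Form c₃ = (c₁ ≡ + (2 ^ (n + t)) ℤ.* c₃) × ¬ (+ 2 ∣ c₃)

  kEven kOdd Large : Set
  kEven = + 2 ∣ + k
  kOdd  = ¬ (+ 2 ∣ + k)
  Large = 2 * t + 4 < m ∸ n

  Conditions : Set ℓ₁
  Conditions = ∃ Form × (kEven → χ₁ ⟨ ℤ.-1ℤ ⟩ ≈ 1#) × (Large → ∃ Solution)

  h : ℤ → ℤ → ℤ
  h c₃ l = + 2 ℤ.* l ℤ.+ (+ k₁ ℤ.- ℤ.1ℤ) ℤ.+ (+ (2 ^ n) ℤ.- ℤ.1ℤ) ℤ.* c₃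

  -- A power of `√2` with doubled exponent, because `(m + n) / 2` is half-integral when `m - n` is
  -- odd.
  V : ℤ → Carrier
  V x₀ = √2 ^ᶜ (m + n + 2 * (t + (1 ⊓ t))) *ᶜ χ₁ ⟨ x₀ ⟩ *ᶜ χ₂ ⟨ f x₀ ⟩

  CaseI : ℤ → Set ℓ₁
  CaseI c₃ = Large → ∀ (x₀ l : ℤ) → Solution x₀ → C x₀ ≡ l ℤ.* + M →
    (+ 2 ∣ + (m ∸ n) → S ≈ V x₀) ×
    (¬ (+ 2 ∣ + (m ∸ n)) → S ≈ V x₀ *ᶜ (ω^ h c₃ l *ᶜ fromℤ (jacobi (+ 2) (h c₃ l))))

  P₁ P₂ P₃ : Set
  P₁ = kEven × C ℤ.1ℤ ≡ ℤ.0ℤ [mod 2 ^ (m ∸ 2) ]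
  P₂ = kOdd × C ℤ.1ℤ ≡ ℤ.0ℤ [mod 2 ^ (m ∸ 2) ]
  P₃ = kOdd × C ℤ.-1ℤ ≡ ℤ.0ℤ [mod 2 ^ (m ∸ 2) ]

  CaseII : Set ℓ₁
  CaseII = t + 3 < m ∸ n → m ∸ n ≤ 2 * t + 4 →
    (P₁ → S ≈ 2# ^ᶜ (m ∸ 1) *ᶜ χ₂ ⟨ A ℤ.+ B ⟩) ×
    (P₂ → S ≈ 2# ^ᶜ (m ∸ 2) *ᶜ χ₂ ⟨ A ℤ.+ B ⟩) ×
    (P₃ → S ≈ 2# ^ᶜ (m ∸ 2) *ᶜ χ₁ ⟨ ℤ.-1ℤ ⟩ *ᶜ χ₂ ⟨ ℤ.- A ℤ.+ B ⟩) ×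
    (¬ (P₁ ⊎ P₂ ⊎ P₃) → S ≈ 0#)

  Q₁ Q₂ χ₁[5]=±1 : Set ℓ₁
  χ₁[5]=±1 = χ₁ ⟨ + 5 ⟩ ≈ 1# ⊎ χ₁ ⟨ + 5 ⟩ ≈ -ᶜ 1#
  Q₁ = kEven × χ₁[5]=±1 × χ₁ ⟨ ℤ.-1ℤ ⟩ ≈ 1#
  Q₂ = kOdd × χ₁[5]=±1

  CaseIII : Set ℓ₁
  CaseIII = m ∸ n ≡ t + 3 →
    (Q₁ → S ≈ 2# ^ᶜ (m ∸ 1) *ᶜ χ₂ ⟨ A ℤ.+ B ⟩) ×
    (Q₂ → S ≈ 2# ^ᶜ (m ∸ 2) *ᶜ (χ₂ ⟨ A ℤ.+ B ⟩ +ᶜ χ₁ ⟨ ℤ.-1ℤ ⟩ *ᶜ χ₂ ⟨ ℤ.- A ℤ.+ B ⟩)) ×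
    (¬ (Q₁ ⊎ Q₂) → S ≈ 0#)

  T : Set ℓ₁
  T = (kEven × (χ₁ ⟨_⟩) ≐ principal (2 ^ m)) ⊎ (kOdd × (χ₁ ⟨_⟩) ≐ χ₄)

  CaseIV : Set ℓ₁
  CaseIV = m ∸ n ≡ t + 2 →
    (T → S ≈ 2# ^ᶜ (m ∸ 1) *ᶜ χ₂ ⟨ A ℤ.+ B ⟩) ×
    (¬ T → S ≈ 0#)

  -- Unfolds definitionally to the conclusion of `theorem1p1`, so that the ranges of `m - n` can be
  -- treated separately without restating it.
  Result : Set ℓ₁
  Result = (¬ Conditions → S ≈ 0#) ×
    (∀ c₃ → Form c₃ → (kEven → χ₁ ⟨ ℤ.-1ℤ ⟩ ≈ 1#) → (Large → ∃ Solution) →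
     CaseI c₃ × CaseII × CaseIII × CaseIV)

import Defs
open import Defs using (_≡_[mod_])
open import Data.Integer.Divisibility using (_∣_)
open import Data.Nat.Base using (⌊_/2⌋)
open import Data.Nat.Properties as ℕ using (m^n≢0)
open import Relation.Nullary.Negation using (¬_)

-- Evaluation of the sum in the separate ranges of m - n.

module Proof {c ℓ₁ ℓ₂} (ℂ : ComplexField c ℓ₁ ℓ₂) (s t n P : ℕ) (0<n : 0 ℕ.< n)
  (n+t≤P : n ℕ.+ t ℕ.≤ P) (P≤n+2t+s+2 : P ℕ.≤ n ℕ.+ t ℕ.+ (2 ℕ.+ (s ℕ.+ t)))
  (N≡ : Defs.N (2 ℕ.+ (s ℕ.+ P)) n t ≡ 2 ℕ.+ (s ℕ.+ t))
  (χ₁ χ₂ : CharacterSums.DirichletCharacter ℂ (2 ℕ.^ (2 ℕ.+ (s ℕ.+ P))))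
  (primitive-χ₂ : CharacterSums.Primitive ℂ χ₂)
  (A A₁ B : ℤ) (k k₁ : ℕ) (A≡ : A ≡ + (2 ℕ.^ n) ℤ.* A₁) (k≡ : k ≡ 2 ℕ.^ t ℕ.* k₁)
  (2∤ : ¬ (+ 2 ∣ A₁ ℤ.* + k₁ ℤ.* B)) (c₁ c₂ : ℤ)
  (χ₁5 : ComplexField._≈_ ℂ (CharacterSums._⟨_⟩ ℂ χ₁ (+ 5)) (CharacterSums.e ℂ (2 ℕ.^ (s ℕ.+ P)) {{m^n≢0 2 (s ℕ.+ P)}} c₁))
  (χ₂5 : ComplexField._≈_ ℂ (CharacterSums._⟨_⟩ ℂ χ₂ (+ 5)) (CharacterSums.e ℂ (2 ℕ.^ (s ℕ.+ P)) {{m^n≢0 2 (s ℕ.+ P)}} c₂))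
  (R′ : ℤ) (R′-inverse : R (Defs.N (2 ℕ.+ (s ℕ.+ P)) n t ℕ.+ n) ℤ.* R′ ≡ ℤ.1ℤ [mod 2 ℕ.^ (2 ℕ.+ (s ℕ.+ P)) ])
  where

  open import Data.Integer.Base using (1ℤ; -1ℤ; 0ℤ)
  import Data.Integer.Properties as ℤ
  open import Data.Integer.Tactic.RingSolver using (solve-∀)
  open import Data.Nat.Base using (zero; suc)
  import Data.Nat.Properties as ℕ
  import Data.Nat.Divisibility as ℕ
  import Data.Nat.Tactic.RingSolver as ℕSolver
  import Data.Integer.DivMod as DivMod
  open import Data.Integer.Coprimality using (Coprime; coprime?)
  open import Data.Product.Base using (_,_; proj₁; proj₂; ∃; _×_)
  open import Data.Sum.Base using (_⊎_; inj₁; inj₂; [_,_]′)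
  open import Relation.Nullary.Negation using (contradiction)
  open import Relation.Nullary.Decidable using (Dec; yes; no; does)
  open import Data.Bool.Base using (if_then_else_)
  import Relation.Binary.PropositionalEquality as ≡
  open ComplexField ℂ renaming (_×_ to _×′_)
  open CharacterSums ℂ using (_⟨_⟩; 2#; √2; principal; χ₄; DirichletCharacter; e; fromℤ; _≐_)
  open import Algebra.Bundles using (CommutativeRing)
  open import Algebra.Properties.Ring (CommutativeRing.ring commutativeRing)
  open import Algebra.Properties.Semiring.Exp semiring using (^-congˡ; ^-congʳ; ^-assocʳ)
  open import Relation.Binary.Reasoning.Setoid setoid
  open Congruence
  open Powers
  open Exponential ℂ
  open Characters ℂ

  private
    ∤⇒Odd : ∀ {x} → ¬ (+ 2 ∣ x) → Odd x
    ∤⇒Odd ∤ = ¬Even⇒Odd (λ ev → ∤ (Even⇒∣ ev))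

    Odd⇒∤ : ∀ {x} → Odd x → ¬ (+ 2 ∣ x)
    Odd⇒∤ od ∣ = Even⇒¬Odd (∣⇒Even ∣) od

    odd-A₁k₁B : Odd (A₁ ℤ.* + k₁ ℤ.* B)
    odd-A₁k₁B = ∤⇒Odd 2∤

    0<s+P : 0 ℕ.< s ℕ.+ P
    0<s+P = ℕ.≤-trans 0<n (ℕ.≤-trans (ℕ.m≤m+n n t) (ℕ.≤-trans n+t≤P (ℕ.m≤n+m P s)))

    E-χ₂5 : χ₂ ⟨ + 5 ⟩ ≈ E (s ℕ.+ P) c₂
    E-χ₂5 = trans χ₂5 (sym (E≡ (s ℕ.+ P) c₂))

    R′-inverse′ : R (2 ℕ.+ (s ℕ.+ t) ℕ.+ n) ℤ.* R′ ≋ 1ℤ ⟨ 2^ (2 ℕ.+ (s ℕ.+ P)) ⟩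
    R′-inverse′ = ≡.subst₂ (λ N q → R (N ℕ.+ n) ℤ.* R′ ≋ 1ℤ ⟨ q ⟩) N≡ (≡.sym (2^≡ _)) (from-[mod] R′-inverse)

  open TwistedSum ℂ s t n P 0<n n+t≤P P≤n+2t+s+2 A A₁ B c₁ c₂ R′ k k₁
    (≡.trans A≡ (≡.cong (ℤ._* A₁) (≡.sym (2^≡ n)))) k≡
    (Odd-*ˡ A₁ (+ k₁) (Odd-*ˡ (A₁ ℤ.* + k₁) B odd-A₁k₁B)) (Odd-*ʳ (A₁ ℤ.* + k₁) B odd-A₁k₁B)
    (Odd-*ʳ A₁ (+ k₁) (Odd-*ˡ (A₁ ℤ.* + k₁) B odd-A₁k₁B)) (primitive⇒odd 0<s+P χ₂ primitive-χ₂ E-χ₂5)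
    R′-inverse′ χ₁ χ₂ (trans χ₁5 (sym (E≡ (s ℕ.+ P) c₁))) E-χ₂5
  open Conclusion ℂ m χ₁ χ₂ A B k k₁ n t c₁ c₂ R′ hiding (f; C; S; M; P₁; P₂; P₃; Q₁; Q₂; T)
  private
    module Con = Conclusion ℂ m χ₁ χ₂ A B k k₁ n t c₁ c₂ R′

    odd-A₁ : Odd A₁
    odd-A₁ = Odd-*ˡ A₁ (+ k₁) (Odd-*ˡ (A₁ ℤ.* + k₁) B odd-A₁k₁B)

    odd-k₁ : Odd (+ k₁)
    odd-k₁ = Odd-*ʳ A₁ (+ k₁) (Odd-*ˡ (A₁ ℤ.* + k₁) B odd-A₁k₁B)

    odd-c₂ : Odd c₂
    odd-c₂ = primitive⇒odd 0<s+P χ₂ primitive-χ₂ E-χ₂5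

    E-χ₁5 : χ₁ ⟨ + 5 ⟩ ≈ E (s ℕ.+ P) c₁
    E-χ₁5 = trans χ₁5 (sym (E≡ (s ℕ.+ P) c₁))

    C-agrees : ∀ x → Con.C x ≡ C x
    C-agrees x = ≡.sym (≡.trans (C-def x) (≡.cong₂ (λ z N → c₁ ℤ.* z ℤ.+ c₂ ℤ.* A ℤ.* + k ℤ.* x ℤ.^ k ℤ.* R N ℤ.* R′) (f≡ x) (≡.sym N≡)))

    to-solves : ∀ {j x} → j ≡ P → Con.C x ≡ 0ℤ [mod 2 ℕ.^ j ] → Solves x
    to-solves {j} {x} ≡.refl p = ≡.subst₂ (λ z q → z ≋ 0ℤ ⟨ q ⟩) (C-agrees x) (≡.sym (2^≡ j)) (from-[mod] p)

    from-solves : ∀ {j x} → j ≡ P → Solves x → Con.C x ≡ 0ℤ [mod 2 ℕ.^ j ]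
    from-solves {j} {x} ≡.refl p = to-[mod] (≡.subst₂ (λ z q → z ≋ 0ℤ ⟨ q ⟩) (≡.sym (C-agrees x)) (2^≡ j) p)

    to-form : ∀ {c₃} → Form c₃ → (c₁ ≡ 2^ (n ℕ.+ t) ℤ.* c₃) × Odd c₃
    to-form {c₃} (eq , ∤) = ≡.trans eq (≡.cong (ℤ._* c₃) (≡.sym (2^≡ (n ℕ.+ t)))) , ∤⇒Odd ∤

    from-form : ∀ {c₃} → c₁ ≡ 2^ (n ℕ.+ t) ℤ.* c₃ → Odd c₃ → Form c₃
    from-form {c₃} eq od = ≡.trans eq (≡.cong (ℤ._* c₃) (2^≡ (n ℕ.+ t))) , Odd⇒∤ od

    odd-solution : ∀ {x} → Solution x → Odd x
    odd-solution {x} (∤ , _) = Odd-*ˡ x (Con.f x) (∤⇒Odd ∤)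

    -- Assuming `¬ S ≈ 0#`, one odd solution `x` would supply all of `Conditions`: the shape of
    -- `c₁`, the sign of `χ₁(-1)`, and itself as the required solution. So there is none, and the
    -- sum over solutions is empty.
    vanishing : (∀ {x} → Odd x → Solves x → ∃ Form) → (Large → ⌊ m ℕ.+ n /2⌋ ℕ.+ t ≡ P) → ¬ Conditions → S ≈ 0#
    vanishing form M≡ ¬conditions = ≈-stable (λ S≉0 → S≉0 (no-solution⇒S≈0 (λ x od p →
      ¬conditions (form od p , (λ ev → S≉0⇒χ₁[-1]≈1 (∣⇒Even ev) S≉0) ,
        (λ large → x , Odd⇒∤ (Odd-* od (≡.subst Odd (f≡ x) (odd-f x))) , from-solves (M≡ large) p)))))

    form-below : n ℕ.+ t ℕ.< P → ∀ {x} → Odd x → Solves x → ∃ Form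
    form-below n+t<P od p = go (solves⇒c₁ p)
      where
      go : (∃ λ c₃ → c₁ ≡ 2^ (n ℕ.+ t) ℤ.* c₃) → ∃ Form
      go (c₃ , eq) = c₃ , from-form eq (odd-c₃ c₃ eq n+t<P od p)

    √2^2* : ∀ a → √2 ^ (2 ℕ.* a) ≈ 2# ^ a
    √2^2* a = trans (sym (^-assocʳ √2 2 a)) (^-congˡ a √2²≈2)

  -- What the two parities of `m - n` share: the hypotheses of `CaseII`, `CaseIII` and `CaseIV`
  -- contradict `Large`, and `CaseI` is left to the caller.
  module LargeRange (large : Large) (n+t<P : n ℕ.+ t ℕ.< P) (M≡ : ⌊ m ℕ.+ n /2⌋ ℕ.+ t ≡ P)
    (case-i : ∀ c₃ → Form c₃ → (kEven → χ₁ ⟨ -1ℤ ⟩ ≈ 1#) → CaseI c₃) where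

    result : Result
    result = vanishing (form-below n+t<P) (λ _ → M≡) , λ c₃ form χ₁[-1] _ →
      case-i c₃ form χ₁[-1] ,
      (λ _ small → contradiction small (ℕ.<⇒≱ large)) ,
      (λ eq → contradiction (ℕ.≤-trans (≡.subst (2 ℕ.* t ℕ.+ 4 ℕ.<_) eq large) (bound 3 (ℕ.s≤s (ℕ.s≤s (ℕ.s≤s ℕ.z≤n))))) (ℕ.<-irrefl ≡.refl)) ,
      (λ eq → contradiction (ℕ.≤-trans (≡.subst (2 ℕ.* t ℕ.+ 4 ℕ.<_) eq large) (bound 2 (ℕ.s≤s (ℕ.s≤s ℕ.z≤n)))) (ℕ.<-irrefl ≡.refl))
      where
      bound : ∀ j → j ℕ.≤ 4 → t ℕ.+ j ℕ.≤ 2 ℕ.* t ℕ.+ 4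
      bound j j≤4 = ℕ.+-mono-≤ (ℕ.m≤m+n t (t ℕ.+ 0)) j≤4

  module EvenRange (large : Large) (P≡ : P ≡ n ℕ.+ t ℕ.+ (2 ℕ.+ s ℕ.+ t)) (even-d : ∃ λ a → m ℕ.∸ n ≡ 2 ℕ.* a) where

    private
      M≡ : ⌊ m ℕ.+ n /2⌋ ℕ.+ t ≡ P
      M≡ = ≡.trans (≡.cong (λ z → ⌊ z /2⌋ ℕ.+ t) (≡.trans (≡.cong (λ P → 2 ℕ.+ (s ℕ.+ P) ℕ.+ n) P≡) (lemma s t n)))
             (≡.trans (≡.cong (ℕ._+ t) (≡.sym (ℕ.n≡⌊n+n/2⌋ (2 ℕ.+ s ℕ.+ t ℕ.+ n)))) (≡.trans (lemma′ s t n) (≡.sym P≡)))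
        where
        lemma : ∀ s t n → 2 ℕ.+ (s ℕ.+ (n ℕ.+ t ℕ.+ (2 ℕ.+ s ℕ.+ t))) ℕ.+ n ≡ 2 ℕ.+ s ℕ.+ t ℕ.+ n ℕ.+ (2 ℕ.+ s ℕ.+ t ℕ.+ n)
        lemma = ℕSolver.solve-∀
        lemma′ : ∀ s t n → 2 ℕ.+ s ℕ.+ t ℕ.+ n ℕ.+ t ≡ n ℕ.+ t ℕ.+ (2 ℕ.+ s ℕ.+ t)
        lemma′ = ℕSolver.solve-∀

      exponent : ∀ τ → m ℕ.+ n ℕ.+ 2 ℕ.* (t ℕ.+ τ) ≡ 2 ℕ.* (P ℕ.+ τ)
      exponent τ = ≡.trans (≡.cong (λ P → 2 ℕ.+ (s ℕ.+ P) ℕ.+ n ℕ.+ 2 ℕ.* (t ℕ.+ τ)) P≡)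
          (≡.trans (lemma s t n τ) (≡.cong (λ P → 2 ℕ.* (P ℕ.+ τ)) (≡.sym P≡)))
        where
        lemma : ∀ s t n τ → 2 ℕ.+ (s ℕ.+ (n ℕ.+ t ℕ.+ (2 ℕ.+ s ℕ.+ t))) ℕ.+ n ℕ.+ 2 ℕ.* (t ℕ.+ τ) ≡ 2 ℕ.* (n ℕ.+ t ℕ.+ (2 ℕ.+ s ℕ.+ t) ℕ.+ τ)
        lemma = ℕSolver.solve-∀

      n+t<P : n ℕ.+ t ℕ.< P
      n+t<P = ≡.subst (n ℕ.+ t ℕ.<_) (≡.sym P≡) (ℕ.m<m+n (n ℕ.+ t) (ℕ.s≤s ℕ.z≤n))

      case-i : ∀ c₃ → Form c₃ → (kEven → χ₁ ⟨ -1ℤ ⟩ ≈ 1#) → CaseI c₃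
      case-i c₃ form χ₁[-1] _ x₀ l solution _ =
        (λ _ → begin
          S ≈⟨ L.S-even ≡.refl ⟩
          2# ^ (P ℕ.+ τ) * g x₀ ≈⟨ *-congʳ (√2^2* (P ℕ.+ τ)) ⟨
          √2 ^ (2 ℕ.* (P ℕ.+ τ)) * g x₀ ≈⟨ *-congʳ (^-congʳ √2 (exponent τ)) ⟨
          √2 ^ (m ℕ.+ n ℕ.+ 2 ℕ.* (t ℕ.+ τ)) * g x₀ ≈⟨ *-assoc _ _ _ ⟨
          V x₀ ∎) ,
        (λ odd-d → contradiction (ℕ.divides (proj₁ even-d) (≡.trans (proj₂ even-d) (ℕ.*-comm 2 (proj₁ even-d)))) odd-d)
        where
        τ = 1 ℕ.⊓ t
        module L = Large (2 ℕ.+ s ℕ.+ t) s P≡ ≡.refl c₃ (proj₁ (to-form form)) (λ ev → χ₁[-1] (Even⇒∣ ev))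
                     (odd-solution solution) (to-solves M≡ (proj₂ solution))

    open LargeRange large n+t<P M≡ case-i public

  module OddRange (large : Large) (s′ : ℕ) (s≡ : s ≡ suc s′) (P≡ : P ≡ n ℕ.+ t ℕ.+ (2 ℕ.+ (s′ ℕ.+ t)))
    (odd-d : ∃ λ a → m ℕ.∸ n ≡ suc (2 ℕ.* a)) where

    private
      M≡ : ⌊ m ℕ.+ n /2⌋ ℕ.+ t ≡ P
      M≡ = ≡.trans (≡.cong (λ z → ⌊ z /2⌋ ℕ.+ t) (≡.trans (≡.cong₂ (λ s P → 2 ℕ.+ (s ℕ.+ P) ℕ.+ n) s≡ P≡) (lemma s′ t n)))
             (≡.trans (≡.cong (ℕ._+ t) (≡.sym (ℕ.n≡⌈n+n/2⌉ (2 ℕ.+ s′ ℕ.+ t ℕ.+ n)))) (≡.trans (lemma′ s′ t n) (≡.sym P≡)))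
        where
        lemma : ∀ s t n → 2 ℕ.+ (suc s ℕ.+ (n ℕ.+ t ℕ.+ (2 ℕ.+ (s ℕ.+ t)))) ℕ.+ n ≡ suc (2 ℕ.+ s ℕ.+ t ℕ.+ n ℕ.+ (2 ℕ.+ s ℕ.+ t ℕ.+ n))
        lemma = ℕSolver.solve-∀
        lemma′ : ∀ s t n → 2 ℕ.+ s ℕ.+ t ℕ.+ n ℕ.+ t ≡ n ℕ.+ t ℕ.+ (2 ℕ.+ (s ℕ.+ t))
        lemma′ = ℕSolver.solve-∀

      exponent : ∀ τ → m ℕ.+ n ℕ.+ 2 ℕ.* (t ℕ.+ τ) ≡ suc (2 ℕ.* (P ℕ.+ τ))
      exponent τ = ≡.trans (≡.cong₂ (λ s P → 2 ℕ.+ (s ℕ.+ P) ℕ.+ n ℕ.+ 2 ℕ.* (t ℕ.+ τ)) s≡ P≡)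
          (≡.trans (lemma s′ t n τ) (≡.cong (λ P → suc (2 ℕ.* (P ℕ.+ τ))) (≡.sym P≡)))
        where
        lemma : ∀ s t n τ → 2 ℕ.+ (suc s ℕ.+ (n ℕ.+ t ℕ.+ (2 ℕ.+ (s ℕ.+ t)))) ℕ.+ n ℕ.+ 2 ℕ.* (t ℕ.+ τ) ≡ suc (2 ℕ.* (n ℕ.+ t ℕ.+ (2 ℕ.+ (s ℕ.+ t)) ℕ.+ τ))
        lemma = ℕSolver.solve-∀

      n+t<P : n ℕ.+ t ℕ.< P
      n+t<P = ≡.subst (n ℕ.+ t ℕ.<_) (≡.sym P≡) (ℕ.m<m+n (n ℕ.+ t) (ℕ.s≤s ℕ.z≤n))

      odd-h : ∀ {c₃} l → Odd c₃ → Odd (h c₃ l)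
      odd-h {c₃} l odd-c₃ = +-cong≋ {b = 0ℤ} {d = 1ℤ}
          (+-cong≋ {b = 0ℤ} {d = 0ℤ} (≋-trans (≋-reflexive (ℤ.*-comm (+ 2) l)) (multiple≋0 l)) (+-congʳ≋ -1ℤ odd-k₁))
          (Odd-* {+ (2 ℕ.^ n) ℤ.- 1ℤ} {c₃} (+-cong≋ {b = 0ℤ} {c = -1ℤ} {d = 1ℤ} (even-2^ n 0<n) (by -1ℤ ≡.refl)) odd-c₃)
        where
        even-2^ : ∀ n → 0 ℕ.< n → Even (+ (2 ℕ.^ n))
        even-2^ (suc n) _ = ∣⇒Even (ℕ.divides (2 ℕ.^ n) (ℕ.*-comm 2 (2 ℕ.^ n)))

      case-i : ∀ c₃ → Form c₃ → (kEven → χ₁ ⟨ -1ℤ ⟩ ≈ 1#) → CaseI c₃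
      case-i c₃ form χ₁[-1] _ x₀ l solution Cx₀≡ =
        (λ even-d → contradiction (∣⇒Even even-d) (λ ev → Even⇒¬Odd ev odd-d′)) ,
        (λ _ → begin
          S ≈⟨ L.S-odd s≡ ⟩
          2# ^ (P ℕ.+ τ) * (g x₀ + g (x₀ ℤ.* η)) ≈⟨ *-congˡ (+-cong (sym (*-identityʳ _)) g-half) ⟩
          2# ^ (P ℕ.+ τ) * (g x₀ * 1# + g x₀ * e 4 (h c₃ l)) ≈⟨ *-congˡ (distribˡ (g x₀) _ _) ⟨
          2# ^ (P ℕ.+ τ) * (g x₀ * (1# + e 4 (h c₃ l))) ≈⟨ *-congˡ (*-congˡ (quadratic-Gauss (h c₃ l) (odd-h l (proj₂ (to-form form))))) ⟩
          2# ^ (P ℕ.+ τ) * (g x₀ * (√2 * J)) ≈⟨ *-congʳ (√2^2* (P ℕ.+ τ)) ⟨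
          √2 ^ (2 ℕ.* (P ℕ.+ τ)) * (g x₀ * (√2 * J)) ≈⟨ *-congˡ (*-assoc (g x₀) √2 J) ⟨
          √2 ^ (2 ℕ.* (P ℕ.+ τ)) * (g x₀ * √2 * J) ≈⟨ *-assoc _ _ J ⟨
          √2 ^ (2 ℕ.* (P ℕ.+ τ)) * (g x₀ * √2) * J ≈⟨ *-congʳ (*-congˡ (*-comm (g x₀) √2)) ⟩
          √2 ^ (2 ℕ.* (P ℕ.+ τ)) * (√2 * g x₀) * J ≈⟨ *-congʳ (*-assoc _ √2 (g x₀)) ⟨
          √2 ^ (2 ℕ.* (P ℕ.+ τ)) * √2 * g x₀ * J ≈⟨ *-congʳ (*-congʳ (*-comm _ √2)) ⟩
          √2 ^ suc (2 ℕ.* (P ℕ.+ τ)) * g x₀ * J ≈⟨ *-congʳ (*-congʳ (^-congʳ √2 (exponent τ))) ⟨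
          √2 ^ (m ℕ.+ n ℕ.+ 2 ℕ.* (t ℕ.+ τ)) * g x₀ * J ≈⟨ *-congʳ (*-assoc _ _ _) ⟨
          V x₀ * J ∎)
        where
        τ = 1 ℕ.⊓ t
        J = e 8 (h c₃ l) * fromℤ (jacobi (+ 2) (h c₃ l))
        module L = Large (2 ℕ.+ (s′ ℕ.+ t)) s′ P≡ ≡.refl c₃ (proj₁ (to-form form)) (λ ev → χ₁[-1] (Even⇒∣ ev))
                     (odd-solution solution) (to-solves M≡ (proj₂ solution))
        η = L.η s≡
        odd-d′ : Odd (+ (m ℕ.∸ n))
        odd-d′ = ≋-trans (≋-reflexive (≡.cong +_ (proj₂ odd-d))) (by (+ proj₁ odd-d)
          (≡.cong (λ z → 1ℤ ℤ.+ z) (≡.trans (ℤ.pos-* 2 (proj₁ odd-d)) (ℤ.*-comm (+ 2) (+ proj₁ odd-d)))))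
        b : ∃ λ b → k₁ ≡ suc (2 ℕ.* b)
        b = odd-ℕ k₁ odd-k₁
        Cx₀≡′ : C x₀ ≡ l ℤ.* 2^ P
        Cx₀≡′ = ≡.trans (≡.sym (C-agrees x₀)) (≡.trans Cx₀≡ (≡.cong (l ℤ.*_) (≡.trans (≡.cong (λ j → + (2 ℕ.^ j)) M≡) (≡.sym (2^≡ P)))))
        module H = HalfStep s′ s≡ P≡ (proj₁ b) (proj₂ b) c₃ (proj₁ (to-form form)) x₀ (D x₀) l
                     (odd-solution solution) (D-inverse x₀) Cx₀≡′
        g-half : g (x₀ ℤ.* η) ≈ g x₀ * e 4 (h c₃ l)
        g-half = go H.half-shift
          where
          z = + 2 ℤ.* l ℤ.+ (+ k₁ ℤ.- 1ℤ) ℤ.+ (2^ n ℤ.- 1ℤ) ℤ.* c₃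
          go : (∃ λ w → f (x₀ ℤ.* η) ≋ f x₀ ℤ.* (+ 5) ℤ.^ w ⟨ 2^ m ⟩ ×
            c₁ ℤ.* + (2 ℕ.^ s′) ℤ.+ c₂ ℤ.* + w ≋ 2^ H.Q ℤ.* z ⟨ 2^ (2 ℕ.+ H.Q) ⟩) → g (x₀ ℤ.* η) ≈ g x₀ * e 4 (h c₃ l)
          go (w , f≋ , exp) = trans (g-shift x₀ η {2 ℕ.^ s′} {w} {2^ H.Q ℤ.* z} ≡.refl f≋ (recast (≡.sym H.s+P≡) exp)) (*-congˡ (begin
            E (s ℕ.+ P) (2^ H.Q ℤ.* z) ≈⟨ reflexive (≡.cong (λ j → E j (2^ H.Q ℤ.* z)) (≡.trans H.s+P≡ (ℕ.+-comm 2 H.Q))) ⟩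
            E (H.Q ℕ.+ 2) (2^ H.Q ℤ.* z) ≈⟨ E-cancel H.Q 2 z ⟩
            E 2 z ≈⟨ E≡ 2 z ⟩
            e 4 z ≈⟨ e-cong 4 (≡.cong (λ q → + 2 ℤ.* l ℤ.+ (+ k₁ ℤ.- 1ℤ) ℤ.+ (q ℤ.- 1ℤ) ℤ.* c₃) (2^≡ n)) ⟩
            e 4 (h c₃ l) ∎))

    open LargeRange large n+t<P M≡ case-i public

  -- Here `P = m - 2`, and `u = m - n - t - 2` is the number of digits that the equation fixes
  -- beyond `2^ (n + t)`: none in `CaseIV`, one in `CaseIII`, at least two in `CaseII`.
  module SmallRange (s≡0 : s ≡ 0) (u : ℕ) (P≡ : P ≡ n ℕ.+ t ℕ.+ u) (d≡ : m ℕ.∸ n ≡ 2 ℕ.+ (t ℕ.+ u)) (¬large : ¬ Large)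
    (1≤c₁ : 1ℤ ℤ.≤ c₁) (c₁≤ : c₁ ℤ.≤ + (2 ℕ.^ (s ℕ.+ P))) where

    private
      s+P≡P : s ℕ.+ P ≡ P
      s+P≡P = ≡.cong (ℕ._+ P) s≡0

      S≈ : S ≈ 2# ^ P * (G 1ℤ + G -1ℤ)
      S≈ = two-classes s≡0

      S-both : Solves 1ℤ → Solves -1ℤ → S ≈ 2# ^ P * (g 1ℤ + g -1ℤ)
      S-both p q = trans S≈ (*-congˡ (+-cong (G-yes p) (G-yes q)))

      2^m-1 : 2# ^ suc P ≈ 2# ^ (m ℕ.∸ 1)
      2^m-1 = ^-congʳ 2# (≡.cong suc (≡.sym s+P≡P))

      2^m-2 : 2# ^ P ≈ 2# ^ (m ℕ.∸ 2)
      2^m-2 = ^-congʳ 2# (≡.sym s+P≡P)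

      Odd-1 : Odd 1ℤ
      Odd-1 = ≋-refl

      Odd₋₁ : Odd -1ℤ
      Odd₋₁ = by -1ℤ ≡.refl

      S-even : Even (+ k) → χ₁ ⟨ -1ℤ ⟩ ≈ 1# → Solves 1ℤ → S ≈ 2# ^ (m ℕ.∸ 1) * χ₂ ⟨ A ℤ.+ B ⟩
      S-even ev χ≈1 p = begin
        S ≈⟨ S-both p (solves-neg ev p) ⟩
        2# ^ P * (g 1ℤ + g -1ℤ)                ≈⟨ *-congˡ (+-cong g-1 (g₋₁-even ev χ≈1)) ⟩
        2# ^ P * (χ₂ ⟨ A ℤ.+ B ⟩ + χ₂ ⟨ A ℤ.+ B ⟩) ≈⟨ double _ ⟩
        2# ^ suc P * χ₂ ⟨ A ℤ.+ B ⟩ ≈⟨ *-congʳ 2^m-1 ⟩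
        2# ^ (m ℕ.∸ 1) * χ₂ ⟨ A ℤ.+ B ⟩ ∎

      S-odd : Odd (+ k) → Solves 1ℤ → Solves -1ℤ → S ≈ 2# ^ P * (χ₂ ⟨ A ℤ.+ B ⟩ + χ₁ ⟨ -1ℤ ⟩ * χ₂ ⟨ ℤ.- A ℤ.+ B ⟩)
      S-odd od p q = trans (S-both p q) (*-congˡ (+-cong g-1 (g₋₁-odd od)))

      -- For `u = 0` the equation does not decide the parity of `c₃`. Instead `c₁` is a multiple of
      -- `2^ (n + t)` between 1 and `2 ^ (s + P)`, which is the same number, so `c₃ = 1`.
      form-small : ∀ {x} → Odd x → Solves x → ∃ Form
      form-small od p = go u ≡.refl
        where
        go : ∀ u′ → u ≡ u′ → ∃ Form
        go (suc u′) eq = form-below (≡.subst (n ℕ.+ t ℕ.<_) (≡.sym (≡.trans P≡ (≡.cong (n ℕ.+ t ℕ.+_) eq))) (ℕ.m<m+n (n ℕ.+ t) (ℕ.s≤s ℕ.z≤n))) od p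
        go zero eq = go′ (solves⇒c₁ p)
          where
          n+t≡ : n ℕ.+ t ≡ s ℕ.+ P
          n+t≡ = ≡.trans (≡.sym (ℕ.+-identityʳ (n ℕ.+ t))) (≡.trans (≡.cong (n ℕ.+ t ℕ.+_) (≡.sym eq)) (≡.trans (≡.sym P≡) (≡.sym s+P≡P)))
          unit-multiple : ∀ p c₃ → 1ℤ ℤ.≤ + p ℤ.* c₃ → + p ℤ.* c₃ ℤ.≤ + p → c₃ ≡ 1ℤ
          unit-multiple p (+ zero) lo _ = contradiction (≡.subst (1ℤ ℤ.≤_) (ℤ.*-zeroʳ (+ p)) lo) λ { (ℤ.+≤+ ()) }
          unit-multiple zero (+ suc j) lo _ = contradiction lo λ { (ℤ.+≤+ ()) }
          unit-multiple (suc p) (+ suc j) lo hi = ≡.cong +_ (ℕ.≤-antisym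
            (ℕ.*-cancelˡ-≤ (suc p) (ℕ.≤-trans (ℤ.drop‿+≤+ (≡.subst (ℤ._≤ + suc p) (≡.sym (ℤ.pos-* (suc p) (suc j))) hi))
              (ℕ.≤-reflexive (≡.sym (ℕ.*-identityʳ (suc p)))))) (ℕ.s≤s ℕ.z≤n))
          unit-multiple zero ℤ.-[1+ j ] lo _ = contradiction lo λ { (ℤ.+≤+ ()) }
          unit-multiple (suc p) ℤ.-[1+ j ] lo _ = contradiction lo λ ()
          go′ : (∃ λ c₃ → c₁ ≡ 2^ (n ℕ.+ t) ℤ.* c₃) → ∃ Form
          go′ (c₃ , c₁≡) = c₃ , from-form c₁≡ (≡.subst Odd (≡.sym c₃≡1) ≋-refl)
            where
            c₁≡′ : c₁ ≡ + (2 ℕ.^ (s ℕ.+ P)) ℤ.* c₃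
            c₁≡′ = ≡.trans c₁≡ (≡.cong (ℤ._* c₃) (≡.trans (2^≡ (n ℕ.+ t)) (≡.cong (λ j → + (2 ℕ.^ j)) n+t≡)))
            c₃≡1 : c₃ ≡ 1ℤ
            c₃≡1 = unit-multiple (2 ℕ.^ (s ℕ.+ P)) c₃ (≡.subst (1ℤ ℤ.≤_) c₁≡′ 1≤c₁) (≡.subst (ℤ._≤ + (2 ℕ.^ (s ℕ.+ P))) c₁≡′ c₁≤)

      module _ {c₃} (form : Form c₃) (χ₁[-1] : kEven → χ₁ ⟨ -1ℤ ⟩ ≈ 1#) where

        c₁≡ : c₁ ≡ 2^ (n ℕ.+ t) ℤ.* c₃
        c₁≡ = proj₁ (to-form form)

        u≡ : ∀ {j} → m ℕ.∸ n ≡ t ℕ.+ (2 ℕ.+ j) → u ≡ j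
        u≡ {j} eq = ℕ.+-cancelˡ-≡ t u j (ℕ.+-cancelˡ-≡ 2 (t ℕ.+ u) (t ℕ.+ j) (≡.trans (≡.sym d≡) (≡.trans eq (lemma t j))))
          where
          lemma : ∀ t j → t ℕ.+ (2 ℕ.+ j) ≡ 2 ℕ.+ (t ℕ.+ j)
          lemma = ℕSolver.solve-∀

        -- After division by `2^ (n + t)` at most the parity is prescribed, and
        -- `c₃ * f x + unit * x ^ k` is a sum of two odd numbers.
        all-solve : u ℕ.≤ 1 → ∀ {x} → Odd x → Solves x
        all-solve u≤1 {x} od = recast (≡.sym P≡) (≋-trans (≋-reflexive (C-reduced c₃ c₁≡ x))
            (≋-trans (scale-2^ {c₃ ℤ.* f x ℤ.+ unit ℤ.* x ℤ.^ k} {0ℤ} (n ℕ.+ t) {u} (lower u≤1 (mod2^1 even-sum))) (≋-reflexive (ℤ.*-zeroʳ (2^ (n ℕ.+ t))))))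
          where
          even-sum : Even (c₃ ℤ.* f x ℤ.+ unit ℤ.* x ℤ.^ k)
          even-sum = ≋-trans (+-cong≋ (Odd-* (proj₂ (to-form form)) (odd-f x)) (Odd-* odd-unit (Odd-^ k od))) (by 1ℤ ≡.refl)

        -- The k-th powers of 1 and -1 would agree modulo `2^ u`, hence modulo 4.
        not-both : 2 ℕ.≤ u → Odd (+ k) → Solves 1ℤ → ¬ Solves -1ℤ
        not-both 2≤u od p q = 1≢-1 (≋-trans (≋-reflexive (≡.sym (ℤ.^-zeroˡ k))) (≋-trans
          (lower 2≤u (equal-powers c₃ c₁≡ u P≡ 1ℤ -1ℤ p q)) (≋-reflexive (neg-power-odd od))))

        case-ii : CaseII
        case-ii t+3<d _ =
          (λ { (ev , p) → S-even (∣⇒Even ev) (χ₁[-1] ev) (to-solves s+P≡P p) }) ,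
          (λ { (od , p) → trans S≈ (trans (*-congˡ (trans (+-cong (trans (G-yes (to-solves s+P≡P p)) g-1) (G-no (not-both 2≤u (∤⇒Odd od) (to-solves s+P≡P p)))) (+-identityʳ _)))
            (*-congʳ 2^m-2)) }) ,
          (λ { (od , q) → trans S≈ (trans (*-congˡ (trans (+-cong (G-no (λ p → not-both 2≤u (∤⇒Odd od) p (to-solves s+P≡P q))) (trans (G-yes (to-solves s+P≡P q)) (g₋₁-odd (∤⇒Odd od)))) (+-identityˡ _)))
            (trans (*-congʳ 2^m-2) (sym (*-assoc _ _ _)))) }) ,
          (λ ¬P → trans S≈ (trans (*-congˡ (trans (+-cong (G-no (proj₁ (neither ¬P))) (G-no (proj₂ (neither ¬P)))) (+-identityˡ 0#))) (zeroʳ _)))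
          where
          2≤u : 2 ℕ.≤ u
          2≤u = ℕ.+-cancelˡ-≤ (2 ℕ.+ t) 2 u (ℕ.≤-trans (ℕ.≤-reflexive (lemma t)) (ℕ.≤-trans t+3<d (ℕ.≤-reflexive d≡)))
            where
            lemma : ∀ t → 2 ℕ.+ t ℕ.+ 2 ≡ suc (t ℕ.+ 3)
            lemma = ℕSolver.solve-∀
          neither : ¬ (Con.P₁ ⊎ Con.P₂ ⊎ Con.P₃) → (¬ Solves 1ℤ) × (¬ Solves -1ℤ)
          neither ¬P = go (parity (+ k))
            where
            go : Even (+ k) ⊎ Odd (+ k) → (¬ Solves 1ℤ) × (¬ Solves -1ℤ)
            go (inj₁ ev) = (λ p → ¬P (inj₁ (Even⇒∣ ev , from-solves s+P≡P p))) , (λ q → ¬P (inj₁ (Even⇒∣ ev , from-solves s+P≡P (solves-neg ev q))))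
            go (inj₂ od) = (λ p → ¬P (inj₂ (inj₁ (Odd⇒∤ od , from-solves s+P≡P p)))) , (λ q → ¬P (inj₂ (inj₂ (Odd⇒∤ od , from-solves s+P≡P q))))

        -- With `u = 1` the odd `c₃` gives `χ₁(5) = e(c₃ / 2) = -1`, so one of `Q₁`, `Q₂` holds;
        -- this refutes the premise of the last clause.
        case-iii : CaseIII
        case-iii d≡t+3 =
          (λ { (ev , _ , χ≈1) → S-even (∣⇒Even ev) χ≈1 (all-solve u≤1 Odd-1) }) ,
          (λ { (od , _) → trans (S-odd (∤⇒Odd od) (all-solve u≤1 Odd-1) (all-solve u≤1 Odd₋₁)) (*-congʳ 2^m-2) }) ,
          (λ ¬Q → contradiction (holds (parity (+ k))) ¬Q)
          where
          u≡1 : u ≡ 1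
          u≡1 = u≡ d≡t+3
          u≤1 : u ℕ.≤ 1
          u≤1 = ℕ.≤-reflexive u≡1
          χ₁5≈-1 : χ₁ ⟨ + 5 ⟩ ≈ - 1#
          χ₁5≈-1 = begin
            χ₁ ⟨ + 5 ⟩ ≈⟨ E-χ₁5 ⟩
            E (s ℕ.+ P) c₁ ≈⟨ reflexive (≡.cong₂ E (≡.trans s+P≡P (≡.trans P≡ (≡.cong (n ℕ.+ t ℕ.+_) u≡1))) c₁≡) ⟩
            E (n ℕ.+ t ℕ.+ 1) (2^ (n ℕ.+ t) ℤ.* c₃) ≈⟨ E-cancel (n ℕ.+ t) 1 c₃ ⟩
            E 1 c₃ ≈⟨ E-odd (proj₂ (to-form form)) ⟩
            - 1# ∎
          holds : Even (+ k) ⊎ Odd (+ k) → Con.Q₁ ⊎ Con.Q₂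
          holds (inj₁ ev) = inj₁ (Even⇒∣ ev , inj₂ χ₁5≈-1 , χ₁[-1] (Even⇒∣ ev))
          holds (inj₂ od) = inj₂ (Odd⇒∤ od , inj₂ χ₁5≈-1)

        -- With `u = 0` one has `χ₁(5) = e(c₃) = 1`, so on odd numbers `χ₁` depends on the residue
        -- modulo 4 only and is determined by `χ₁(-1)`.
        case-iv : CaseIV
        case-iv d≡t+2 = (λ T → value T) , (λ ¬T → vanishes′ ¬T (parity (+ k)))
          where
          u≡0 : u ≡ 0
          u≡0 = u≡ d≡t+2
          u≤1 : u ℕ.≤ 1
          u≤1 = ℕ.≤-trans (ℕ.≤-reflexive u≡0) ℕ.z≤n
          P≡n+t : P ≡ n ℕ.+ t
          P≡n+t = ≡.trans P≡ (≡.trans (≡.cong (n ℕ.+ t ℕ.+_) u≡0) (ℕ.+-identityʳ (n ℕ.+ t)))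

          χ₁5≈1 : χ₁ ⟨ + 5 ⟩ ≈ 1#
          χ₁5≈1 = begin
            χ₁ ⟨ + 5 ⟩ ≈⟨ E-χ₁5 ⟩
            E (s ℕ.+ P) c₁ ≈⟨ reflexive (≡.cong₂ E (≡.trans s+P≡P P≡n+t) c₁≡) ⟩
            E (n ℕ.+ t) (2^ (n ℕ.+ t) ℤ.* c₃) ≈⟨ E-cong (n ℕ.+ t) (≋-trans (≋-reflexive (ℤ.*-comm (2^ (n ℕ.+ t)) c₃)) (multiple≋0 c₃)) ⟩
            E (n ℕ.+ t) 0ℤ ≈⟨ E-0 (n ℕ.+ t) ⟩
            1# ∎

          χ₁-1mod4 : ∀ {x} → x ≋ 1ℤ ⟨ + 4 ⟩ → χ₁ ⟨ x ⟩ ≈ 1#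
          χ₁-1mod4 {x} p = go (5-generates 0 (s ℕ.+ P) (mod2^2 p))
            where
            go : (∃ λ v → x ≋ 5^[2^ 0 * v ] ⟨ 2^ (2 ℕ.+ 0 ℕ.+ (s ℕ.+ P)) ⟩) → χ₁ ⟨ x ⟩ ≈ 1#
            go (v , q) = trans (χ-2^cong (suc (s ℕ.+ P)) χ₁ q) (trans (χ-^ χ₁ (+ 5) (1 ℕ.* v)) (trans (^-congˡ (1 ℕ.* v) χ₁5≈1) (1^ (1 ℕ.* v))))

          χ₁-₋₁mod4 : ∀ {x} → x ≋ -1ℤ ⟨ + 4 ⟩ → χ₁ ⟨ x ⟩ ≈ χ₁ ⟨ -1ℤ ⟩
          χ₁-₋₁mod4 {x} p = begin
            χ₁ ⟨ x ⟩ ≈⟨ χ-≡ χ₁ (≡.sym (ℤ.neg-involutive x)) ⟩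
            χ₁ ⟨ ℤ.- (ℤ.- x) ⟩ ≈⟨ χ-neg χ₁ (ℤ.- x) ⟩
            χ₁ ⟨ -1ℤ ⟩ * χ₁ ⟨ ℤ.- x ⟩ ≈⟨ *-congˡ (χ₁-1mod4 (-‿cong≋ p)) ⟩
            χ₁ ⟨ -1ℤ ⟩ * 1# ≈⟨ *-identityʳ _ ⟩
            χ₁ ⟨ -1ℤ ⟩ ∎

          χ₁≐principal : χ₁ ⟨ -1ℤ ⟩ ≈ 1# → (χ₁ ⟨_⟩) ≐ principal (2 ℕ.^ m)
          χ₁≐principal χ≈1 x = go (coprime? x (+ (2 ℕ.^ m)))
            where
            even-absurd : Coprime x (+ (2 ℕ.^ m)) → ¬ Even x
            even-absurd coprime ev with coprime {2} (Even⇒∣ ev , ℕ.divides (2 ℕ.^ suc (s ℕ.+ P)) (ℕ.*-comm 2 (2 ℕ.^ suc (s ℕ.+ P))))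
            ... | ()
            go : (d : Dec (Coprime x (+ (2 ℕ.^ m)))) → χ₁ ⟨ x ⟩ ≈ (if does d then 1# else 0#)
            go (no ¬coprime) = DirichletCharacter.vanishes χ₁ x ¬coprime
            go (yes coprime) = [ χ₁-1mod4 , (λ p → trans (χ₁-₋₁mod4 p) χ≈1) ]′ (odd-mod4 (¬Even⇒Odd (even-absurd coprime)))

          χ₁≐χ₄ : χ₁ ⟨ -1ℤ ⟩ ≈ - 1# → (χ₁ ⟨_⟩) ≐ χ₄
          χ₁≐χ₄ χ≈-1 x with x ℤ.%ℕ 4 | residue x 4 | DivMod.n%ℕd<d x 4
          ... | 0 | p | _ = χ-even (suc (s ℕ.+ P)) χ₁ (modulus-∣ (+ 2) p)
          ... | 1 | p | _ = χ₁-1mod4 p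
          ... | 2 | p | _ = χ-even (suc (s ℕ.+ P)) χ₁ (≋-trans (modulus-∣ (+ 2) p) (by 1ℤ ≡.refl))
          ... | 3 | p | _ = trans (χ₁-₋₁mod4 (≋-trans p (by 1ℤ ≡.refl))) χ≈-1
          ... | suc (suc (suc (suc _))) | _ | ℕ.s≤s (ℕ.s≤s (ℕ.s≤s (ℕ.s≤s ())))

          -- Here t = 0, so that m = n + 2 and - A + B ≡ (A + B)(1 + 2 ^ (m - 1)) modulo 2 ^ m.
          χ₂-flip : Odd (+ k) → χ₂ ⟨ ℤ.- A ℤ.+ B ⟩ ≈ - χ₂ ⟨ A ℤ.+ B ⟩
          χ₂-flip od = go n 0<n ≡.refl
            where
            t≡0 : t ≡ 0
            t≡0 = zero-or t ≡.refl
              where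
              zero-or : ∀ t′ → t ≡ t′ → t ≡ 0
              zero-or zero    eq = eq
              zero-or (suc _) eq = contradiction (even-k (≡.subst (0 ℕ.<_) (≡.sym eq) (ℕ.s≤s ℕ.z≤n))) (λ ev → Even⇒¬Odd ev od)
            go : ∀ n′ → 0 ℕ.< n′ → n ≡ n′ → χ₂ ⟨ ℤ.- A ℤ.+ B ⟩ ≈ - χ₂ ⟨ A ℤ.+ B ⟩
            go (suc p) _ n≡ = begin
              χ₂ ⟨ ℤ.- A ℤ.+ B ⟩ ≈⟨ χ-2^cong (suc (s ℕ.+ P)) χ₂ (recast (≡.cong (2 ℕ.+_) (≡.sym s+P≡)) flip) ⟩
              χ₂ ⟨ (A ℤ.+ B) ℤ.* (+ 5) ℤ.^ (2 ℕ.^ p) ⟩ ≈⟨ χ-* χ₂ (A ℤ.+ B) _ ⟩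
              χ₂ ⟨ A ℤ.+ B ⟩ * χ₂ ⟨ (+ 5) ℤ.^ (2 ℕ.^ p) ⟩ ≈⟨ *-congˡ χ₂5^ ⟩
              χ₂ ⟨ A ℤ.+ B ⟩ * - 1# ≈⟨ *-comm _ _ ⟩
              - 1# * χ₂ ⟨ A ℤ.+ B ⟩ ≈⟨ -1*x≈-x _ ⟩
              - χ₂ ⟨ A ℤ.+ B ⟩ ∎
              where
              s+P≡ : s ℕ.+ P ≡ suc p
              s+P≡ = ≡.trans s+P≡P (≡.trans P≡n+t (≡.trans (≡.cong (n ℕ.+_) t≡0) (≡.trans (ℕ.+-identityʳ n) n≡)))
              χ₂5^ : χ₂ ⟨ (+ 5) ℤ.^ (2 ℕ.^ p) ⟩ ≈ - 1#
              χ₂5^ = begin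
                χ₂ ⟨ (+ 5) ℤ.^ (2 ℕ.^ p) ⟩ ≈⟨ χ-5^ χ₂ E-χ₂5 (2 ℕ.^ p) ⟩
                E (s ℕ.+ P) (c₂ ℤ.* + (2 ℕ.^ p)) ≈⟨ reflexive (≡.cong₂ E (≡.trans s+P≡ (ℕ.+-comm 1 p)) (≡.trans (ℤ.*-comm c₂ _) (≡.cong (ℤ._* c₂) (≡.sym (2^≡ p))))) ⟩
                E (p ℕ.+ 1) (2^ p ℤ.* c₂) ≈⟨ E-cancel p 1 c₂ ⟩
                E 1 c₂ ≈⟨ E-odd odd-c₂ ⟩
                - 1# ∎
              odd-A+B : Odd (A ℤ.+ B)
              odd-A+B = +-cong≋ {b = 0ℤ} even-A (Odd-*ʳ (A₁ ℤ.* + k₁) B odd-A₁k₁B)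
              q = 2^ (2 ℕ.+ p)
              A≡q : + 2 ℤ.* A ≡ q ℤ.* A₁
              A≡q = ≡.trans (≡.cong (+ 2 ℤ.*_) (≡.trans A≡ (≡.cong (ℤ._* A₁) (≡.trans (≡.sym (2^≡ n)) (≡.cong 2^_ n≡)))))
                (≡.trans (≡.sym (ℤ.*-assoc (+ 2) (2^ (suc p)) A₁)) (≡.cong (ℤ._* A₁) (≡.sym (2^-suc (suc p)))))
              flip : ℤ.- A ℤ.+ B ≋ (A ℤ.+ B) ℤ.* (+ 5) ℤ.^ (2 ℕ.^ p) ⟨ 2^ (2 ℕ.+ suc p) ⟩
              flip = ≋-trans (≋-reflexive (≡.trans (lemma₁ A B) (≡.cong (λ z → A ℤ.+ B ℤ.+ ℤ.- z) A≡q)))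
                (≋-trans (≋-reflexive (lemma₂ (A ℤ.+ B) q A₁)) (≋-trans
                  (+-congˡ≋ (A ℤ.+ B) (recast (ℕ.+-comm (2 ℕ.+ p) 1) (scale-2^ (2 ℕ.+ p) (mod2^1
                    (≋-trans (Odd-neg odd-A₁) (≋-sym (Odd-* odd-A+B (R-odd p))))))))
                  (≋-reflexive (≡.trans (lemma₃ (A ℤ.+ B) q (R (2 ℕ.+ p))) (≡.cong ((A ℤ.+ B) ℤ.*_) (≡.sym (5^2^≡1+R p)))))))
                where
                lemma₁ : ∀ a b → ℤ.- a ℤ.+ b ≡ a ℤ.+ b ℤ.+ ℤ.- (+ 2 ℤ.* a)
                lemma₁ = solve-∀
                lemma₂ : ∀ z q a → z ℤ.+ ℤ.- (q ℤ.* a) ≡ z ℤ.+ q ℤ.* ℤ.- a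
                lemma₂ = solve-∀
                lemma₃ : ∀ z q r → z ℤ.+ q ℤ.* (z ℤ.* r) ≡ z ℤ.* (1ℤ ℤ.+ r ℤ.* q)
                lemma₃ = solve-∀

          S-flip : Odd (+ k) → S ≈ 2# ^ P * (χ₂ ⟨ A ℤ.+ B ⟩ + - χ₁ ⟨ -1ℤ ⟩ * χ₂ ⟨ A ℤ.+ B ⟩)
          S-flip od = trans (S-odd od (all-solve u≤1 Odd-1) (all-solve u≤1 Odd₋₁))
            (*-congˡ (+-congˡ (trans (*-congˡ (χ₂-flip od)) (trans (sym (-‿distribʳ-* _ _)) (-‿distribˡ-* _ _)))))

          value : Con.T → S ≈ 2# ^ (m ℕ.∸ 1) * χ₂ ⟨ A ℤ.+ B ⟩
          value (inj₁ (ev , _)) = S-even (∣⇒Even ev) (χ₁[-1] ev) (all-solve u≤1 Odd-1)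
          value (inj₂ (od , χ₁≐)) = trans (S-flip (∤⇒Odd od)) (trans (*-congˡ (+-congˡ (trans (*-congʳ
            (trans (-‿cong (χ₁≐ -1ℤ)) (-‿involutive 1#))) (*-identityˡ _)))) (trans (double _) (*-congʳ 2^m-1)))

          -- For odd `k` the value `χ₁(-1)` is a square root of 1; it is not -1, or `χ₁` would be
          -- `χ₄`. With the value 1 the contributions of 1 and -1 cancel by `χ₂-flip`.
          vanishes′ : ¬ Con.T → Even (+ k) ⊎ Odd (+ k) → S ≈ 0#
          vanishes′ ¬T (inj₁ ev) = contradiction (inj₁ (Even⇒∣ ev , χ₁≐principal (χ₁[-1] (Even⇒∣ ev)))) ¬T
          vanishes′ ¬T (inj₂ od) = trans (S-flip od) (trans (*-congˡ (trans (+-congˡ (trans (sym (-‿distribˡ-* _ _)) (-‿cong (trans (*-congʳ χ≈1) (*-identityˡ _))))) (-‿inverseʳ _))) (zeroʳ _))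
            where
            x = χ₁ ⟨ -1ℤ ⟩
            x*x≈1 : x * x ≈ 1#
            x*x≈1 = trans (sym (χ-* χ₁ -1ℤ -1ℤ)) (χ-1 χ₁)
            χ≈1 : x ≈ 1#
            χ≈1 = x∙y⁻¹≈ε⇒x≈y x 1# (no-zero-divisors {x + 1#} (begin
              (x + 1#) * (x - 1#) ≈⟨ distribʳ (x - 1#) x 1# ⟩
              x * (x - 1#) + 1# * (x - 1#) ≈⟨ +-cong (trans (distribˡ x x (- 1#)) (+-cong x*x≈1 (trans (*-comm x (- 1#)) (-1*x≈-x x)))) (*-identityˡ _) ⟩
              (1# - x) + (x - 1#) ≈⟨ +-congʳ (⁻¹-anti-homo‿- x 1#) ⟨
              - (x - 1#) + (x - 1#) ≈⟨ -‿inverseˡ _ ⟩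
              0# ∎)
              (λ x+1≈0 → ¬T (inj₂ (Odd⇒∤ od , χ₁≐χ₄ (+-inverseˡ-unique x 1# x+1≈0)))))

    result : Result
    result = vanishing form-small (λ large → contradiction large ¬large) , λ c₃ form χ₁[-1] _ →
      (λ large → contradiction large ¬large) , case-ii form χ₁[-1] , case-iii form χ₁[-1] , case-iv form χ₁[-1]

-- The three ranges of m - n and the value of N in each.

module Ranges where
  open import Data.Nat.Base
  open import Data.Nat.Properties
  open import Data.Nat.Tactic.RingSolver using (solve-∀)
  open import Data.Bool.Base using (if_then_else_)
  open import Data.Sum.Base using (_⊎_; inj₁; inj₂)
  open import Data.Product.Base using (∃; _,_)
  open import Relation.Nullary.Decidable using (Dec; yes; no; does)
  open import Relation.Nullary.Negation using (contradiction)
  open import Relation.Binary.PropositionalEquality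
  open import Defs using (N)

  -- Each constructor writes `m` as `2 + (s + P)` with the parameters of its range, so that matching
  -- on `refl` brings it to the shape required by `Proof` without subtraction. The argument of
  -- `even` and `odd` is `s - 1`, since `s > 0` in the large range.
  data Range (m n t : ℕ) : Set where
    small : ∀ u → u ≤ 2 + t → m ≡ 2 + (0 + (n + t + u)) → Range m n t
    even  : ∀ s → m ≡ 2 + (suc s + (n + t + (2 + suc s + t))) → Range m n t
    odd   : ∀ s → m ≡ 2 + (suc s + (n + t + (2 + (s + t)))) → Range m n t

  half : ∀ v → ∃ λ w → v ≡ 2 * w ⊎ v ≡ suc (2 * w)
  half zero    = 0 , inj₁ refl
  half (suc v) with half v
  ... | w , inj₁ eq = w , inj₂ (cong suc eq)
  ... | w , inj₂ eq = suc w , inj₁ (trans (cong suc eq) (sym (*-suc 2 w)))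

  range : ∀ m n t → t + 2 ≤ m ∸ n → Range m n t
  range m n t t+2≤d = go (u ≤? 2 + t)
    where
    u = m ∸ n ∸ (t + 2)
    m≡ : m ≡ n + (t + 2 + u)
    m≡ = trans (sym (m+[n∸m]≡n n≤m)) (cong (λ d → n + d) (sym (m+[n∸m]≡n t+2≤d)))
      where
      n≤m : n ≤ m
      n≤m = <⇒≤ (m∸n≢0⇒n<m λ eq → contradiction (≤-trans (m≤n+m 2 t) (≤-trans t+2≤d (≤-reflexive eq))) λ ())
    large : ∀ v → u ≡ 3 + t + v → Range m n t
    large v u≡ with half v
    ... | w , inj₁ refl = odd w (trans m≡ (trans (cong (λ u → n + (t + 2 + u)) u≡) (lemma n t w)))
      where
      lemma : ∀ n t w → n + (t + 2 + (3 + t + 2 * w)) ≡ 2 + (suc w + (n + t + (2 + (w + t))))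
      lemma = solve-∀
    ... | w , inj₂ refl = even w (trans m≡ (trans (cong (λ u → n + (t + 2 + u)) u≡) (lemma n t w)))
      where
      lemma : ∀ n t w → n + (t + 2 + (3 + t + suc (2 * w))) ≡ 2 + (suc w + (n + t + (2 + suc w + t)))
      lemma = solve-∀
    go : Dec (u ≤ 2 + t) → Range m n t
    go (yes u≤) = small u u≤ (trans m≡ (lemma n t u))
      where
      lemma : ∀ n t u → n + (t + 2 + u) ≡ 2 + (0 + (n + t + u))
      lemma = solve-∀
    go (no u≰) = large (u ∸ (3 + t)) (sym (m+[n∸m]≡n (≰⇒> u≰)))

  N-large : ∀ m n t → 2 * t + 4 < m ∸ n → N m n t ≡ ⌈ m ∸ n /2⌉
  N-large m n t l = go (2 * t + 4 <? m ∸ n)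
    where
    go : (d : Dec (2 * t + 4 < m ∸ n)) → (if does d then ⌈ m ∸ n /2⌉ else t + 2) ≡ ⌈ m ∸ n /2⌉
    go (yes _) = refl
    go (no ¬l) = contradiction l ¬l

  N-small : ∀ m n t → m ∸ n ≤ 2 * t + 4 → N m n t ≡ 2 + t
  N-small m n t l = go (2 * t + 4 <? m ∸ n)
    where
    go : (d : Dec (2 * t + 4 < m ∸ n)) → (if does d then ⌈ m ∸ n /2⌉ else t + 2) ≡ 2 + t
    go (yes g) = contradiction l (<⇒≱ g)
    go (no _)  = +-comm t 2

  d-small : ∀ n t u → 2 + (0 + (n + t + u)) ∸ n ≡ 2 + (t + u)
  d-small n t u = trans (cong (_∸ n) (lemma n t u)) (m+n∸m≡n n (2 + (t + u)))
    where
    lemma : ∀ n t u → 2 + (0 + (n + t + u)) ≡ n + (2 + (t + u))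
    lemma = solve-∀

  d-even : ∀ n t s → 2 + (suc s + (n + t + (2 + suc s + t))) ∸ n ≡ 2 * (3 + (s + t))
  d-even n t s = trans (cong (_∸ n) (lemma n t s)) (m+n∸m≡n n (2 * (3 + (s + t))))
    where
    lemma : ∀ n t s → 2 + (suc s + (n + t + (2 + suc s + t))) ≡ n + 2 * (3 + (s + t))
    lemma = solve-∀

  d-odd : ∀ n t s → 2 + (suc s + (n + t + (2 + (s + t)))) ∸ n ≡ suc (2 * (2 + (s + t)))
  d-odd n t s = trans (cong (_∸ n) (lemma n t s)) (m+n∸m≡n n (suc (2 * (2 + (s + t)))))
    where
    lemma : ∀ n t s → 2 + (suc s + (n + t + (2 + (s + t)))) ≡ n + suc (2 * (2 + (s + t)))
    lemma = solve-∀

  small-bound : ∀ n t u → u ≤ 2 + t → 2 + (0 + (n + t + u)) ∸ n ≤ 2 * t + 4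
  small-bound n t u u≤ = ≤-trans (≤-reflexive (d-small n t u))
    (≤-trans (+-monoʳ-≤ 2 (+-monoʳ-≤ t u≤)) (≤-reflexive (lemma t)))
    where
    lemma : ∀ t → 2 + (t + (2 + t)) ≡ 2 * t + 4
    lemma = solve-∀

  large-even : ∀ n t s → 2 * t + 4 < 2 + (suc s + (n + t + (2 + suc s + t))) ∸ n
  large-even n t s = ≤-trans (m≤m+n _ (1 + 2 * s)) (≤-reflexive (trans (lemma t s) (sym (d-even n t s))))
    where
    lemma : ∀ t s → suc (2 * t + 4) + (1 + 2 * s) ≡ 2 * (3 + (s + t))
    lemma = solve-∀

  large-odd : ∀ n t s → 2 * t + 4 < 2 + (suc s + (n + t + (2 + (s + t)))) ∸ n
  large-odd n t s = ≤-trans (m≤m+n _ (2 * s)) (≤-reflexive (trans (lemma t s) (sym (d-odd n t s))))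
    where
    lemma : ∀ t s → suc (2 * t + 4) + 2 * s ≡ suc (2 * (2 + (s + t)))
    lemma = solve-∀

  N-even : ∀ n t s → N (2 + (suc s + (n + t + (2 + suc s + t)))) n t ≡ 2 + (suc s + t)
  N-even n t s = trans (N-large _ n t (large-even n t s)) (trans (cong ⌈_/2⌉ (trans (d-even n t s) (lemma (3 + (s + t)))))
      (sym (n≡⌈n+n/2⌉ (3 + (s + t)))))
    where
    lemma : ∀ a → 2 * a ≡ a + a
    lemma = solve-∀

  N-odd : ∀ n t s → N (2 + (suc s + (n + t + (2 + (s + t))))) n t ≡ 2 + (suc s + t)
  N-odd n t s = trans (N-large _ n t (large-odd n t s)) (trans (cong ⌈_/2⌉ (d-odd n t s))
      (trans (cong ⌊_/2⌋ (lemma (2 + (s + t)))) (sym (n≡⌊n+n/2⌋ (3 + (s + t))))))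
    where
    lemma : ∀ a → suc (suc (2 * a)) ≡ suc a + suc a
    lemma = solve-∀

-- Assembly of the ranges.

open Ranges
open import Data.Product.Base using (_,_)
open import Relation.Binary.PropositionalEquality.Core using (refl)

by-range : ∀ {c ℓ₁ ℓ₂} (ℂ : ComplexField c ℓ₁ ℓ₂) → let open CharacterSums ℂ in
  ∀ {m n t} → Range m n t → 0 ℕ.< n →
  (χ₁ χ₂ : DirichletCharacter (2 ℕ.^ m)) → Primitive χ₂ →
  ∀ (A A₁ B : ℤ) (k k₁ : ℕ) → A ≡ + (2 ℕ.^ n) ℤ.* A₁ → k ≡ 2 ℕ.^ t ℕ.* k₁ → ¬ (+ 2 ∣ A₁ ℤ.* + k₁ ℤ.* B) →
  ∀ (c₁ c₂ : ℤ) → ℤ.1ℤ ℤ.≤ c₁ → c₁ ℤ.≤ + (2 ℕ.^ (m ℕ.∸ 2)) →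
  χ₁ ⟨ + 5 ⟩ ≈ e (2 ℕ.^ (m ℕ.∸ 2)) {{m^n≢0 2 (m ℕ.∸ 2)}} c₁ →
  χ₂ ⟨ + 5 ⟩ ≈ e (2 ℕ.^ (m ℕ.∸ 2)) {{m^n≢0 2 (m ℕ.∸ 2)}} c₂ →
  ∀ R′ → R (Defs.N m n t ℕ.+ n) ℤ.* R′ ≡ ℤ.1ℤ [mod 2 ℕ.^ m ] →
  Conclusion.Result ℂ m χ₁ χ₂ A B k k₁ n t c₁ c₂ R′
by-range ℂ {n = n} {t} (small u u≤ refl) 0<n χ₁ χ₂ prim A A₁ B k k₁ A≡ k≡ 2∤ c₁ c₂ 1≤c₁ c₁≤ χ₁5 χ₂5 R′ R′-inverse =
  Proof.SmallRange.result ℂ 0 t n (n ℕ.+ t ℕ.+ u) 0<n (ℕ.m≤m+n (n ℕ.+ t) u) (ℕ.+-monoʳ-≤ (n ℕ.+ t) u≤)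
    (N-small (2 ℕ.+ (0 ℕ.+ (n ℕ.+ t ℕ.+ u))) n t (small-bound n t u u≤)) χ₁ χ₂ prim A A₁ B k k₁ A≡ k≡ 2∤ c₁ c₂ χ₁5 χ₂5 R′ R′-inverse
    refl u refl (d-small n t u) (λ large → ℕ.<⇒≱ large (small-bound n t u u≤)) 1≤c₁ c₁≤
by-range ℂ {n = n} {t} (even s refl) 0<n χ₁ χ₂ prim A A₁ B k k₁ A≡ k≡ 2∤ c₁ c₂ 1≤c₁ c₁≤ χ₁5 χ₂5 R′ R′-inverse =
  Proof.EvenRange.result ℂ (ℕ.suc s) t n (n ℕ.+ t ℕ.+ (2 ℕ.+ ℕ.suc s ℕ.+ t)) 0<n (ℕ.m≤m+n (n ℕ.+ t) _) ℕ.≤-refl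
    (N-even n t s) χ₁ χ₂ prim A A₁ B k k₁ A≡ k≡ 2∤ c₁ c₂ χ₁5 χ₂5 R′ R′-inverse
    (large-even n t s) refl (3 ℕ.+ (s ℕ.+ t) , d-even n t s)
by-range ℂ {n = n} {t} (odd s refl) 0<n χ₁ χ₂ prim A A₁ B k k₁ A≡ k≡ 2∤ c₁ c₂ 1≤c₁ c₁≤ χ₁5 χ₂5 R′ R′-inverse =
  Proof.OddRange.result ℂ (ℕ.suc s) t n (n ℕ.+ t ℕ.+ (2 ℕ.+ (s ℕ.+ t))) 0<n (ℕ.m≤m+n (n ℕ.+ t) _) (ℕ.+-monoʳ-≤ (n ℕ.+ t) (ℕ.n≤1+n _))
    (N-odd n t s) χ₁ χ₂ prim A A₁ B k k₁ A≡ k≡ 2∤ c₁ c₂ χ₁5 χ₂5 R′ R′-inverse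
    (large-odd n t s) s refl refl (2 ℕ.+ (s ℕ.+ t) , d-odd n t s)

open import Defs
open import Data.Nat.Base using (_+_; _*_; _∸_; _^_; _≤_; _<_; _⊓_)
open import Data.Product.Base using (_×_; ∃)
open import Data.Sum.Base using (_⊎_)

theorem1p1 :
  ∀ {c ℓ₁ ℓ₂} (ℂ : ComplexField c ℓ₁ ℓ₂) →
  let open CharacterSums ℂ in
  ∀ (m : ℕ) → 3 ≤ m →
  (χ₁ χ₂ : DirichletCharacter (2 ^ m)) → Primitive χ₂ →
  ∀ (A A₁ B : ℤ) (k k₁ n t : ℕ) → 1 ≤ k →
  A ≡ + (2 ^ n) ℤ.* A₁ → 0 < n →
  k ≡ 2 ^ t * k₁ →
  ¬ (+ 2 ∣ A₁ ℤ.* + k₁ ℤ.* B) →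
  ∀ (c₁ c₂ : ℤ) →
  ℤ.1ℤ ℤ.≤ c₁ → c₁ ℤ.≤ + (2 ^ (m ∸ 2)) →
  ℤ.1ℤ ℤ.≤ c₂ → c₂ ℤ.≤ + (2 ^ (m ∸ 2)) →
  χ₁ ⟨ + 5 ⟩ ≈ e (2 ^ (m ∸ 2)) {{m^n≢0 2 (m ∸ 2)}} c₁ →
  χ₂ ⟨ + 5 ⟩ ≈ e (2 ^ (m ∸ 2)) {{m^n≢0 2 (m ∸ 2)}} c₂ →
  -- R′ is an inverse of R_{N+n} modulo 2^m
  ∀ (R′ : ℤ) → R (N m n t + n) ℤ.* R′ ≡ ℤ.1ℤ [mod 2 ^ m ] →
  t + 2 ≤ m ∸ n →
  let
    f : ℤ → ℤ
    f x = A ℤ.* x ℤ.^ k ℤ.+ B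

    S : Carrier
    S = ∑[1⋯ 2 ^ m ] (λ x → χ₁ ⟨ x ⟩ *ᶜ χ₂ ⟨ f x ⟩)

    C : ℤ → ℤ
    C x = c₁ ℤ.* f x ℤ.+ c₂ ℤ.* A ℤ.* + k ℤ.* x ℤ.^ k ℤ.* R (N m n t) ℤ.* R′

    M : ℕ
    M = 2 ^ (⌊ m + n /2⌋ + t)

    Solution : ℤ → Set
    Solution x₀ = ¬ (+ 2 ∣ x₀ ℤ.* f x₀) × C x₀ ≡ ℤ.0ℤ [mod M ]

    Form : ℤ → Set
    Form c₃ = (c₁ ≡ + (2 ^ (n + t)) ℤ.* c₃) × ¬ (+ 2 ∣ c₃)

    kEven : Set
    kEven = + 2 ∣ + k

    kOdd : Set
    kOdd = ¬ (+ 2 ∣ + k)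
  in
  (¬ (∃ Form ×
      (kEven → χ₁ ⟨ ℤ.-1ℤ ⟩ ≈ 1#) ×
      (2 * t + 4 < m ∸ n → ∃ Solution)) →
   S ≈ 0#)
  ×
  (∀ (c₃ : ℤ) → Form c₃ →
   (kEven → χ₁ ⟨ ℤ.-1ℤ ⟩ ≈ 1#) →
   (2 * t + 4 < m ∸ n → ∃ Solution) →
   -- (i)
   (2 * t + 4 < m ∸ n →
    ∀ (x₀ l : ℤ) → Solution x₀ → C x₀ ≡ l ℤ.* + M →
    let
      h : ℤ
      h = + 2 ℤ.* l ℤ.+ (+ k₁ ℤ.- ℤ.1ℤ) ℤ.+ (+ (2 ^ n) ℤ.- ℤ.1ℤ) ℤ.* c₃

      -- 2^{(m+n)/2 + t + min(1,t)} χ₁(x₀) χ₂(A x₀^k + B)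
      V : Carrier
      V = √2 ^ᶜ (m + n + 2 * (t + (1 ⊓ t))) *ᶜ χ₁ ⟨ x₀ ⟩ *ᶜ χ₂ ⟨ f x₀ ⟩
    in
    (+ 2 ∣ + (m ∸ n) → S ≈ V) ×
    (¬ (+ 2 ∣ + (m ∸ n)) → S ≈ V *ᶜ (ω^ h *ᶜ fromℤ (jacobi (+ 2) h))))
   ×
   -- (ii)
   (t + 3 < m ∸ n → m ∸ n ≤ 2 * t + 4 →
    let
      P₁ : Set
      P₁ = kEven × C ℤ.1ℤ ≡ ℤ.0ℤ [mod 2 ^ (m ∸ 2) ]

      P₂ : Set
      P₂ = kOdd × C ℤ.1ℤ ≡ ℤ.0ℤ [mod 2 ^ (m ∸ 2) ]

      P₃ : Set
      P₃ = kOdd × C ℤ.-1ℤ ≡ ℤ.0ℤ [mod 2 ^ (m ∸ 2) ]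
    in
    (P₁ → S ≈ 2# ^ᶜ (m ∸ 1) *ᶜ χ₂ ⟨ A ℤ.+ B ⟩) ×
    (P₂ → S ≈ 2# ^ᶜ (m ∸ 2) *ᶜ χ₂ ⟨ A ℤ.+ B ⟩) ×
    (P₃ → S ≈ 2# ^ᶜ (m ∸ 2) *ᶜ χ₁ ⟨ ℤ.-1ℤ ⟩ *ᶜ χ₂ ⟨ ℤ.- A ℤ.+ B ⟩) ×
    (¬ (P₁ ⊎ P₂ ⊎ P₃) → S ≈ 0#))
   ×
   -- (iii)
   (m ∸ n ≡ t + 3 →
    let
      χ₁[5]=±1 = χ₁ ⟨ + 5 ⟩ ≈ 1# ⊎ χ₁ ⟨ + 5 ⟩ ≈ -ᶜ 1#
      Q₁ = kEven × χ₁[5]=±1 × χ₁ ⟨ ℤ.-1ℤ ⟩ ≈ 1#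
      Q₂ = kOdd × χ₁[5]=±1
    in
    (Q₁ → S ≈ 2# ^ᶜ (m ∸ 1) *ᶜ χ₂ ⟨ A ℤ.+ B ⟩) ×
    (Q₂ → S ≈ 2# ^ᶜ (m ∸ 2) *ᶜ (χ₂ ⟨ A ℤ.+ B ⟩ +ᶜ χ₁ ⟨ ℤ.-1ℤ ⟩ *ᶜ χ₂ ⟨ ℤ.- A ℤ.+ B ⟩)) ×
    (¬ (Q₁ ⊎ Q₂) → S ≈ 0#))
   ×
   -- (iv)
   (m ∸ n ≡ t + 2 →
    let
      T = (kEven × (χ₁ ⟨_⟩) ≐ principal (2 ^ m)) ⊎ (kOdd × (χ₁ ⟨_⟩) ≐ χ₄)
    in
    (T → S ≈ 2# ^ᶜ (m ∸ 1) *ᶜ χ₂ ⟨ A ℤ.+ B ⟩) ×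
    (¬ T → S ≈ 0#)))
theorem1p1 ℂ m _ χ₁ χ₂ prim A A₁ B k k₁ n t _ A≡ 0<n k≡ 2∤ c₁ c₂ 1≤c₁ c₁≤ _ _ χ₁5 χ₂5 R′ R′-inverse t+2≤m∸n =
  by-range ℂ (range m n t t+2≤m∸n) 0<n χ₁ χ₂ prim A A₁ B k k₁ A≡ k≡ 2∤ c₁ c₂ 1≤c₁ c₁≤ χ₁5 χ₂5 R′ R′-inverse
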